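{- Let $E(q)=\prod_{k\ge1}(1-q^k)$, $$X=\frac{E(q^2)^4E(q^3)^8}{E(q)^8E(q^6)^4},\qquad \xi=q^{ -2}\frac{E(q^2)^5E(q^9)^4}{E(q)^4E(q^{18})^5}.$$ For a formal Laurent series $\sum_{n\ge n_0}a_nq^n$ define $U\left(\sum_{n\ge n_0}a_nq^n\right)=\sum_{3n\ge n_0}a_{3n}q^n$. Then \begin{align*} U(\xi)&=9X,\\ U(\xi X)&=-9X+252X^2-891X^3+729X^4,\\ U(\xi X^2)&=X-378X^2+8613X^3-54675X^4+138510X^5-150903X^6+59049X^7,\\ U(\xi X^3)&=147X^2-14553X^3+312255X^4-2617839X^5+10764414X^6\\ &\qquad-23914845X^7+29288304X^8-18600435X^9+4782969X^{10}. \end{align*}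
   Context: All objects are formal Laurent series in $q$. -}

module Defs where

open import Data.Nat as ℕ using (ℕ; zero; suc; _∸_; NonZero)
open import Data.Nat.DivMod using (_/_; _%_)
open import Data.Integer as ℤ using (ℤ; +_; -[1+_]; _+_; _*_; -_; _-_)
open import Data.List using (List; []; _∷_)
open import Relation.Nullary using (does)
open import Data.Bool using (if_then_else_)

Series : Set
Series = ℕ → ℤ

zeroS : Series
zeroS _ = + 0

oneS : Series
oneS zero    = + 1
oneS (suc _) = + 0

monoS : ℕ → Series
monoS k n = if does (n ℕ.≟ k) then + 1 else + 0

_+S_ : Series → Series → Series
(f +S g) n = f n + g n

_-S_ : Series → Series → Series
(f -S g) n = f n - g n

_·S_ : ℤ → Series → Series
(c ·S f) n = c * f n

sum< : ℕ → (ℕ → ℤ) → ℤ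
sum< zero    h = + 0
sum< (suc n) h = sum< n h + h n

_*S_ : Series → Series → Series
(f *S g) n = sum< (suc n) (λ i → f i * g (n ∸ i))

_^S_ : Series → ℕ → Series
f ^S zero  = oneS
f ^S suc k = f *S (f ^S k)

dil : (m : ℕ) → .{{NonZero m}} → Series → Series
dil m f n = if does (n % m ℕ.≟ 0) then f (n / m) else + 0

-- Multiplicative inverse of a series with constant term 1
-- (b_0 = 1, b_n = - Σ_{i=1}^n f_i b_{n-i}).
-- invRev f n = [b_n , b_{n-1} , ... , b_0]
private
  convRev : Series → ℕ → List ℤ → ℤ
  convRev f i []       = + 0
  convRev f i (b ∷ bs) = f i * b + convRev f (suc i) bs

invRev : Series → ℕ → List ℤ
invRev f zero    = + 1 ∷ []
invRev f (suc n) = (- convRev f 1 (invRev f n)) ∷ invRev f n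

invS : Series → Series
invS f n with invRev f n
... | []    = + 0
... | b ∷ _ = b

-- E(q) = ∏_{k≥1} (1 - q^k), as a formal power series.
-- Epart N = ∏_{k=1}^{N} (1 - q^k); the coefficient of q^n in E(q)
-- equals that of Epart n (factors with k > n do not contribute).

Epart : ℕ → Series
Epart zero    = oneS
Epart (suc N) = Epart N *S (oneS -S monoS (suc N))

E : Series
E n = Epart n n

Eq : (m : ℕ) → .{{NonZero m}} → Series
Eq m = dil m E

-- Formal Laurent series of the form q^{-s} · f with f a power series.

record Laurent : Set where
  constructor laurent
  field
    shift : ℕ
    ser   : Series
open Laurent public

coeffL : Laurent → ℤ → ℤ
coeffL (laurent s f) n with n + + s
... | + m      = f m
... | -[1+ _ ] = + 0

fromSeries : Series → Laurent
fromSeries f = laurent 0 f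

_*L_ : Laurent → Laurent → Laurent
laurent s f *L laurent t g = laurent (s ℕ.+ t) (f *S g)

_^L_ : Laurent → ℕ → Laurent
x ^L zero  = fromSeries oneS
x ^L suc k = x *L (x ^L k)

U : (ℤ → ℤ) → (ℤ → ℤ)
U a n = a (+ 3 * n)

_+L_ : Laurent → Laurent → Laurent
a +L b = laurent m (λ n → coeffL a (+ n - + m) + coeffL b (+ n - + m))
  where m = shift a ℕ.⊔ shift b

polyL : List ℤ → Laurent → Laurent
polyL []       x = fromSeries zeroS
polyL (c ∷ cs) x = fromSeries (c ·S oneS) +L (x *L polyL cs x)

X : Laurent
X = fromSeries (((Eq 2 ^S 4) *S (Eq 3 ^S 8)) *S invS ((Eq 1 ^S 8) *S (Eq 6 ^S 4)))

ξ : Laurent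
ξ = laurent 2 (((Eq 2 ^S 5) *S (Eq 9 ^S 4)) *S invS ((Eq 1 ^S 4) *S (Eq 18 ^S 5)))

{-# OPTIONS --safe #-}
module Submission where

-- Write φ(-q) = E(q)²/E(q²), ψ(q) = E(q²)²/E(q) and W = q E(q³)E(q¹⁸)³/(E(q⁶)E(q⁹)³).  Jacobi's
-- triple product, proved in finite form with Gaussian binomials and read modulo q^N, turns
-- φ(-q), ψ(q) and their 3-dissections into the relations
--   φ(-q) = φ(-q⁹)(1 - 2W),   W ψ(q) = q ψ(q⁹)(1 + W).
-- The norm ∏ f(ζ q^{1/3}) over the cube roots of unity ζ, applied to the first relation, gives
-- 1/X = 1 - 8v with v(q³) = W³.  With P = 1 + 2W + 4W² and Y = X(q³) this yields X = P⁴Y³ and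
--   q²ξX^k = (q/W)² (1 + W)² P^{4k+1} Y^{3k+1}.
-- As q/W and Y are series in q³, U keeps the powers W^{3j+2} only, so U(ξX^k) is X^{3k+1} times
-- a polynomial in v = (1 - 1/X)/8, hence a polynomial in X found by computation.

-- In both theta series the exponents meet only the residues 0 and 1 modulo 3, and the ratios of the
-- second component to the first are -2W and W. That the same W occurs twice is why one variable
-- suffices for X and ξ. Up to series in q³, X and ξ have powers of 1 - 2W in the denominator; as (1
-- - 2W) P = 1 - 8W³ is a series in q³, dividing by 1 - 2W amounts to multiplying by P, and only
-- polynomials in W remain. The shape of the answers is then forced. The polynomial (1 + W)²
-- P^{4k+1} has degree 8k + 4, so its part of exponents 3j + 2 has degree at most 3k in v, and
-- X^{3k+1} turns it into a polynomial in X of degree at most 3k + 1 without constant term. The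
-- coefficient of X^{3k+1} is the value at v = 1/8, that is W = 1/2: at the other two cube roots of
-- 1/8 the factor P vanishes, which leaves 3^{4k+2}, namely 9, 729, 59049 and 4782969.

open import Defs
open import Data.Integer using (ℤ; +_; -[1+_]; -_)
open import Data.List using (List; []; _∷_)
open import Data.Product using (_×_)
open import Relation.Binary.PropositionalEquality using (_≡_)

open import Algebra.Bundles using (CommutativeRing)
open import Algebra.Solver.Ring.AlmostCommutativeRing
  using (fromCommutativeRing; _-Raw-AlmostCommutative⟶_)
import Algebra.Solver.Ring as RingSolver
open import Algebra.Structures using (IsCommutativeRing)
open import Data.Bool using (if_then_else_; true; false)
open import Data.Integer as ℤ using ()
import Data.Integer.Properties as ℤₚ
import Data.Integer.Tactic.RingSolver as ℤ-Solver
open import Data.List using (length; map; _ʳ++_; reverse)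
open import Data.List.Relation.Unary.All using (All; []; _∷_; all?)
open import Data.Maybe using (Maybe; just; nothing)
open import Data.Nat as ℕ using (ℕ; zero; suc; _∸_; _<_; _≤_; z≤n; s≤s; NonZero)
import Data.Nat.DivMod as ℕ
import Data.Nat.Properties as ℕₚ
import Data.Nat.Tactic.RingSolver as ℕ-Solver
open import Data.Product using (_,_; proj₁; proj₂; ∃)
open import Data.Sum using (inj₁; inj₂)
open import Function using (_∘_)
open import Level using (0ℓ)
open import Relation.Binary using (Setoid)
open import Relation.Binary.PropositionalEquality
  using (_≢_; refl; sym; trans; cong; cong₂; subst; module ≡-Reasoning)
open import Relation.Nullary using (yes; no; does)
open import Relation.Nullary.Decidable using (dec-false; True; toWitness)

-- The ring of power series

infix 4 _≈_

record _≈_ (f g : Series) : Set where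
  constructor pointwise
  field at : ∀ n → f n ≡ g n
open _≈_

≈-refl : ∀ {f} → f ≈ f
≈-refl = pointwise λ _ → refl

≈-sym : ∀ {f g} → f ≈ g → g ≈ f
≈-sym p = pointwise λ n → sym (at p n)

≈-trans : ∀ {f g h} → f ≈ g → g ≈ h → f ≈ h
≈-trans p r = pointwise λ n → trans (at p n) (at r n)

tail : Series → Series
tail f n = f (suc n)

sum<-cong : ∀ n {h k : ℕ → ℤ} → (∀ i → i < n → h i ≡ k i) → sum< n h ≡ sum< n k
sum<-cong zero    p = refl
sum<-cong (suc n) p =
  cong₂ ℤ._+_ (sum<-cong n λ i i<n → p i (ℕₚ.m<n⇒m<1+n i<n)) (p n ℕₚ.≤-refl)

sum<-first : ∀ n (h : ℕ → ℤ) → sum< (suc n) h ≡ h 0 ℤ.+ sum< n (h ∘ suc)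
sum<-first zero    h = ℤₚ.+-comm (+ 0) (h 0)
sum<-first (suc n) h = trans (cong (ℤ._+ h (suc n)) (sum<-first n h))
  (ℤₚ.+-assoc (h 0) (sum< n (h ∘ suc)) (h (suc n)))

*S-zero : ∀ f g → (f *S g) 0 ≡ f 0 ℤ.* g 0
*S-zero f g = ℤₚ.+-identityˡ _

-- Peeling off the constant term turns the ring laws into inductions on the index with `tail f` in
-- place of `f`, so that no double sum has to be rearranged.
*S-sucˡ : ∀ f g n → (f *S g) (suc n) ≡ f 0 ℤ.* g (suc n) ℤ.+ (tail f *S g) n
*S-sucˡ f g n = sum<-first (suc n) λ i → f i ℤ.* g (suc n ∸ i)

*S-sucʳ : ∀ f g n → (f *S g) (suc n) ≡ (f *S tail g) n ℤ.+ f (suc n) ℤ.* g 0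
*S-sucʳ f g n = cong₂ ℤ._+_
  (sum<-cong (suc n) λ { i (s≤s i≤n) → cong (λ j → f i ℤ.* g j) (ℕₚ.+-∸-assoc 1 i≤n) })
  (cong (λ j → f (suc n) ℤ.* g j) (ℕₚ.n∸n≡0 n))

*S-pointwise-cong : ∀ n {f f′ g g′} →
  (∀ i → i ≤ n → f i ≡ f′ i) → (∀ i → i ≤ n → g i ≡ g′ i) → (f *S g) n ≡ (f′ *S g′) n
*S-pointwise-cong n p r = sum<-cong (suc n)
  λ { i (s≤s i≤n) → cong₂ ℤ._*_ (p i i≤n) (r (n ∸ i) (ℕₚ.m∸n≤m n i)) }

*S-cong : ∀ {f f′ g g′} → f ≈ f′ → g ≈ g′ → f *S g ≈ f′ *S g′
*S-cong p r = pointwise λ n → *S-pointwise-cong n (λ i _ → at p i) (λ i _ → at r i)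

*S-comm : ∀ f g → f *S g ≈ g *S f
*S-comm f g = pointwise (go f g)
  where
  go : ∀ f g n → (f *S g) n ≡ (g *S f) n
  go f g zero    = cong (λ x → + 0 ℤ.+ x) (ℤₚ.*-comm (f 0) (g 0))
  go f g (suc n) = begin
    (f *S g) (suc n)                           ≡⟨ *S-sucˡ f g n ⟩
    f 0 ℤ.* g (suc n) ℤ.+ (tail f *S g) n      ≡⟨ ℤₚ.+-comm (f 0 ℤ.* g (suc n)) _ ⟩
    (tail f *S g) n ℤ.+ f 0 ℤ.* g (suc n)      ≡⟨ cong₂ ℤ._+_ (go (tail f) g n) (ℤₚ.*-comm (f 0) (g (suc n))) ⟩
    (g *S tail f) n ℤ.+ g (suc n) ℤ.* f 0      ≡⟨ *S-sucʳ g f n ⟨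
    (g *S f) (suc n)                           ∎
    where open ≡-Reasoning

*S-distribʳ : ∀ h f g → (f +S g) *S h ≈ (f *S h) +S (g *S h)
*S-distribʳ h f g = pointwise (go f g)
  where
  go : ∀ f g n → ((f +S g) *S h) n ≡ (f *S h) n ℤ.+ (g *S h) n
  go f g zero    = alg (f 0) (g 0) (h 0)
    where
    alg : ∀ a b c → + 0 ℤ.+ (a ℤ.+ b) ℤ.* c ≡ (+ 0 ℤ.+ a ℤ.* c) ℤ.+ (+ 0 ℤ.+ b ℤ.* c)
    alg = ℤ-Solver.solve-∀
  go f g (suc n) = begin
    ((f +S g) *S h) (suc n)                           ≡⟨ *S-sucˡ (f +S g) h n ⟩
    (f 0 ℤ.+ g 0) ℤ.* h (suc n) ℤ.+ ((tail f +S tail g) *S h) n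
      ≡⟨ cong (ℤ._+_ ((f 0 ℤ.+ g 0) ℤ.* h (suc n))) (go (tail f) (tail g) n) ⟩
    (f 0 ℤ.+ g 0) ℤ.* h (suc n) ℤ.+ ((tail f *S h) n ℤ.+ (tail g *S h) n)
      ≡⟨ alg (f 0) (g 0) (h (suc n)) _ _ ⟩
    (f 0 ℤ.* h (suc n) ℤ.+ (tail f *S h) n) ℤ.+ (g 0 ℤ.* h (suc n) ℤ.+ (tail g *S h) n)
      ≡⟨ cong₂ ℤ._+_ (*S-sucˡ f h n) (*S-sucˡ g h n) ⟨
    (f *S h) (suc n) ℤ.+ (g *S h) (suc n)             ∎
    where
    open ≡-Reasoning
    alg : ∀ a b c u v → (a ℤ.+ b) ℤ.* c ℤ.+ (u ℤ.+ v) ≡ (a ℤ.* c ℤ.+ u) ℤ.+ (b ℤ.* c ℤ.+ v)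
    alg = ℤ-Solver.solve-∀

·S-*S : ∀ c f g → (c ·S f) *S g ≈ c ·S (f *S g)
·S-*S c f g = pointwise (go f)
  where
  go : ∀ f n → ((c ·S f) *S g) n ≡ c ℤ.* (f *S g) n
  go f zero    = alg c (f 0) (g 0)
    where
    alg : ∀ c a b → + 0 ℤ.+ c ℤ.* a ℤ.* b ≡ c ℤ.* (+ 0 ℤ.+ a ℤ.* b)
    alg = ℤ-Solver.solve-∀
  go f (suc n) = begin
    ((c ·S f) *S g) (suc n)                                   ≡⟨ *S-sucˡ (c ·S f) g n ⟩
    c ℤ.* f 0 ℤ.* g (suc n) ℤ.+ ((c ·S tail f) *S g) n        ≡⟨ cong (ℤ._+_ (c ℤ.* f 0 ℤ.* g (suc n))) (go (tail f) n) ⟩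
    c ℤ.* f 0 ℤ.* g (suc n) ℤ.+ c ℤ.* (tail f *S g) n         ≡⟨ alg c (f 0) (g (suc n)) _ ⟩
    c ℤ.* (f 0 ℤ.* g (suc n) ℤ.+ (tail f *S g) n)             ≡⟨ cong (c ℤ.*_) (*S-sucˡ f g n) ⟨
    c ℤ.* (f *S g) (suc n)                                    ∎
    where
    open ≡-Reasoning
    alg : ∀ c a b u → c ℤ.* a ℤ.* b ℤ.+ c ℤ.* u ≡ c ℤ.* (a ℤ.* b ℤ.+ u)
    alg = ℤ-Solver.solve-∀

*S-assoc : ∀ f g h → (f *S g) *S h ≈ f *S (g *S h)
*S-assoc f g h = pointwise (go f)
  where
  go : ∀ f n → ((f *S g) *S h) n ≡ (f *S (g *S h)) n
  go f zero    = alg (f 0) (g 0) (h 0)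
    where
    alg : ∀ a b c → + 0 ℤ.+ (+ 0 ℤ.+ a ℤ.* b) ℤ.* c ≡ + 0 ℤ.+ a ℤ.* (+ 0 ℤ.+ b ℤ.* c)
    alg = ℤ-Solver.solve-∀
  go f (suc n) = begin
    ((f *S g) *S h) (suc n)
      ≡⟨ *S-sucˡ (f *S g) h n ⟩
    (f *S g) 0 ℤ.* h (suc n) ℤ.+ (tail (f *S g) *S h) n
      -- The tail of a product is `(f 0 ·S tail g) +S (tail f *S g)`; its second summand is where
      -- the induction hypothesis for `tail f` applies.
      ≡⟨ cong₂ (λ x y → x ℤ.* h (suc n) ℤ.+ y) (*S-zero f g)
           (trans (*S-pointwise-cong n {g = h} (λ i _ → *S-sucˡ f g i) (λ _ _ → refl))
             (trans (at (*S-distribʳ h (f 0 ·S tail g) (tail f *S g)) n)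
               (cong₂ ℤ._+_ (at (·S-*S (f 0) (tail g) h) n) (go (tail f) n)))) ⟩
    f 0 ℤ.* g 0 ℤ.* h (suc n) ℤ.+ (f 0 ℤ.* (tail g *S h) n ℤ.+ (tail f *S (g *S h)) n)
      ≡⟨ alg (f 0) (g 0) (h (suc n)) _ _ ⟩
    f 0 ℤ.* (g 0 ℤ.* h (suc n) ℤ.+ (tail g *S h) n) ℤ.+ (tail f *S (g *S h)) n
      ≡⟨ cong (λ x → f 0 ℤ.* x ℤ.+ (tail f *S (g *S h)) n) (*S-sucˡ g h n) ⟨
    f 0 ℤ.* (g *S h) (suc n) ℤ.+ (tail f *S (g *S h)) n
      ≡⟨ *S-sucˡ f (g *S h) n ⟨
    (f *S (g *S h)) (suc n) ∎
    where
    open ≡-Reasoning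
    alg : ∀ a b c u v → a ℤ.* b ℤ.* c ℤ.+ (a ℤ.* u ℤ.+ v) ≡ a ℤ.* (b ℤ.* c ℤ.+ u) ℤ.+ v
    alg = ℤ-Solver.solve-∀

zeroS-*S : ∀ f → zeroS *S f ≈ zeroS
zeroS-*S f = pointwise go
  where
  go : ∀ n → (zeroS *S f) n ≡ + 0
  go zero    = refl
  go (suc n) = trans (*S-sucˡ zeroS f n) (trans (ℤₚ.+-identityˡ _) (go n))

oneS-*S : ∀ f → oneS *S f ≈ f
oneS-*S f = pointwise go
  where
  go : ∀ n → (oneS *S f) n ≡ f n
  go zero    = alg (f 0)
    where
    alg : ∀ a → + 0 ℤ.+ + 1 ℤ.* a ≡ a
    alg = ℤ-Solver.solve-∀
  go (suc n) = trans (*S-sucˡ oneS f n)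
    (trans (cong₂ ℤ._+_ (ℤₚ.*-identityˡ (f (suc n))) (at (zeroS-*S f) n)) (ℤₚ.+-identityʳ _))

-- Agda compares terms of function type after η-expansion, which would unfold the
-- operations of Defs and block the inference of their arguments; hence opaque copies.
opaque
  infixl 6 _+_
  infixl 7 _*_
  infix  8 q^_

  _+_ _*_ : Series → Series → Series
  _+_ = _+S_
  _*_ = _*S_

  neg : Series → Series
  neg f n = - f n

  ι : ℤ → Series
  ι c = c ·S oneS

  q^_ : ℕ → Series
  q^_ = monoS

  D : (m : ℕ) → .{{NonZero m}} → Series → Series
  D = dil

opaque
  unfolding _+_

  isCommutativeRing : IsCommutativeRing _≈_ _+_ _*_ neg zeroS oneS
  isCommutativeRing = record
    { isRing = record
      { +-isAbelianGroup = record
        { isGroup = record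
          { isMonoid = record
            { isSemigroup = record
              { isMagma = record
                { isEquivalence = record { refl = ≈-refl ; sym = ≈-sym ; trans = ≈-trans }
                ; ∙-cong = λ p r → pointwise λ n → cong₂ ℤ._+_ (at p n) (at r n) }
              ; assoc = λ f g h → pointwise λ n → ℤₚ.+-assoc (f n) (g n) (h n) }
            ; identity = (λ f → pointwise λ n → ℤₚ.+-identityˡ (f n))
                       , (λ f → pointwise λ n → ℤₚ.+-identityʳ (f n)) }
          ; inverse = (λ f → pointwise λ n → ℤₚ.+-inverseˡ (f n))
                    , (λ f → pointwise λ n → ℤₚ.+-inverseʳ (f n))
          ; ⁻¹-cong = λ p → pointwise λ n → cong -_ (at p n) }
        ; comm = λ f g → pointwise λ n → ℤₚ.+-comm (f n) (g n) }
      ; *-cong = *S-cong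
      ; *-assoc = *S-assoc
      ; *-identity = oneS-*S , (λ f → ≈-trans (*S-comm f oneS) (oneS-*S f))
      ; distrib = (λ f g h → ≈-trans (*S-comm f (g +S h))
                    (≈-trans (*S-distribʳ f g h)
                      (pointwise λ n → cong₂ ℤ._+_ (at (*S-comm g f) n) (at (*S-comm h f) n))))
                , *S-distribʳ }
    ; *-comm = *S-comm }

seriesRing : CommutativeRing 0ℓ 0ℓ
seriesRing = record { isCommutativeRing = isCommutativeRing }

open CommutativeRing seriesRing
  using (_-_; +-cong; *-cong; +-congˡ; +-congʳ; *-congˡ; *-congʳ; setoid;
         +-identityˡ; +-identityʳ; *-identityˡ; *-identityʳ; *-comm; zeroˡ; zeroʳ)
  renaming (-‿cong to neg-cong)
open import Algebra.Properties.Semiring.Exp (CommutativeRing.semiring seriesRing)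
  using (_^_; ^-congˡ)
open import Algebra.Properties.CommutativeSemiring.Exp (CommutativeRing.commutativeSemiring seriesRing)
  using (^-distrib-*)

opaque
  unfolding _+_

  +-at : ∀ f g n → (f + g) n ≡ f n ℤ.+ g n
  +-at f g n = refl

  ι-* : ∀ c f → ι c * f ≈ c ·S f
  ι-* c f = ≈-trans (·S-*S c oneS f) (pointwise λ n → cong (c ℤ.*_) (at (oneS-*S f) n))

  ι-homo-+ : ∀ x y → ι (x ℤ.+ y) ≈ ι x + ι y
  ι-homo-+ x y = pointwise λ n → ℤₚ.*-distribʳ-+ (oneS n) x y

  ι-homo-* : ∀ x y → ι (x ℤ.* y) ≈ ι x * ι y
  ι-homo-* x y = ≈-sym (≈-trans (ι-* x (ι y)) (pointwise λ n → sym (ℤₚ.*-assoc x y (oneS n))))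

  ι-homo-neg : ∀ x → ι (- x) ≈ neg (ι x)
  ι-homo-neg x = pointwise λ n → sym (ℤₚ.neg-distribˡ-* x (oneS n))

  ι-zero : ι (+ 0) ≈ zeroS
  ι-zero = pointwise λ n → ℤₚ.*-zeroˡ (oneS n)

  ι-one : ι (+ 1) ≈ oneS
  ι-one = pointwise λ n → ℤₚ.*-identityˡ (oneS n)

ι-morphism : ℤ.+-*-rawRing -Raw-AlmostCommutative⟶ fromCommutativeRing seriesRing
ι-morphism = record
  { ⟦_⟧ = ι ; +-homo = ι-homo-+ ; *-homo = ι-homo-* ; -‿homo = ι-homo-neg
  ; 0-homo = ι-zero ; 1-homo = ι-one }

private
  ι-≟ : ∀ x y → Maybe (ι x ≈ ι y)
  ι-≟ x y with x ℤ.≟ y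
  ... | yes refl = just ≈-refl
  ... | no _     = nothing

module S = RingSolver ℤ.+-*-rawRing (fromCommutativeRing seriesRing) ι-morphism ι-≟
open S using (solve; _:=_; _:+_; _:*_; _:-_; :-_; _:^_; con)

-- `con (+ 1)` denotes `ι (+ 1)`, which is opaque; a zeroth power denotes `oneS` itself, so
-- equations that mention `oneS` match by computation.
:1 : ∀ {n} → S.Polynomial n
:1 = con (+ 1) :^ 0

import Relation.Binary.Reasoning.Setoid setoid as ≈-R

-- Congruence modulo q^N

infix 4 _≈[_]_

record _≈[_]_ (f : Series) (N : ℕ) (g : Series) : Set where
  constructor below
  field at< : ∀ n → n < N → f n ≡ g n
open _≈[_]_

truncSetoid : ℕ → Setoid 0ℓ 0ℓ
truncSetoid N = record
  { Carrier = Series ; _≈_ = _≈[ N ]_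
  ; isEquivalence = record
    { refl  = below λ _ _ → refl
    ; sym   = λ p → below λ n n<N → sym (at< p n n<N)
    ; trans = λ p r → below λ n n<N → trans (at< p n n<N) (at< r n n<N) } }

module ≈[]-R {N : ℕ} where
  open import Relation.Binary.Reasoning.Setoid (truncSetoid N) public

module _ {N : ℕ} where
  open Setoid (truncSetoid N) public using ()
    renaming (refl to trunc-refl; trans to trunc-trans)

trunc : ∀ {N f g} → f ≈ g → f ≈[ N ] g
trunc p = below λ n _ → at p n

untrunc : ∀ {f g} → (∀ N → f ≈[ N ] g) → f ≈ g
untrunc p = pointwise λ n → at< (p (suc n)) n ℕₚ.≤-refl

weaken : ∀ {M N f g} → M ≤ N → f ≈[ N ] g → f ≈[ M ] g
weaken M≤N p = below λ n n<M → at< p n (ℕₚ.<-≤-trans n<M M≤N)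

module _ {N : ℕ} {f f′ g g′ : Series} where
  opaque
    unfolding _+_

    trunc-+ : f ≈[ N ] f′ → g ≈[ N ] g′ → f + g ≈[ N ] f′ + g′
    trunc-+ p r = below λ n n<N → cong₂ ℤ._+_ (at< p n n<N) (at< r n n<N)

    trunc-- : f ≈[ N ] f′ → g ≈[ N ] g′ → f - g ≈[ N ] f′ - g′
    trunc-- p r = below λ n n<N → cong₂ ℤ._-_ (at< p n n<N) (at< r n n<N)

    trunc-* : f ≈[ N ] f′ → g ≈[ N ] g′ → f * g ≈[ N ] f′ * g′
    trunc-* p r = below λ n n<N → *S-pointwise-cong n
      (λ i i≤n → at< p i (ℕₚ.≤-<-trans i≤n n<N)) (λ i i≤n → at< r i (ℕₚ.≤-<-trans i≤n n<N))

trunc-*ˡ : ∀ {N f g} h → f ≈[ N ] g → h * f ≈[ N ] h * g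
trunc-*ˡ h = trunc-* (trunc-refl {x = h})

trunc-*ʳ : ∀ {N f g} h → f ≈[ N ] g → f * h ≈[ N ] g * h
trunc-*ʳ h p = trunc-* p (trunc-refl {x = h})

*-cancel-unit : ∀ {N u v f g} → u * v ≈ oneS → u * f ≈[ N ] u * g → f ≈[ N ] g
*-cancel-unit {N} {u} {v} {f} {g} uv p = begin
  f             ≈⟨ trunc (strip f) ⟨
  v * (u * f)   ≈⟨ trunc-*ˡ v p ⟩
  v * (u * g)   ≈⟨ trunc (strip g) ⟩
  g             ∎
  where
  open ≈[]-R {N}
  strip : ∀ h → v * (u * h) ≈ h
  strip h = ≈-trans (solve 3 (λ u v h → v :* (u :* h) := (u :* v) :* h) ≈-refl u v h)
    (≈-trans (*-congʳ uv) (*-identityˡ h))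

-- The recursion of invS runs through a private function of Defs; the placeholder
-- below is solved to it by unification.

private
  mutual
    convRev : Series → ℕ → List ℤ → ℤ
    convRev = _

    invS-suc : ∀ f n → invS f (suc n) ≡ - convRev f 1 (invRev f n)
    invS-suc f n with 1 | invRev f n
    ... | i | bs = refl {x = - convRev f i bs}

  -- The list `invRev f n` runs from the coefficient of index n down to index 0, so pairing it with
  -- `f i`, `f (i + 1)`, ... is a convolution. The case i = 1 is the recursion that defines the
  -- inverse.
  convRev-invRev : ∀ f i n → convRev f i (invRev f n) ≡ ((λ j → f (i ℕ.+ j)) *S invS f) n
  convRev-invRev f i zero = begin
    f i ℤ.* + 1 ℤ.+ + 0                        ≡⟨ ℤₚ.+-comm (f i ℤ.* + 1) (+ 0) ⟩
    + 0 ℤ.+ f i ℤ.* + 1                        ≡⟨ cong (λ j → + 0 ℤ.+ f j ℤ.* + 1) (ℕₚ.+-identityʳ i) ⟨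
    + 0 ℤ.+ f (i ℕ.+ 0) ℤ.* + 1                ∎
    where open ≡-Reasoning
  convRev-invRev f i (suc n) = begin
    f i ℤ.* invS f (suc n) ℤ.+ convRev f (suc i) (invRev f n)
      ≡⟨ cong₂ ℤ._+_ (cong (λ j → f j ℤ.* invS f (suc n)) (sym (ℕₚ.+-identityʳ i)))
           (trans (convRev-invRev f (suc i) n)
             (*S-pointwise-cong n {g = invS f} (λ j _ → cong f (sym (ℕₚ.+-suc i j))) (λ _ _ → refl))) ⟩
    f (i ℕ.+ 0) ℤ.* invS f (suc n) ℤ.+ (tail (λ j → f (i ℕ.+ j)) *S invS f) n
      ≡⟨ *S-sucˡ (λ j → f (i ℕ.+ j)) (invS f) n ⟨
    ((λ j → f (i ℕ.+ j)) *S invS f) (suc n) ∎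
    where open ≡-Reasoning

opaque
  unfolding _+_

  *-invS : ∀ f → f 0 ≡ + 1 → f * invS f ≈ oneS
  *-invS f f0 = pointwise go
    where
    open ≡-Reasoning
    alg : ∀ a → + 1 ℤ.* - a ℤ.+ a ≡ + 0
    alg = ℤ-Solver.solve-∀
    go : ∀ n → (f *S invS f) n ≡ oneS n
    go zero    = cong (λ a → + 0 ℤ.+ a ℤ.* + 1) f0
    go (suc n) = begin
      (f *S invS f) (suc n)                                      ≡⟨ *S-sucˡ f (invS f) n ⟩
      f 0 ℤ.* invS f (suc n) ℤ.+ (tail f *S invS f) n
        ≡⟨ cong₂ ℤ._+_ (cong₂ ℤ._*_ f0 (trans (invS-suc f n) (cong -_ (convRev-invRev f 1 n)))) refl ⟩
      + 1 ℤ.* - (tail f *S invS f) n ℤ.+ (tail f *S invS f) n    ≡⟨ alg ((tail f *S invS f) n) ⟩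
      + 0                                                        ∎

-- Monomials

opaque
  unfolding _+_

  mono-0 : q^ 0 ≈ oneS
  mono-0 = pointwise λ { zero → refl ; (suc n) → refl }

  mono-suc-*-zero : ∀ k f → (q^ suc k * f) 0 ≡ + 0
  mono-suc-*-zero k f = refl

  mono-suc-*-suc : ∀ k f n → (q^ suc k * f) (suc n) ≡ (q^ k * f) n
  mono-suc-*-suc k f n = trans (*S-sucˡ (q^ suc k) f n) (ℤₚ.+-identityˡ _)

  mono-suc-zero : ∀ k → (q^ suc k) 0 ≡ + 0
  mono-suc-zero k = refl

  mono-suc-suc : ∀ k n → (q^ suc k) (suc n) ≡ (q^ k) n
  mono-suc-suc k n = refl

  mono-vanish : ∀ k → q^ k ≈[ k ] zeroS
  mono-vanish k = below λ n n<k → cong (λ b → if b then + 1 else + 0) (dec-false (n ℕ.≟ k) (ℕₚ.<⇒≢ n<k))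

mono-0-* : ∀ f → q^ 0 * f ≈ f
mono-0-* f = ≈-trans (*-congʳ mono-0) (*-identityˡ f)

mono-*-shift : ∀ k f n → (q^ k * f) (k ℕ.+ n) ≡ f n
mono-*-shift zero    f n = at (mono-0-* f) n
mono-*-shift (suc k) f n = trans (mono-suc-*-suc k f (k ℕ.+ n)) (mono-*-shift k f n)

mono-*-small : ∀ k f n → n < k → (q^ k * f) n ≡ + 0
mono-*-small (suc k) f zero    _         = mono-suc-*-zero k f
mono-*-small (suc k) f (suc n) (s≤s n<k) = trans (mono-suc-*-suc k f n) (mono-*-small k f n n<k)

mono-+ : ∀ j k → q^ j * q^ k ≈ q^ (j ℕ.+ k)
mono-+ zero    k = mono-0-* (q^ k)
mono-+ (suc j) k = pointwise λ
  { zero    → trans (mono-suc-*-zero j (q^ k)) (sym (mono-suc-zero (j ℕ.+ k)))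
  ; (suc n) → trans (mono-suc-*-suc j (q^ k) n)
                (trans (at (mono-+ j k) n) (sym (mono-suc-suc (j ℕ.+ k) n))) }

-- The gain of k in precision drives the later inductions on N: a series is split into its constant
-- term and a multiple of a positive power of q, whose cofactor is needed to lower precision only.
mono-*-trunc : ∀ k {N f g} → f ≈[ N ] g → q^ k * f ≈[ k ℕ.+ N ] q^ k * g
mono-*-trunc zero    {f = f} {g} p =
  trunc-trans (trunc (mono-0-* f)) (trunc-trans p (trunc (≈-sym (mono-0-* g))))
mono-*-trunc (suc k) {f = f} {g} p = below λ
  { zero _ → trans (mono-suc-*-zero k f) (sym (mono-suc-*-zero k g))
  ; (suc n) (s≤s n<) → trans (mono-suc-*-suc k f n)
      (trans (at< (mono-*-trunc k p) n n<) (sym (mono-suc-*-suc k g n))) }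

opaque
  unfolding _+_

  head-tail : ∀ f → f ≈ ι (f 0) + q^ 1 * tail f
  head-tail f = pointwise λ
    { zero    → alg (f 0)
    ; (suc n) → sym (trans (cong₂ ℤ._+_ (ℤₚ.*-zeroʳ (f 0)) (mono-*-shift 1 (tail f) n)) (ℤₚ.+-identityˡ _)) }
    where
    alg : ∀ a → a ≡ a ℤ.* + 1 ℤ.+ + 0
    alg = ℤ-Solver.solve-∀

-- Substitution q ↦ q^m

module _ (m : ℕ) .{{_ : NonZero m}} where
  private
    pick : ℕ → Series → ℕ → ℤ
    pick r f k = if does (r ℕ.≟ 0) then f k else + 0

  opaque
    unfolding _+_

    D-zero : ∀ f → D m f 0 ≡ f 0
    D-zero f = cong₂ (λ r k → pick r f k) (ℕ.m*n%n≡0 0 m) (ℕ.0/n≡0 m)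

    D-small : ∀ f n → n < m → n ≢ 0 → D m f n ≡ + 0
    D-small f n n<m n≢0 =
      cong (λ b → if b then f (n ℕ./ m) else + 0)
        (dec-false (n ℕ.% m ℕ.≟ 0) λ e → n≢0 (trans (sym (ℕ.m<n⇒m%n≡m n<m)) e))

    D-shift : ∀ f n → D m f (m ℕ.+ n) ≡ D m (tail f) n
    D-shift f n = cong₂ (λ r k → pick r f k)
      (trans (cong (ℕ._% m) (ℕₚ.+-comm m n)) (ℕ.[m+n]%n≡m%n n m))
      (trans (ℕ.m/n≡1+[m∸n]/n (ℕₚ.m≤m+n m n)) (cong (λ k → suc (k ℕ./ m)) (ℕₚ.m+n∸m≡n m n)))

    D-trunc : ∀ {N f g} → f ≈[ N ] g → D m f ≈[ N ] D m g
    D-trunc p = below λ n n<N → cong (λ x → if does (n ℕ.% m ℕ.≟ 0) then x else + 0)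
      (at< p (n ℕ./ m) (ℕₚ.≤-<-trans (ℕ.m/n≤m n m) n<N))

    D-scale : ∀ c f → D m (ι c * f) ≈ ι c * D m f
    D-scale c f = pointwise λ n →
      trans (go n) (sym (at (ι-* c (D m f)) n))
      where
      go : ∀ n → D m (ι c * f) n ≡ c ℤ.* D m f n
      go n with does (n ℕ.% m ℕ.≟ 0)
      ... | true  = at (ι-* c f) (n ℕ./ m)
      ... | false = sym (ℤₚ.*-zeroʳ c)

    D-+ : ∀ f g → D m (f + g) ≈ D m f + D m g
    D-+ f g = pointwise go
      where
      go : ∀ n → D m (f + g) n ≡ D m f n ℤ.+ D m g n
      go n with does (n ℕ.% m ℕ.≟ 0)
      ... | true  = refl
      ... | false = refl

    D-neg : ∀ f → D m (neg f) ≈ neg (D m f)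
    D-neg f = pointwise go
      where
      go : ∀ n → D m (neg f) n ≡ - D m f n
      go n with does (n ℕ.% m ℕ.≟ 0)
      ... | true  = refl
      ... | false = refl

    D-zeroS : D m zeroS ≈ zeroS
    D-zeroS = pointwise go
      where
      go : ∀ n → D m zeroS n ≡ + 0
      go n with does (n ℕ.% m ℕ.≟ 0)
      ... | true  = refl
      ... | false = refl

    -- A recursion for the substitution. Products, monomials and compositions are treated through it
    -- rather than through division with remainder.
    D-unfold : ∀ f → D m f ≈ ι (f 0) + q^ m * D m (tail f)
    D-unfold f = pointwise go
      where
      open ≡-Reasoning
      ι-pos : ∀ m j .{{_ : NonZero m}} → f 0 ℤ.* oneS (m ℕ.+ j) ≡ + 0
      ι-pos (suc _) _ = ℤₚ.*-zeroʳ (f 0)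
      go : ∀ n → D m f n ≡ (ι (f 0) + q^ m * D m (tail f)) n
      go n with n ℕₚ.<? m
      go zero    | yes n<m = begin
        D m f 0                                     ≡⟨ D-zero f ⟩
        f 0                                         ≡⟨ ℤₚ.*-identityʳ (f 0) ⟨
        f 0 ℤ.* + 1                                 ≡⟨ ℤₚ.+-identityʳ _ ⟨
        f 0 ℤ.* + 1 ℤ.+ + 0                         ≡⟨ cong (ℤ._+_ (f 0 ℤ.* + 1)) (mono-*-small m (D m (tail f)) 0 n<m) ⟨
        f 0 ℤ.* + 1 ℤ.+ (q^ m * D m (tail f)) 0     ∎
      go (suc n) | yes n<m = trans (D-small f (suc n) n<m λ ())
        (sym (cong₂ ℤ._+_ (ℤₚ.*-zeroʳ (f 0)) (mono-*-small m (D m (tail f)) (suc n) n<m)))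
      go n       | no n≮m with ℕₚ.m≤n⇒∃[o]m+o≡n (ℕₚ.≮⇒≥ n≮m)
      ... | j , refl = begin
        D m f (m ℕ.+ j)                                           ≡⟨ D-shift f j ⟩
        D m (tail f) j                                            ≡⟨ mono-*-shift m (D m (tail f)) j ⟨
        (q^ m * D m (tail f)) (m ℕ.+ j)                           ≡⟨ ℤₚ.+-identityˡ _ ⟨
        + 0 ℤ.+ (q^ m * D m (tail f)) (m ℕ.+ j)
          ≡⟨ cong (λ x → x ℤ.+ (q^ m * D m (tail f)) (m ℕ.+ j)) (ι-pos m j) ⟨
        f 0 ℤ.* oneS (m ℕ.+ j) ℤ.+ (q^ m * D m (tail f)) (m ℕ.+ j) ∎

  D-cong : ∀ {f g} → f ≈ g → D m f ≈ D m g
  D-cong p = untrunc λ N → D-trunc (trunc p)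

  D-- : ∀ f g → D m (f - g) ≈ D m f - D m g
  D-- f g = ≈-trans (D-+ f (neg g)) (+-congˡ (D-neg g))

  D-mono1-* : ∀ f → D m (q^ 1 * f) ≈ q^ m * D m f
  D-mono1-* f = begin
    D m (q^ 1 * f)
      ≈⟨ D-unfold (q^ 1 * f) ⟩
    ι ((q^ 1 * f) 0) + q^ m * D m (tail (q^ 1 * f))
      ≈⟨ +-cong (≈-trans (ι-cong (mono-suc-*-zero 0 f)) ι-zero)
           (*-congˡ (D-cong (pointwise λ n → mono-*-shift 1 f n))) ⟩
    zeroS + q^ m * D m f
      ≈⟨ +-identityˡ _ ⟩
    q^ m * D m f ∎
    where
    open ≈-R
    ι-cong : ∀ {x y} → x ≡ y → ι x ≈ ι y
    ι-cong refl = ≈-refl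

  D-* : ∀ f g → D m (f * g) ≈ D m f * D m g
  D-* f g = untrunc λ N → go N f g
    where
    go : ∀ N f g → D m (f * g) ≈[ N ] D m f * D m g
    go zero    f g = below λ _ ()
    go (suc N) f g = begin
      D m (f * g)
        ≈⟨ trunc (D-cong (≈-trans (*-congʳ (head-tail f))
             (solve 4 (λ c x y g → (c :+ x :* y) :* g := c :* g :+ x :* (y :* g)) ≈-refl
               (ι (f 0)) (q^ 1) (tail f) g))) ⟩
      D m (ι (f 0) * g + q^ 1 * (tail f * g))
        ≈⟨ trunc (≈-trans (D-+ _ _) (+-cong (D-scale (f 0) g) (D-mono1-* (tail f * g)))) ⟩
      ι (f 0) * D m g + q^ m * D m (tail f * g)
        ≈⟨ trunc-+ trunc-refl (weaken (ℕₚ.+-monoˡ-≤ N (ℕ.>-nonZero⁻¹ m)) (mono-*-trunc m (go N (tail f) g))) ⟩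
      ι (f 0) * D m g + q^ m * (D m (tail f) * D m g)
        ≈⟨ trunc (solve 4 (λ c x y g → c :* g :+ x :* (y :* g) := (c :+ x :* y) :* g) ≈-refl
               (ι (f 0)) (q^ m) (D m (tail f)) (D m g)) ⟩
      (ι (f 0) + q^ m * D m (tail f)) * D m g
        ≈⟨ trunc (*-congʳ (D-unfold f)) ⟨
      D m f * D m g ∎
      where open ≈[]-R {suc N}

  D-one : D m oneS ≈ oneS
  D-one = begin
    D m oneS                       ≈⟨ D-unfold oneS ⟩
    ι (+ 1) + q^ m * D m zeroS     ≈⟨ +-cong ι-one (≈-trans (*-congˡ D-zeroS) (zeroʳ (q^ m))) ⟩
    oneS + zeroS                   ≈⟨ +-identityʳ oneS ⟩
    oneS                           ∎
    where open ≈-R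

  D-ι : ∀ c → D m (ι c) ≈ ι c
  D-ι c = begin
    D m (ι c)           ≈⟨ D-cong (*-identityʳ (ι c)) ⟨
    D m (ι c * oneS)    ≈⟨ D-scale c oneS ⟩
    ι c * D m oneS      ≈⟨ *-congˡ D-one ⟩
    ι c * oneS          ≈⟨ *-identityʳ (ι c) ⟩
    ι c                 ∎
    where open ≈-R

  D-mono : ∀ k → D m (q^ k) ≈ q^ (k ℕ.* m)
  D-mono zero    = ≈-trans (D-cong mono-0) (≈-trans D-one (≈-sym mono-0))
  D-mono (suc k) = begin
    D m (q^ suc k)           ≈⟨ D-cong (mono-+ 1 k) ⟨
    D m (q^ 1 * q^ k)        ≈⟨ D-mono1-* (q^ k) ⟩
    q^ m * D m (q^ k)        ≈⟨ *-congˡ (D-mono k) ⟩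
    q^ m * q^ (k ℕ.* m)      ≈⟨ mono-+ m (k ℕ.* m) ⟩
    q^ (suc k ℕ.* m)         ∎
    where open ≈-R

  D-^ : ∀ f k → D m (f ^ k) ≈ D m f ^ k
  D-^ f zero    = D-one
  D-^ f (suc k) = ≈-trans (D-* f (f ^ k)) (*-congˡ (D-^ f k))

-- The product enters as a separate `k` with an equation, so that numerals such as 18 can be given
-- directly and checked by `refl`.
D-∘ : ∀ m n k .{{_ : NonZero m}} .{{_ : NonZero n}} .{{_ : NonZero k}} → k ≡ n ℕ.* m →
  ∀ f → D m (D n f) ≈ D k f
D-∘ m n k k≡ f = untrunc λ N → go N f
  where
  go : ∀ N f → D m (D n f) ≈[ N ] D k f
  go zero    f = below λ _ ()
  go (suc N) f = begin
    D m (D n f)                              ≈⟨ trunc (D-cong m (D-unfold n f)) ⟩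
    D m (ι (f 0) + q^ n * D n (tail f))
      ≈⟨ trunc (≈-trans (D-+ m _ _) (+-cong (D-ι m (f 0)) (≈-trans (D-* m _ _) (*-congʳ (D-mono m n))))) ⟩
    ι (f 0) + q^ (n ℕ.* m) * D m (D n (tail f))
      ≡⟨ cong (λ j → ι (f 0) + q^ j * D m (D n (tail f))) (sym k≡) ⟩
    ι (f 0) + q^ k * D m (D n (tail f))
      ≈⟨ trunc-+ trunc-refl (weaken (ℕₚ.+-monoˡ-≤ N (ℕ.>-nonZero⁻¹ k)) (mono-*-trunc k (go N (tail f)))) ⟩
    ι (f 0) + q^ k * D k (tail f)            ≈⟨ trunc (D-unfold k f) ⟨
    D k f                                    ∎
    where open ≈[]-R {suc N}

-- Gaussian binomials

opaque
  unfolding _+_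

  one-minus-q-head : ∀ k → (oneS - q^ suc k) 0 ≡ + 1
  one-minus-q-head k = refl

  *-head : ∀ {f g} → f 0 ≡ + 1 → g 0 ≡ + 1 → (f * g) 0 ≡ + 1
  *-head p r = cong₂ (λ x y → + 0 ℤ.+ x ℤ.* y) p r

  poch : ℕ → Series
  poch = Epart

  poch-zero : poch 0 ≡ oneS
  poch-zero = refl

  poch-suc : ∀ n → poch (suc n) ≡ poch n * (oneS - q^ suc n)
  poch-suc n = refl

  E-at : ∀ n → E n ≡ poch n n
  E-at n = refl

poch-head : ∀ n → poch n 0 ≡ + 1
poch-head zero    = cong (λ f → f 0) poch-zero
poch-head (suc n) = trans (cong (λ f → f 0) (poch-suc n))
  (*-head {poch n} (poch-head n) (one-minus-q-head n))

≡⇒≈ : ∀ {f g} → f ≡ g → f ≈ g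
≡⇒≈ refl = ≈-refl

q-cong : ∀ {j k} → j ≡ k → q^ j ≈ q^ k
q-cong refl = ≈-refl

-- gauss k m is the Gaussian binomial coefficient [k+m choose k].
gauss : ℕ → ℕ → Series
gauss zero    m       = oneS
gauss (suc k) zero    = oneS
gauss (suc k) (suc m) = gauss k (suc m) + q^ suc k * gauss (suc k) m

gauss-zeroʳ : ∀ k → gauss k 0 ≡ oneS
gauss-zeroʳ zero    = refl
gauss-zeroʳ (suc k) = refl

-- The factorial formula for Gaussian binomials, cleared of denominators. Pascal's rule reduces it
-- to (1 - x) + x (1 - y) = 1 - x y with x = q^(k+1) and y = q^(m+1). It yields the symmetry of
-- `gauss`, hence the second Pascal rule, and the limit of `gauss k m`.
poch-gauss : ∀ k m → poch k * poch m * gauss k m ≈ poch (k ℕ.+ m)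
poch-gauss zero    m       = ≈-trans (*-identityʳ _)
  (≈-trans (*-congʳ (≡⇒≈ poch-zero)) (*-identityˡ _))
poch-gauss (suc k) zero    = ≈-trans (*-identityʳ _)
  (≈-trans (*-congˡ (≡⇒≈ poch-zero)) (≈-trans (*-identityʳ _)
    (≡⇒≈ (cong poch (sym (ℕₚ.+-identityʳ (suc k)))))))
poch-gauss (suc k) (suc m) = begin
  poch (suc k) * poch (suc m) * (gauss k (suc m) + q^ suc k * gauss (suc k) m)
    ≡⟨ cong₂ (λ x y → x * y * (gauss k (suc m) + q^ suc k * gauss (suc k) m)) (poch-suc k) (poch-suc m) ⟩
  poch k * (oneS - q^ suc k) * (poch m * (oneS - q^ suc m)) * (gauss k (suc m) + q^ suc k * gauss (suc k) m)
    ≈⟨ solve 6 (λ a b x y g h → a :* (:1 :- x) :* (b :* (:1 :- y)) :* (g :+ x :* h) :=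
         (:1 :- x) :* (a :* (b :* (:1 :- y)) :* g) :+ x :* (:1 :- y) :* (a :* (:1 :- x) :* b :* h)) ≈-refl
         (poch k) (poch m) (q^ suc k) (q^ suc m) (gauss k (suc m)) (gauss (suc k) m) ⟩
  (oneS - q^ suc k) * (poch k * (poch m * (oneS - q^ suc m)) * gauss k (suc m))
    + q^ suc k * (oneS - q^ suc m) * (poch k * (oneS - q^ suc k) * poch m * gauss (suc k) m)
    ≡⟨ cong₂ (λ x y → (oneS - q^ suc k) * (poch k * x * gauss k (suc m))
               + q^ suc k * (oneS - q^ suc m) * (y * poch m * gauss (suc k) m)) (poch-suc m) (poch-suc k) ⟨
  (oneS - q^ suc k) * (poch k * poch (suc m) * gauss k (suc m))
    + q^ suc k * (oneS - q^ suc m) * (poch (suc k) * poch m * gauss (suc k) m)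
    ≈⟨ +-cong (*-congˡ (poch-gauss k (suc m))) (*-congˡ (poch-gauss (suc k) m)) ⟩
  (oneS - q^ suc k) * poch (k ℕ.+ suc m) + q^ suc k * (oneS - q^ suc m) * poch (suc k ℕ.+ m)
    ≡⟨ cong (λ j → (oneS - q^ suc k) * poch (k ℕ.+ suc m) + q^ suc k * (oneS - q^ suc m) * poch j) (ℕₚ.+-suc k m) ⟨
  (oneS - q^ suc k) * poch (k ℕ.+ suc m) + q^ suc k * (oneS - q^ suc m) * poch (k ℕ.+ suc m)
    ≈⟨ solve 3 (λ e x y → (:1 :- x) :* e :+ x :* (:1 :- y) :* e := e :* (:1 :- x :* y)) ≈-refl
         (poch (k ℕ.+ suc m)) (q^ suc k) (q^ suc m) ⟩
  poch (k ℕ.+ suc m) * (oneS - q^ suc k * q^ suc m)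
    ≈⟨ *-congˡ (+-congˡ (neg-cong (mono-+ (suc k) (suc m)))) ⟩
  poch (k ℕ.+ suc m) * (oneS - q^ (suc k ℕ.+ suc m))
    ≡⟨ poch-suc (k ℕ.+ suc m) ⟨
  poch (suc k ℕ.+ suc m) ∎
  where open ≈-R

poch-inverse : ∀ n → poch n * invS (poch n) ≈ oneS
poch-inverse n = *-invS (poch n) (poch-head n)

unit-cancel : ∀ {u v f g} → u * v ≈ oneS → u * f ≈ u * g → f ≈ g
unit-cancel uv p = untrunc λ N → *-cancel-unit uv (trunc p)

gauss-comm : ∀ k m → gauss k m ≈ gauss m k
gauss-comm k m = unit-cancel (poch-inverse k) (unit-cancel (poch-inverse m) (begin
  poch m * (poch k * gauss k m)     ≈⟨ solve 3 (λ a b g → b :* (a :* g) := a :* b :* g) ≈-refl (poch k) (poch m) (gauss k m) ⟩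
  poch k * poch m * gauss k m       ≈⟨ poch-gauss k m ⟩
  poch (k ℕ.+ m)                     ≡⟨ cong poch (ℕₚ.+-comm k m) ⟩
  poch (m ℕ.+ k)                     ≈⟨ poch-gauss m k ⟨
  poch m * poch k * gauss m k       ≈⟨ solve 3 (λ a b g → b :* (a :* g) := b :* a :* g) ≈-refl (poch k) (poch m) (gauss m k) ⟨
  poch m * (poch k * gauss m k)     ∎))
  where open ≈-R

gauss-pascalʳ : ∀ k m → gauss (suc k) (suc m) ≈ q^ suc m * gauss k (suc m) + gauss (suc k) m
gauss-pascalʳ k m = begin
  gauss (suc k) (suc m)                              ≈⟨ gauss-comm (suc k) (suc m) ⟩
  gauss m (suc k) + q^ suc m * gauss (suc m) k       ≈⟨ +-cong (gauss-comm m (suc k)) (*-congˡ (gauss-comm (suc m) k)) ⟩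
  gauss (suc k) m + q^ suc m * gauss k (suc m)       ≈⟨ solve 2 (λ x y → x :+ y := y :+ x) ≈-refl (gauss (suc k) m) (q^ suc m * gauss k (suc m)) ⟩
  q^ suc m * gauss k (suc m) + gauss (suc k) m       ∎
  where open ≈-R

one-minus-q-trunc : ∀ {N} k → N ≤ k → oneS - q^ k ≈[ N ] oneS
one-minus-q-trunc {N} k N≤k = begin
  oneS - q^ k     ≈⟨ trunc-- trunc-refl (weaken N≤k (mono-vanish k)) ⟩
  oneS - zeroS    ≈⟨ trunc (+-congˡ (neg-cong ι-zero)) ⟨
    oneS - ι (+ 0)  ≈⟨ trunc (solve 1 (λ x → x :- con (+ 0) := x) ≈-refl oneS) ⟩
  oneS            ∎
  where open ≈[]-R {N}

poch-trunc : ∀ n d → poch (d ℕ.+ n) ≈[ suc n ] poch n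
poch-trunc n zero    = trunc-refl
poch-trunc n (suc d) = begin
  poch (suc d ℕ.+ n)                              ≡⟨ poch-suc (d ℕ.+ n) ⟩
  poch (d ℕ.+ n) * (oneS - q^ suc (d ℕ.+ n))      ≈⟨ trunc-* (poch-trunc n d) (one-minus-q-trunc _ (s≤s (ℕₚ.m≤n+m n d))) ⟩
  poch n * oneS                                   ≈⟨ trunc (*-identityʳ (poch n)) ⟩
  poch n                                          ∎
  where open ≈[]-R

E-trunc : ∀ {N} n → N ≤ suc n → E ≈[ N ] poch n
E-trunc n N≤n+1 = below λ i i<N → go i (ℕₚ.≤-pred (ℕₚ.<-≤-trans i<N N≤n+1))
  where
  go : ∀ i → i ≤ n → E i ≡ poch n i
  go i i≤n with ℕₚ.m≤n⇒∃[o]m+o≡n i≤n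
  ... | d , refl = trans (E-at i) (sym (trans (cong (λ j → poch j i) (ℕₚ.+-comm i d)) (at< (poch-trunc i d) i ℕₚ.≤-refl)))

E-inverse : E * invS E ≈ oneS
E-inverse = *-invS E refl

-- Modulo q^N the series `E` may replace all three Pochhammer products of the factorial formula,
-- which then reads E · E · `gauss k m` = E; one unit `E` cancels.
E-gauss : ∀ {N} k m → N ≤ suc k → N ≤ suc m → E * gauss k m ≈[ N ] oneS
E-gauss {N} k m N≤k N≤m = *-cancel-unit E-inverse (begin
  E * (E * gauss k m)             ≈⟨ trunc (solve 2 (λ e g → e :* (e :* g) := e :* e :* g) ≈-refl E (gauss k m)) ⟩
  E * E * gauss k m               ≈⟨ trunc-*ʳ (gauss k m) (trunc-* (E-trunc k N≤k) (E-trunc m N≤m)) ⟩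
  poch k * poch m * gauss k m   ≈⟨ trunc (poch-gauss k m) ⟩
  poch (k ℕ.+ m)                 ≈⟨ E-trunc (k ℕ.+ m) (ℕₚ.≤-trans N≤k (s≤s (ℕₚ.m≤m+n k m))) ⟨
  E                               ≈⟨ trunc (*-identityʳ E) ⟨
  E * oneS                        ∎)
  where open ≈[]-R {N}

-- Jacobi's triple product

-- Summing over pairs with k + m = n keeps both indices of `gauss k m` at hand without subtraction.
antidiag : ℕ → (ℕ → ℕ → Series) → Series
antidiag zero    h = h 0 0
antidiag (suc n) h = h 0 (suc n) + antidiag n (λ k m → h (suc k) m)

antidiag-trunc : ∀ {N} n {h h′} → (∀ k m → k ℕ.+ m ≡ n → h k m ≈[ N ] h′ k m) →
  antidiag n h ≈[ N ] antidiag n h′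
antidiag-trunc zero    p = p 0 0 refl
antidiag-trunc (suc n) p = trunc-+ (p 0 (suc n) refl) (antidiag-trunc n λ k m e → p (suc k) m (cong suc e))

antidiag-cong : ∀ n {h h′} → (∀ k m → h k m ≈ h′ k m) → antidiag n h ≈ antidiag n h′
antidiag-cong n p = untrunc λ N → antidiag-trunc n λ k m _ → trunc (p k m)

antidiag-*ʳ : ∀ n h x → antidiag n h * x ≈ antidiag n (λ k m → h k m * x)
antidiag-*ʳ zero    h x = ≈-refl
antidiag-*ʳ (suc n) h x = ≈-trans
  (solve 3 (λ a b x → (a :+ b) :* x := a :* x :+ b :* x) ≈-refl (h 0 (suc n)) _ x)
  (+-congˡ (antidiag-*ʳ n (λ k m → h (suc k) m) x))

antidiag-last : ∀ n h → antidiag (suc n) h ≈ antidiag n (λ k m → h k (suc m)) + h (suc n) 0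
antidiag-last zero    h = ≈-refl
antidiag-last (suc n) h = ≈-trans (+-congˡ (antidiag-last n (λ k m → h (suc k) m)))
  (solve 3 (λ a b c → a :+ (b :+ c) := a :+ b :+ c) ≈-refl (h 0 (suc (suc n))) _ (h (suc (suc n)) 0))

-- Pascal's triangle in the abstract: an entry of the new row receives `u` from the neighbour with
-- the same first index and `v` from the neighbour with the same second index. The spare summand `x`
-- is there for the induction, where it holds the contribution `v 0 (suc n)` to the row that starts
-- at first index 1.
antidiag-pascal : ∀ n h {u v x} → h 0 (suc n) ≈ x + u 0 n → h (suc n) 0 ≈ v n 0 →
  (∀ k m → k ℕ.+ suc m ≡ n → h (suc k) (suc m) ≈ v k (suc m) + u (suc k) m) →
  antidiag (suc n) h ≈ x + (antidiag n u + antidiag n v)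
antidiag-pascal zero    h {u} {v} {x} first last middle = ≈-trans (+-cong first last)
  (solve 3 (λ x a b → (x :+ a) :+ b := x :+ (a :+ b)) ≈-refl x (u 0 0) (v 0 0))
antidiag-pascal (suc n) h {u} {v} {x} first last middle = ≈-trans
  (+-cong first (antidiag-pascal n (λ k m → h (suc k) m) {x = v 0 (suc n)} (middle 0 n refl) last
    (λ k m e → middle (suc k) m (cong suc e))))
  (solve 5 (λ x a b c d → (x :+ a) :+ (b :+ (c :+ d)) := x :+ ((a :+ c) :+ (b :+ d))) ≈-refl
    x (u 0 (suc n)) (v 0 (suc n)) (antidiag n (λ k m → u (suc k) m)) (antidiag n (λ k m → v (suc k) m)))

Π : ℕ → (ℕ → Series) → Series
Π zero    h = oneS
Π (suc n) h = Π n h * h n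

-- In closed form this is c n(n+1)/2 + d n(n-1)/2, the exponent in Ramanujan's theta function;
-- exchanging c and d replaces n by -n.
expo : ℕ → ℕ → ℕ → ℕ
expo c d zero    = 0
expo c d (suc n) = c ℕ.+ n ℕ.* (c ℕ.+ d) ℕ.+ expo c d n

-- The theta function f(ε q^c, ε q^d) for a sign ε. Of the sign only ε² = 1 is used, so that both
-- kinds of theta series below are instances.
module TripleProduct (c d : ℕ) .{{a-nonZero : NonZero (c ℕ.+ d)}} (ε : Series) (ε² : ε * ε ≈ oneS) where
  a : ℕ
  a = c ℕ.+ d

  -- shifted k B is the exponent c j(j+1)/2 + d j(j-1)/2 for j = k - B.
  shifted : ℕ → ℕ → ℕ
  shifted k       zero    = expo c d k
  shifted zero    (suc B) = expo d c (suc B)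
  shifted (suc k) (suc B) = shifted k B

  shifted-zeroˡ : ∀ B → shifted 0 B ≡ expo d c B
  shifted-zeroˡ zero    = refl
  shifted-zeroˡ (suc B) = refl

  shifted-+ : ∀ k B → shifted (k ℕ.+ B) B ≡ expo c d k
  shifted-+ k zero    = cong (expo c d) (ℕₚ.+-identityʳ k)
  shifted-+ k (suc B) rewrite ℕₚ.+-suc k B = shifted-+ k B

  -- From j = k - B to j + 1 the exponent grows by c + j a, which may be negative; moving terms to
  -- both sides keeps the equation in the natural numbers.
  shifted-step : ∀ k B → shifted k B ℕ.+ suc k ℕ.* a ≡ shifted (suc k) B ℕ.+ (d ℕ.+ B ℕ.* a)
  shifted-step k zero = alg c d k (expo c d k)
    where
    alg : ∀ c d k e → e ℕ.+ suc k ℕ.* (c ℕ.+ d) ≡ c ℕ.+ k ℕ.* (c ℕ.+ d) ℕ.+ e ℕ.+ (d ℕ.+ 0)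
    alg = ℕ-Solver.solve-∀
  shifted-step zero (suc B) rewrite shifted-zeroˡ B = alg c d B (expo d c B)
    where
    alg : ∀ c d B e → d ℕ.+ B ℕ.* (d ℕ.+ c) ℕ.+ e ℕ.+ (c ℕ.+ d ℕ.+ 0) ≡ e ℕ.+ (d ℕ.+ suc B ℕ.* (c ℕ.+ d))
    alg = ℕ-Solver.solve-∀
  shifted-step (suc k) (suc B) = begin
    shifted k B ℕ.+ (a ℕ.+ suc k ℕ.* a)             ≡⟨ alg₁ a (shifted k B) (suc k ℕ.* a) ⟩
    a ℕ.+ (shifted k B ℕ.+ suc k ℕ.* a)             ≡⟨ cong (a ℕ.+_) (shifted-step k B) ⟩
    a ℕ.+ (shifted (suc k) B ℕ.+ (d ℕ.+ B ℕ.* a))   ≡⟨ alg₂ a d (shifted (suc k) B) (B ℕ.* a) ⟩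
    shifted (suc k) B ℕ.+ (d ℕ.+ (a ℕ.+ B ℕ.* a))   ∎
    where
    open ≡-Reasoning
    alg₁ : ∀ a x y → x ℕ.+ (a ℕ.+ y) ≡ a ℕ.+ (x ℕ.+ y)
    alg₁ = ℕ-Solver.solve-∀
    alg₂ : ∀ a d x y → a ℕ.+ (x ℕ.+ (d ℕ.+ y)) ≡ x ℕ.+ (d ℕ.+ (a ℕ.+ y))
    alg₂ = ℕ-Solver.solve-∀

  -- Since ε² = 1, the power k + B stands in for k - B, which may be negative.
  term : ℕ → ℕ → Series
  term k B = ε ^ (k ℕ.+ B) * q^ shifted k B

  g : ℕ → ℕ → Series
  g k m = D a (gauss k m)

  g-pascalˡ : ∀ k m → g (suc k) (suc m) ≈ g k (suc m) + q^ (suc k ℕ.* a) * g (suc k) m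
  g-pascalˡ k m = ≈-trans (D-+ a _ _)
    (+-congˡ (≈-trans (D-* a _ _) (*-congʳ (D-mono a (suc k)))))

  g-pascalʳ : ∀ k m → g (suc k) (suc m) ≈ q^ (suc m ℕ.* a) * g k (suc m) + g (suc k) m
  g-pascalʳ k m = ≈-trans (D-cong a (gauss-pascalʳ k m)) (≈-trans (D-+ a _ _)
    (+-congʳ (≈-trans (D-* a _ _) (*-congʳ (D-mono a (suc m))))))

  factors : ℕ → ℕ → Series
  factors r n = Π n (λ i → oneS + ε * q^ (r ℕ.+ i ℕ.* a))

  mono-merge : ∀ {i j k l} → i ℕ.+ j ≡ k ℕ.+ l → q^ i * q^ j ≈ q^ k * q^ l
  mono-merge {i} {j} {k} {l} e = ≈-trans (mono-+ i j) (≈-trans (q-cong e) (≈-sym (mono-+ k l)))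

  -- The q-binomial theorem in base q^a. In the product with a new factor, the summand multiplied by
  -- `y` moves from k to k + 1, which calls for the right-hand Pascal rule.
  finite-c : ∀ A → factors c A ≈ antidiag A (λ k m → term k 0 * g k m)
  finite-c zero    = ≈-sym (begin
    oneS * q^ 0 * D a oneS    ≈⟨ *-cong (*-congˡ mono-0) (D-one a) ⟩
    oneS * oneS * oneS        ≈⟨ solve 0 (:1 :* :1 :* :1 := :1) ≈-refl ⟩
    oneS                      ∎)
    where open ≈-R
  finite-c (suc A) = begin
    factors c A * (oneS + y)
      ≈⟨ solve 2 (λ f y → f :* (:1 :+ y) := f :+ f :* y) ≈-refl (factors c A) y ⟩
    factors c A + factors c A * y
      ≈⟨ +-cong (finite-c A) (≈-trans (*-congʳ (finite-c A)) (antidiag-*ʳ A _ y)) ⟩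
    antidiag A (λ k m → term k 0 * g k m) + antidiag A (λ k m → term k 0 * g k m * y)
      ≈⟨ +-identityˡ _ ⟨
    zeroS + (antidiag A (λ k m → term k 0 * g k m) + antidiag A (λ k m → term k 0 * g k m * y))
      ≈⟨ antidiag-pascal A (λ k m → term k 0 * g k m) (≈-sym (+-identityˡ _)) last middle ⟨
    antidiag (suc A) (λ k m → term k 0 * g k m) ∎
    where
    open ≈-R
    y : Series
    y = ε * q^ (c ℕ.+ A ℕ.* a)

    last : term (suc A) 0 * g (suc A) 0 ≈ term A 0 * g A 0 * y
    last rewrite gauss-zeroʳ A = begin
      ε * ε ^ (A ℕ.+ 0) * q^ (c ℕ.+ A ℕ.* a ℕ.+ expo c d A) * D a oneS
        ≈⟨ *-congʳ (*-congˡ (mono-+ (c ℕ.+ A ℕ.* a) (expo c d A))) ⟨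
      ε * ε ^ (A ℕ.+ 0) * (q^ (c ℕ.+ A ℕ.* a) * q^ expo c d A) * D a oneS
        ≈⟨ solve 5 (λ e p x y z → e :* p :* (x :* y) :* z := p :* y :* z :* (e :* x)) ≈-refl
             ε (ε ^ (A ℕ.+ 0)) (q^ (c ℕ.+ A ℕ.* a)) (q^ expo c d A) (D a oneS) ⟩
      ε ^ (A ℕ.+ 0) * q^ expo c d A * D a oneS * y ∎

    middle : ∀ k m → k ℕ.+ suc m ≡ A → term (suc k) 0 * g (suc k) (suc m) ≈
      term k 0 * g k (suc m) * y + term (suc k) 0 * g (suc k) m
    middle k m e = begin
      ε * p * q^ expo c d (suc k) * g (suc k) (suc m)
        ≈⟨ *-congˡ (g-pascalʳ k m) ⟩
      ε * p * q^ expo c d (suc k) * (q^ (suc m ℕ.* a) * g k (suc m) + g (suc k) m)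
        ≈⟨ solve 6 (λ e p x y g h → e :* p :* x :* (y :* g :+ h) := e :* p :* g :* (x :* y) :+ e :* p :* x :* h) ≈-refl
             ε p (q^ expo c d (suc k)) (q^ (suc m ℕ.* a)) (g k (suc m)) (g (suc k) m) ⟩
      ε * p * g k (suc m) * (q^ expo c d (suc k) * q^ (suc m ℕ.* a)) + term (suc k) 0 * g (suc k) m
        ≈⟨ +-congʳ (*-congˡ (mono-merge (exponents e))) ⟩
      ε * p * g k (suc m) * (q^ expo c d k * q^ (c ℕ.+ A ℕ.* a)) + term (suc k) 0 * g (suc k) m
        ≈⟨ +-congʳ (solve 5 (λ e p x y g → e :* p :* g :* (x :* y) := p :* x :* g :* (e :* y)) ≈-refl
             ε p (q^ expo c d k) (q^ (c ℕ.+ A ℕ.* a)) (g k (suc m))) ⟩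
      term k 0 * g k (suc m) * y + term (suc k) 0 * g (suc k) m ∎
      where
      p : Series
      p = ε ^ (k ℕ.+ 0)
      exponents : k ℕ.+ suc m ≡ A →
        expo c d (suc k) ℕ.+ suc m ℕ.* a ≡ expo c d k ℕ.+ (c ℕ.+ A ℕ.* a)
      exponents refl = alg c a k m (expo c d k)
        where
        alg : ∀ c a k m e → c ℕ.+ k ℕ.* a ℕ.+ e ℕ.+ suc m ℕ.* a ≡ e ℕ.+ (c ℕ.+ (k ℕ.+ suc m) ℕ.* a)
        alg = ℕ-Solver.solve-∀

  -- The finite triple product, by induction on B from the q-binomial theorem. A new factor of the
  -- second kind moves the centre of summation from B to B + 1. Now the summand multiplied by `y`
  -- keeps its index k and the other one moves to k + 1, which calls for the left-hand Pascal rule.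
  finite : ∀ A B → factors c A * factors d B ≈ antidiag (B ℕ.+ A) (λ k m → term k B * g k m)
  finite A zero    = ≈-trans (*-identityʳ _) (finite-c A)
  finite A (suc B) = begin
    factors c A * (factors d B * (oneS + y))
      ≈⟨ solve 3 (λ f g y → f :* (g :* (:1 :+ y)) := f :* g :* y :+ f :* g) ≈-refl (factors c A) (factors d B) y ⟩
    factors c A * factors d B * y + factors c A * factors d B
      ≈⟨ +-cong (≈-trans (*-congʳ (finite A B)) (antidiag-*ʳ (B ℕ.+ A) _ y)) (finite A B) ⟩
    antidiag (B ℕ.+ A) (λ k m → term k B * g k m * y) + antidiag (B ℕ.+ A) (λ k m → term k B * g k m)
      ≈⟨ +-identityˡ _ ⟨
    zeroS + (antidiag (B ℕ.+ A) (λ k m → term k B * g k m * y) + antidiag (B ℕ.+ A) (λ k m → term k B * g k m))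
      ≈⟨ antidiag-pascal (B ℕ.+ A) (λ k m → term k (suc B) * g k m) (≈-trans first (≈-sym (+-identityˡ _))) last middle ⟨
    antidiag (suc B ℕ.+ A) (λ k m → term k (suc B) * g k m) ∎
    where
    open ≈-R
    y : Series
    y = ε * q^ (d ℕ.+ B ℕ.* a)

    term-shift : ∀ k → term (suc k) (suc B) ≈ term k B
    term-shift k rewrite ℕₚ.+-suc k B = *-congʳ (begin
      ε * (ε * ε ^ (k ℕ.+ B))   ≈⟨ solve 2 (λ e p → e :* (e :* p) := e :* e :* p) ≈-refl ε (ε ^ (k ℕ.+ B)) ⟩
      ε * ε * ε ^ (k ℕ.+ B)     ≈⟨ *-congʳ ε² ⟩
      oneS * ε ^ (k ℕ.+ B)      ≈⟨ *-identityˡ _ ⟩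
      ε ^ (k ℕ.+ B)             ∎)

    last : term (suc (B ℕ.+ A)) (suc B) * g (suc (B ℕ.+ A)) 0 ≈ term (B ℕ.+ A) B * g (B ℕ.+ A) 0
    last rewrite gauss-zeroʳ (B ℕ.+ A) = *-congʳ (term-shift (B ℕ.+ A))

    first : term 0 (suc B) * g 0 (suc (B ℕ.+ A)) ≈ term 0 B * g 0 (B ℕ.+ A) * y
    first = begin
      ε * ε ^ B * q^ (d ℕ.+ B ℕ.* (d ℕ.+ c) ℕ.+ expo d c B) * D a oneS
        ≈⟨ *-congʳ (*-congˡ (≈-trans (q-cong (exponents (shifted-zeroˡ B)))
             (≈-sym (mono-+ (shifted 0 B) (d ℕ.+ B ℕ.* a))))) ⟩
      ε * ε ^ B * (q^ shifted 0 B * q^ (d ℕ.+ B ℕ.* a)) * D a oneS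
        ≈⟨ solve 5 (λ e p x y g → e :* p :* (x :* y) :* g := p :* x :* g :* (e :* y)) ≈-refl
             ε (ε ^ B) (q^ shifted 0 B) (q^ (d ℕ.+ B ℕ.* a)) (D a oneS) ⟩
      ε ^ B * q^ shifted 0 B * D a oneS * y ∎
      where
      exponents : ∀ {s} → s ≡ expo d c B → d ℕ.+ B ℕ.* (d ℕ.+ c) ℕ.+ expo d c B ≡ s ℕ.+ (d ℕ.+ B ℕ.* a)
      exponents {s} refl = alg c d B s
        where
        alg : ∀ c d B s → d ℕ.+ B ℕ.* (d ℕ.+ c) ℕ.+ s ≡ s ℕ.+ (d ℕ.+ B ℕ.* (c ℕ.+ d))
        alg = ℕ-Solver.solve-∀

    middle : ∀ k m → k ℕ.+ suc m ≡ B ℕ.+ A → term (suc k) (suc B) * g (suc k) (suc m) ≈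
      term k B * g k (suc m) + term (suc k) B * g (suc k) m * y
    middle k m _ = begin
      term (suc k) (suc B) * g (suc k) (suc m)
        ≈⟨ *-cong (term-shift k) (g-pascalˡ k m) ⟩
      p * q^ shifted k B * (g k (suc m) + q^ (suc k ℕ.* a) * g (suc k) m)
        ≈⟨ solve 5 (λ p x y g h → p :* x :* (g :+ y :* h) := p :* x :* g :+ p :* h :* (x :* y)) ≈-refl
             p (q^ shifted k B) (q^ (suc k ℕ.* a)) (g k (suc m)) (g (suc k) m) ⟩
      p * q^ shifted k B * g k (suc m) + p * g (suc k) m * (q^ shifted k B * q^ (suc k ℕ.* a))
        ≈⟨ +-congˡ (*-cong (*-congʳ (≈-sym ε²p)) (mono-merge (shifted-step k B))) ⟩
      p * q^ shifted k B * g k (suc m) + ε * (ε * p) * g (suc k) m * (q^ shifted (suc k) B * q^ (d ℕ.+ B ℕ.* a))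
        ≈⟨ +-congˡ (solve 5 (λ e p x y h → e :* (e :* p) :* h :* (x :* y) := e :* p :* x :* h :* (e :* y)) ≈-refl
             ε p (q^ shifted (suc k) B) (q^ (d ℕ.+ B ℕ.* a)) (g (suc k) m)) ⟩
      term k B * g k (suc m) + term (suc k) B * g (suc k) m * y ∎
      where
      p : Series
      p = ε ^ (k ℕ.+ B)
      ε²p : ε * (ε * p) ≈ p
      ε²p = ≈-trans (solve 2 (λ e p → e :* (e :* p) := e :* e :* p) ≈-refl ε p)
        (≈-trans (*-congʳ ε²) (*-identityˡ p))

  θ : ℕ → Series
  θ zero    = oneS
  θ (suc n) = θ n + ε ^ suc n * (q^ expo c d (suc n) + q^ expo d c (suc n))

  ε-even : ∀ n k → ε ^ (n ℕ.+ n ℕ.+ k) ≈ ε ^ k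
  ε-even zero    k = ≈-refl
  ε-even (suc n) k rewrite ℕₚ.+-suc n n = begin
    ε * (ε * ε ^ (n ℕ.+ n ℕ.+ k))   ≈⟨ solve 2 (λ e p → e :* (e :* p) := e :* e :* p) ≈-refl ε _ ⟩
    ε * ε * ε ^ (n ℕ.+ n ℕ.+ k)     ≈⟨ *-cong ε² (ε-even n k) ⟩
    oneS * ε ^ k                    ≈⟨ *-identityˡ _ ⟩
    ε ^ k                           ∎
    where open ≈-R

  antidiag-θ : ∀ n → antidiag (n ℕ.+ n) (λ k _ → term k n) ≈ θ n
  antidiag-θ zero    = ≈-trans (*-identityˡ _) mono-0
  antidiag-θ (suc n) rewrite ℕₚ.+-suc n n = begin
    term 0 (suc n) + antidiag (suc (n ℕ.+ n)) (λ k _ → term (suc k) (suc n))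
      ≈⟨ +-congˡ (antidiag-last (n ℕ.+ n) (λ k _ → term (suc k) (suc n))) ⟩
    term 0 (suc n) + (antidiag (n ℕ.+ n) (λ k _ → term (suc k) (suc n)) + term (suc (suc (n ℕ.+ n))) (suc n))
      ≈⟨ +-congˡ (+-cong (≈-trans (antidiag-cong (n ℕ.+ n) λ k _ → term-shift k) (antidiag-θ n)) top) ⟩
    ε ^ suc n * q^ expo d c (suc n) + (θ n + ε ^ suc n * q^ expo c d (suc n))
      ≈⟨ solve 4 (λ p x y t → p :* y :+ (t :+ p :* x) := t :+ p :* (x :+ y)) ≈-refl
           (ε ^ suc n) (q^ expo c d (suc n)) (q^ expo d c (suc n)) (θ n) ⟩
    θ (suc n) ∎
    where
    open ≈-R
    term-shift : ∀ k → term (suc k) (suc n) ≈ term k n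
    term-shift k rewrite ℕₚ.+-suc k n = *-congʳ (ε-even 1 (k ℕ.+ n))
    top : term (suc (suc (n ℕ.+ n))) (suc n) ≈ ε ^ suc n * q^ expo c d (suc n)
    top = *-cong
      (≈-trans (ε-even 1 (n ℕ.+ n ℕ.+ suc n)) (ε-even n (suc n)))
      (q-cong (shifted-+ (suc n) n))

  private
    a≥1 : 1 ≤ a
    a≥1 = ℕ.>-nonZero⁻¹ a

  -- The extra 1 covers c′ = 0 and n = 1, where the exponent is still 0; this case occurs for `ψ`.
  expo-large : ∀ c′ d′ → 1 ≤ c′ ℕ.+ d′ → ∀ n → n ≤ suc (expo c′ d′ n)
  expo-large c′ d′ pos zero          = z≤n
  expo-large c′ d′ pos (suc zero)    = s≤s z≤n
  expo-large c′ d′ pos (suc (suc n)) = s≤s (begin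
    suc n                                   ≤⟨ expo-large c′ d′ pos (suc n) ⟩
    1 ℕ.+ expo c′ d′ (suc n)                ≤⟨ ℕₚ.+-monoˡ-≤ (expo c′ d′ (suc n)) (begin
      1                                        ≤⟨ pos ⟩
      c′ ℕ.+ d′                                ≤⟨ ℕₚ.m≤m+n (c′ ℕ.+ d′) (n ℕ.* (c′ ℕ.+ d′)) ⟩
      suc n ℕ.* (c′ ℕ.+ d′)                    ≤⟨ ℕₚ.m≤n+m _ c′ ⟩
      c′ ℕ.+ suc n ℕ.* (c′ ℕ.+ d′)             ∎) ⟩
    expo c′ d′ (suc (suc n))                ∎)
    where open ℕₚ.≤-Reasoning

  shifted-largeʳ : ∀ k B → B ≤ shifted k B ℕ.+ suc k
  shifted-largeʳ k       zero    = z≤n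
  shifted-largeʳ zero    (suc B) = subst (suc B ≤_) (ℕₚ.+-comm 1 _)
    (expo-large d c (subst (1 ≤_) (ℕₚ.+-comm c d) a≥1) (suc B))
  shifted-largeʳ (suc k) (suc B) = subst (suc B ≤_) (sym (ℕₚ.+-suc _ (suc k))) (s≤s (shifted-largeʳ k B))

  shifted-largeˡ : ∀ k B → k ≤ shifted k B ℕ.+ suc B
  shifted-largeˡ zero    B       = z≤n
  shifted-largeˡ (suc k) zero    = subst (suc k ≤_) (ℕₚ.+-comm 1 _) (expo-large c d a≥1 (suc k))
  shifted-largeˡ (suc k) (suc B) = subst (suc k ≤_) (sym (ℕₚ.+-suc _ (suc B))) (s≤s (shifted-largeˡ k B))

  -- By `E-gauss` a Gaussian binomial is known only modulo q^(min(k,m)+1), which is poor near the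
  -- ends of the antidiagonal. There the power of q in front is large, and the two together always
  -- reach precision B.
  shifted-large : ∀ k m B → k ℕ.+ m ≡ B ℕ.+ B → B ≤ shifted k B ℕ.+ suc (k ℕ.⊓ m)
  shifted-large k m B e with ℕₚ.⊓-sel k m
  ... | inj₁ eq rewrite eq = shifted-largeʳ k B
  ... | inj₂ eq rewrite eq = ℕₚ.+-cancelˡ-≤ B _ _ (begin
    B ℕ.+ B                                 ≡⟨ e ⟨
    k ℕ.+ m                                 ≤⟨ ℕₚ.+-monoˡ-≤ m (shifted-largeˡ k B) ⟩
    shifted k B ℕ.+ suc B ℕ.+ m             ≡⟨ alg (shifted k B) B m ⟩
    B ℕ.+ (shifted k B ℕ.+ suc m)           ∎)
    where
    open ℕₚ.≤-Reasoning
    alg : ∀ s B m → s ℕ.+ suc B ℕ.+ m ≡ B ℕ.+ (s ℕ.+ suc m)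
    alg = ℕ-Solver.solve-∀

  triple-product : ∀ n → D a E * (factors c n * factors d n) ≈[ n ] θ n
  triple-product n = begin
    D a E * (factors c n * factors d n)
      ≈⟨ trunc (≈-trans (*-congˡ (finite n n)) (≈-trans (*-comm (D a E) _) (antidiag-*ʳ (n ℕ.+ n) _ (D a E)))) ⟩
    antidiag (n ℕ.+ n) (λ k m → term k n * g k m * D a E)
      ≈⟨ antidiag-trunc (n ℕ.+ n) limit ⟩
    antidiag (n ℕ.+ n) (λ k _ → term k n)
      ≈⟨ trunc (antidiag-θ n) ⟩
    θ n ∎
    where
    open ≈[]-R {n}
    limit : ∀ k m → k ℕ.+ m ≡ n ℕ.+ n → term k n * g k m * D a E ≈[ n ] term k n
    limit k m e = begin
      p * x * g k m * D a E
        ≈⟨ trunc (solve 4 (λ p x g e → p :* x :* g :* e := p :* (x :* (e :* g))) ≈-refl p x (g k m) (D a E)) ⟩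
      p * (x * (D a E * g k m))
        ≈⟨ trunc (*-congˡ (*-congˡ (D-* a E (gauss k m)))) ⟨
      p * (x * D a (E * gauss k m))
        ≈⟨ trunc-*ˡ p (weaken (shifted-large k m n e) (mono-*-trunc (shifted k n)
             (D-trunc a (E-gauss k m (s≤s (ℕₚ.m⊓n≤m k m)) (s≤s (ℕₚ.m⊓n≤n k m)))))) ⟩
      p * (x * D a oneS)
        ≈⟨ trunc (*-congˡ (≈-trans (*-congˡ (D-one a)) (*-identityʳ x))) ⟩
      p * x ∎
      where
      p x : Series
      p = ε ^ (k ℕ.+ n)
      x = q^ shifted k n

-- Theta functions as eta quotients

D-1 : ∀ f → D 1 f ≈ f
D-1 f = untrunc λ N → go N f
  where
  go : ∀ N f → D 1 f ≈[ N ] f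
  go zero    f = below λ _ ()
  go (suc N) f = begin
    D 1 f                               ≈⟨ trunc (D-unfold 1 f) ⟩
    ι (f 0) + q^ 1 * D 1 (tail f)       ≈⟨ trunc-+ trunc-refl (mono-*-trunc 1 (go N (tail f))) ⟩
    ι (f 0) + q^ 1 * tail f             ≈⟨ trunc (head-tail f) ⟨
    f                                   ∎
    where open ≈[]-R {suc N}

D-poch-suc : ∀ m .{{_ : NonZero m}} n → D m (poch (suc n)) ≈ D m (poch n) * (oneS - q^ (suc n ℕ.* m))
D-poch-suc m n = begin
  D m (poch (suc n))                          ≡⟨ cong (D m) (poch-suc n) ⟩
  D m (poch n * (oneS - q^ suc n))            ≈⟨ D-* m (poch n) (oneS - q^ suc n) ⟩
  D m (poch n) * D m (oneS - q^ suc n)        ≈⟨ *-congˡ (≈-trans (D-- m oneS (q^ suc n)) (+-cong (D-one m) (neg-cong (D-mono m (suc n))))) ⟩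
  D m (poch n) * (oneS - q^ (suc n ℕ.* m))    ∎
  where open ≈-R

D-poch-zero : ∀ m .{{_ : NonZero m}} → D m (poch 0) ≈ oneS
D-poch-zero m = ≈-trans (D-cong m (≡⇒≈ poch-zero)) (D-one m)

-- Also E(q) is used in the form `D 1 E`, so that the same lemmas serve all factors of an eta
-- quotient.
e : (m : ℕ) → .{{NonZero m}} → Series
e m = D m E

e-trunc : ∀ m .{{_ : NonZero m}} {N} n → N ≤ suc n → e m ≈[ N ] D m (poch n)
e-trunc m n N≤ = D-trunc m (E-trunc n N≤)

e1-trunc : ∀ {N} n → N ≤ suc n → e 1 ≈[ N ] poch n
e1-trunc n N≤ = trunc-trans (trunc (D-1 E)) (E-trunc n N≤)

-1S : Series
-1S = neg oneS

-1S² : -1S * -1S ≈ oneS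
-1S² = solve 0 (:- :1 :* :- :1 := :1) ≈-refl

oneS² : oneS * oneS ≈ oneS
oneS² = *-identityˡ oneS

-- The limits of the partial sums `θ` are φ(-q), f(-q, -q⁵), 2ψ(q) and f(q, q²). The factor 2 arises
-- for d = 0 because j and -1 - j have the same exponent j(j+1)/2.
module φ = TripleProduct 1 1 -1S -1S²
module Ω = TripleProduct 1 5 -1S -1S²
module ψ = TripleProduct 1 0 oneS oneS²
module Λ = TripleProduct 1 2 oneS oneS²

private
  n≤sn*m : ∀ n m .{{_ : NonZero m}} → n ≤ suc (n ℕ.* m)
  n≤sn*m n m = ℕₚ.m≤n⇒m≤1+n (ℕₚ.m≤m*n n m)

φ-factors : ∀ n → φ.factors 1 n * D 2 (poch n) ≈ poch (n ℕ.* 2)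
φ-factors zero    = ≈-trans (*-identityˡ _) (≈-trans (D-poch-zero 2) (≡⇒≈ (sym poch-zero)))
φ-factors (suc n) = begin
  φ.factors 1 n * (oneS + -1S * x₁) * D 2 (poch (suc n))
    ≈⟨ *-congˡ (D-poch-suc 2 n) ⟩
  φ.factors 1 n * (oneS + -1S * x₁) * (D 2 (poch n) * (oneS - x₂))
    ≈⟨ solve 4 (λ f p x y → f :* (:1 :+ :- :1 :* x) :* (p :* (:1 :- y)) := f :* p :* (:1 :- x) :* (:1 :- y)) ≈-refl
         (φ.factors 1 n) (D 2 (poch n)) x₁ x₂ ⟩
  φ.factors 1 n * D 2 (poch n) * (oneS - x₁) * (oneS - x₂)
    ≈⟨ *-congʳ (*-congʳ (φ-factors n)) ⟩
  poch (n ℕ.* 2) * (oneS - x₁) * (oneS - x₂)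
    ≡⟨ trans (poch-suc (1 ℕ.+ n ℕ.* 2)) (cong (_* (oneS - x₂)) (poch-suc (n ℕ.* 2))) ⟨
  poch (suc n ℕ.* 2) ∎
  where
  open ≈-R
  x₁ x₂ : Series
  x₁ = q^ (1 ℕ.+ n ℕ.* 2)
  x₂ = q^ (2 ℕ.+ n ℕ.* 2)

φ-product : ∀ n → e 2 * φ.θ n ≈[ n ] e 1 * e 1
φ-product n = begin
  e 2 * φ.θ n                       ≈⟨ trunc-*ˡ (e 2) (φ.triple-product n) ⟨
  e 2 * (e 2 * (f * f))             ≈⟨ trunc (solve 2 (λ e f → e :* (e :* (f :* f)) := (f :* e) :* (f :* e)) ≈-refl (e 2) f) ⟩
  (f * e 2) * (f * e 2)             ≈⟨ trunc-* f*e2 f*e2 ⟩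
  e 1 * e 1                         ∎
  where
  open ≈[]-R {n}
  f : Series
  f = φ.factors 1 n
  f*e2 : f * e 2 ≈[ n ] e 1
  f*e2 = begin
    f * e 2              ≈⟨ trunc-*ˡ f (e-trunc 2 n (ℕₚ.n≤1+n n)) ⟩
    f * D 2 (poch n)     ≈⟨ trunc (φ-factors n) ⟩
    poch (n ℕ.* 2)       ≈⟨ e1-trunc (n ℕ.* 2) (n≤sn*m n 2) ⟨
    e 1                  ∎

-- The residues 1 and 5 are those prime to 6, so this is inclusion and exclusion for the multiples
-- of 2, 3 and 6. The lengths 3n, 2n, 6n and n make all products stop at 1 - q^(6n).
Ω-factors : ∀ n → Ω.factors 1 n * Ω.factors 5 n * D 2 (poch (n ℕ.* 3)) * D 3 (poch (n ℕ.* 2)) ≈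
  poch (n ℕ.* 6) * D 6 (poch n)
Ω-factors zero    = ≈-trans
  (*-cong (≈-trans (*-cong (*-identityˡ oneS) (D-poch-zero 2)) (*-identityˡ oneS)) (D-poch-zero 3))
  (≈-sym (*-cong (≡⇒≈ poch-zero) (D-poch-zero 6)))
Ω-factors (suc n) = begin
  f * (oneS + -1S * x 1) * (g * (oneS + -1S * x 5)) * D 2 (poch (3 ℕ.+ n ℕ.* 3)) * D 3 (poch (2 ℕ.+ n ℕ.* 2))
    ≈⟨ *-cong (*-congˡ D2) D3 ⟩
  f * (oneS + -1S * x 1) * (g * (oneS + -1S * x 5))
    * (D 2 (poch (n ℕ.* 3)) * (oneS - x 2) * (oneS - x 4) * (oneS - x 6))
    * (D 3 (poch (n ℕ.* 2)) * (oneS - x 3) * (oneS - x 6))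
    ≈⟨ solve 10 (λ f g a b x₁ x₂ x₃ x₄ x₅ x₆ →
         f :* (:1 :+ :- :1 :* x₁) :* (g :* (:1 :+ :- :1 :* x₅)) :* (a :* (:1 :- x₂) :* (:1 :- x₄) :* (:1 :- x₆))
           :* (b :* (:1 :- x₃) :* (:1 :- x₆)) :=
         f :* g :* a :* b :* ((:1 :- x₁) :* (:1 :- x₂) :* (:1 :- x₃) :* (:1 :- x₄) :* (:1 :- x₅) :* (:1 :- x₆) :* (:1 :- x₆)))
         ≈-refl f g (D 2 (poch (n ℕ.* 3))) (D 3 (poch (n ℕ.* 2))) (x 1) (x 2) (x 3) (x 4) (x 5) (x 6) ⟩
  f * g * D 2 (poch (n ℕ.* 3)) * D 3 (poch (n ℕ.* 2))
    * ((oneS - x 1) * (oneS - x 2) * (oneS - x 3) * (oneS - x 4) * (oneS - x 5) * (oneS - x 6) * (oneS - x 6))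
    ≈⟨ *-congʳ (Ω-factors n) ⟩
  poch (n ℕ.* 6) * D 6 (poch n)
    * ((oneS - x 1) * (oneS - x 2) * (oneS - x 3) * (oneS - x 4) * (oneS - x 5) * (oneS - x 6) * (oneS - x 6))
    ≈⟨ solve 8 (λ p r x₁ x₂ x₃ x₄ x₅ x₆ →
         p :* r :* (x₁ :* x₂ :* x₃ :* x₄ :* x₅ :* x₆ :* x₆) := p :* x₁ :* x₂ :* x₃ :* x₄ :* x₅ :* x₆ :* (r :* x₆))
         ≈-refl (poch (n ℕ.* 6)) (D 6 (poch n))
         (oneS - x 1) (oneS - x 2) (oneS - x 3) (oneS - x 4) (oneS - x 5) (oneS - x 6) ⟩
  poch (n ℕ.* 6) * (oneS - x 1) * (oneS - x 2) * (oneS - x 3) * (oneS - x 4) * (oneS - x 5) * (oneS - x 6)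
    * (D 6 (poch n) * (oneS - x 6))
    ≈⟨ *-cong poch6 (D-poch-suc 6 n) ⟨
  poch (6 ℕ.+ n ℕ.* 6) * D 6 (poch (suc n)) ∎
  where
  open ≈-R
  f g : Series
  f = Ω.factors 1 n
  g = Ω.factors 5 n
  x : ℕ → Series
  x i = q^ (i ℕ.+ n ℕ.* 6)

  peel : ∀ m .{{_ : NonZero m}} j i → suc j ℕ.* m ≡ i ℕ.+ n ℕ.* 6 → D m (poch (suc j)) ≈ D m (poch j) * (oneS - x i)
  peel m j i e = ≈-trans (D-poch-suc m j) (*-congˡ (+-congˡ (neg-cong (q-cong e))))

  D2 : D 2 (poch (3 ℕ.+ n ℕ.* 3)) ≈ D 2 (poch (n ℕ.* 3)) * (oneS - x 2) * (oneS - x 4) * (oneS - x 6)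
  D2 = ≈-trans (peel 2 (2 ℕ.+ n ℕ.* 3) 6 (cong (6 ℕ.+_) (ℕₚ.*-assoc n 3 2)))
    (*-congʳ (≈-trans (peel 2 (1 ℕ.+ n ℕ.* 3) 4 (cong (4 ℕ.+_) (ℕₚ.*-assoc n 3 2)))
      (*-congʳ (peel 2 (n ℕ.* 3) 2 (cong (2 ℕ.+_) (ℕₚ.*-assoc n 3 2))))))

  D3 : D 3 (poch (2 ℕ.+ n ℕ.* 2)) ≈ D 3 (poch (n ℕ.* 2)) * (oneS - x 3) * (oneS - x 6)
  D3 = ≈-trans (peel 3 (1 ℕ.+ n ℕ.* 2) 6 (cong (6 ℕ.+_) (ℕₚ.*-assoc n 2 3)))
    (*-congʳ (peel 3 (n ℕ.* 2) 3 (cong (3 ℕ.+_) (ℕₚ.*-assoc n 2 3))))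

  step : ∀ i {f} → poch (i ℕ.+ n ℕ.* 6) ≈ f → poch (suc i ℕ.+ n ℕ.* 6) ≈ f * (oneS - x (suc i))
  step i p = ≈-trans (≡⇒≈ (poch-suc (i ℕ.+ n ℕ.* 6))) (*-congʳ p)

  poch6 : poch (6 ℕ.+ n ℕ.* 6) ≈
    poch (n ℕ.* 6) * (oneS - x 1) * (oneS - x 2) * (oneS - x 3) * (oneS - x 4) * (oneS - x 5) * (oneS - x 6)
  poch6 = step 5 (step 4 (step 3 (step 2 (step 1 (step 0 ≈-refl)))))

Ω-product : ∀ n → e 2 * e 3 * Ω.θ n ≈[ n ] e 1 * e 6 * e 6
Ω-product n = begin
  e 2 * e 3 * Ω.θ n
    ≈⟨ trunc-*ˡ (e 2 * e 3) (Ω.triple-product n) ⟨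
  e 2 * e 3 * (e 6 * (f * g))
    ≈⟨ trunc (solve 5 (λ a b c f g → a :* b :* (c :* (f :* g)) := f :* g :* a :* b :* c) ≈-refl (e 2) (e 3) (e 6) f g) ⟩
  f * g * e 2 * e 3 * e 6
    ≈⟨ trunc-*ʳ (e 6) (trunc-* (trunc-*ˡ (f * g) (e-trunc 2 (n ℕ.* 3) (n≤sn*m n 3))) (e-trunc 3 (n ℕ.* 2) (n≤sn*m n 2))) ⟩
  f * g * D 2 (poch (n ℕ.* 3)) * D 3 (poch (n ℕ.* 2)) * e 6
    ≈⟨ trunc (*-congʳ (Ω-factors n)) ⟩
  poch (n ℕ.* 6) * D 6 (poch n) * e 6
    ≈⟨ trunc-*ʳ (e 6) (trunc-* (e1-trunc (n ℕ.* 6) (n≤sn*m n 6)) (e-trunc 6 n (ℕₚ.n≤1+n n))) ⟨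
  e 1 * e 6 * e 6 ∎
  where
  open ≈[]-R {n}
  f g : Series
  f = Ω.factors 1 n
  g = Ω.factors 5 n

ψ-factors₁ : ∀ n → ψ.factors 1 n * poch n ≈ D 2 (poch n)
ψ-factors₁ zero    = ≈-trans (*-identityˡ _) (≈-trans (≡⇒≈ poch-zero) (≈-sym (D-poch-zero 2)))
ψ-factors₁ (suc n) = begin
  f * (oneS + oneS * q^ (1 ℕ.+ n ℕ.* 1)) * poch (suc n)
    ≈⟨ *-cong (*-congˡ (+-congˡ (*-congˡ (q-cong (cong suc (ℕₚ.*-identityʳ n)))))) (≡⇒≈ (poch-suc n)) ⟩
  f * (oneS + oneS * x) * (poch n * (oneS - x))
    ≈⟨ solve 3 (λ f p x → f :* (:1 :+ :1 :* x) :* (p :* (:1 :- x)) := f :* p :* (:1 :- x :* x)) ≈-refl f (poch n) x ⟩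
  f * poch n * (oneS - x * x)
    ≈⟨ *-cong (ψ-factors₁ n) (+-congˡ (neg-cong (≈-trans (mono-+ (suc n) (suc n)) (q-cong (alg n))))) ⟩
  D 2 (poch n) * (oneS - q^ (suc n ℕ.* 2))
    ≈⟨ D-poch-suc 2 n ⟨
  D 2 (poch (suc n)) ∎
  where
  open ≈-R
  f x : Series
  f = ψ.factors 1 n
  x = q^ suc n
  alg : ∀ n → suc n ℕ.+ suc n ≡ suc n ℕ.* 2
  alg = ℕ-Solver.solve-∀

-- For d = 0 the second product starts with 1 + q^0 = 2. Moving its range up by one trades this
-- factor for 1 + q^n, which is 1 modulo q^n.
ψ-factors₀ : ∀ n → ψ.factors 0 n * (oneS + oneS * q^ (n ℕ.* 1)) ≈ ι (+ 2) * ψ.factors 1 n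
ψ-factors₀ zero    = ≈-trans (*-congˡ (+-congˡ (*-congˡ mono-0)))
  (solve 0 (:1 :* (:1 :+ :1 :* :1) := con (+ 2) :* :1) ≈-refl)
ψ-factors₀ (suc n) = ≈-trans (*-congʳ (ψ-factors₀ n))
  (solve 2 (λ f y → con (+ 2) :* f :* y := con (+ 2) :* (f :* y)) ≈-refl
    (ψ.factors 1 n) (oneS + oneS * q^ (1 ℕ.+ n ℕ.* 1)))

ψ-product : ∀ n → e 1 * ψ.θ n ≈[ n ] ι (+ 2) * (e 2 * e 2)
ψ-product n = begin
  e 1 * ψ.θ n
    ≈⟨ trunc-*ˡ (e 1) (ψ.triple-product n) ⟨
  e 1 * (e 1 * (f * ψ.factors 0 n))
    ≈⟨ trunc-*ˡ (e 1) (trunc-*ˡ (e 1) (trunc-*ˡ f f₀)) ⟩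
  e 1 * (e 1 * (f * (ι (+ 2) * f)))
    ≈⟨ trunc (solve 2 (λ e f → e :* (e :* (f :* (con (+ 2) :* f))) := con (+ 2) :* (f :* e :* (f :* e))) ≈-refl (e 1) f) ⟩
  ι (+ 2) * (f * e 1 * (f * e 1))
    ≈⟨ trunc-*ˡ (ι (+ 2)) (trunc-* f*e1 f*e1) ⟩
  ι (+ 2) * (e 2 * e 2) ∎
  where
  open ≈[]-R {n}
  f : Series
  f = ψ.factors 1 n

  f*e1 : f * e 1 ≈[ n ] e 2
  f*e1 = begin
    f * e 1          ≈⟨ trunc-*ˡ f (e1-trunc n (ℕₚ.n≤1+n n)) ⟩
    f * poch n       ≈⟨ trunc (ψ-factors₁ n) ⟩
    D 2 (poch n)     ≈⟨ e-trunc 2 n (ℕₚ.n≤1+n n) ⟨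
    e 2              ∎

  f₀ : ψ.factors 0 n ≈[ n ] ι (+ 2) * f
  f₀ = begin
    ψ.factors 0 n
      ≈⟨ trunc (≈-trans (solve 1 (λ g → g := g :* (:1 :+ :1 :* con (+ 0))) ≈-refl (ψ.factors 0 n))
           (*-congˡ (+-congˡ (*-congˡ ι-zero)))) ⟩
    ψ.factors 0 n * (oneS + oneS * zeroS)
      ≈⟨ trunc-*ˡ (ψ.factors 0 n) (trunc-+ trunc-refl (trunc-*ˡ oneS
           (weaken (ℕₚ.≤-reflexive (sym (ℕₚ.*-identityʳ n))) (mono-vanish (n ℕ.* 1))))) ⟨
    ψ.factors 0 n * (oneS + oneS * q^ (n ℕ.* 1))
      ≈⟨ trunc (ψ-factors₀ n) ⟩
    ι (+ 2) * f ∎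

-- The left-hand factors are 1 + q^k for k prime to 3. Each is (1 - q^(2k))/(1 - q^k), and the
-- Pochhammer products in q⁶ and q³ account for the multiples of 3.
Λ-factors : ∀ n → Λ.factors 1 n * Λ.factors 2 n * D 6 (poch n) * poch (n ℕ.* 3) ≈ D 2 (poch (n ℕ.* 3)) * D 3 (poch n)
Λ-factors zero    = ≈-trans
  (*-cong (≈-trans (*-cong (*-identityˡ oneS) (D-poch-zero 6)) (*-identityˡ oneS)) (≡⇒≈ poch-zero))
  (≈-sym (*-cong (D-poch-zero 2) (D-poch-zero 3)))
Λ-factors (suc n) = begin
  f * (oneS + oneS * x 1) * (g * (oneS + oneS * x 2)) * D 6 (poch (suc n)) * poch (3 ℕ.+ n ℕ.* 3)
    ≈⟨ *-cong (*-congˡ D6) poch3 ⟩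
  f * (oneS + oneS * x 1) * (g * (oneS + oneS * x 2)) * (D 6 (poch n) * (oneS - x 3 * x 3))
    * (poch (n ℕ.* 3) * (oneS - x 1) * (oneS - x 2) * (oneS - x 3))
    ≈⟨ solve 7 (λ f g a p x₁ x₂ x₃ →
         f :* (:1 :+ :1 :* x₁) :* (g :* (:1 :+ :1 :* x₂)) :* (a :* (:1 :- x₃ :* x₃))
           :* (p :* (:1 :- x₁) :* (:1 :- x₂) :* (:1 :- x₃)) :=
         f :* g :* a :* p :* ((:1 :- x₁ :* x₁) :* (:1 :- x₂ :* x₂) :* (:1 :- x₃ :* x₃) :* (:1 :- x₃)))
         ≈-refl f g (D 6 (poch n)) (poch (n ℕ.* 3)) (x 1) (x 2) (x 3) ⟩
  f * g * D 6 (poch n) * poch (n ℕ.* 3)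
    * ((oneS - x 1 * x 1) * (oneS - x 2 * x 2) * (oneS - x 3 * x 3) * (oneS - x 3))
    ≈⟨ *-congʳ (Λ-factors n) ⟩
  D 2 (poch (n ℕ.* 3)) * D 3 (poch n)
    * ((oneS - x 1 * x 1) * (oneS - x 2 * x 2) * (oneS - x 3 * x 3) * (oneS - x 3))
    ≈⟨ solve 6 (λ a b y₁ y₂ y₃ z → a :* b :* (y₁ :* y₂ :* y₃ :* z) := a :* y₁ :* y₂ :* y₃ :* (b :* z)) ≈-refl
         (D 2 (poch (n ℕ.* 3))) (D 3 (poch n)) (oneS - x 1 * x 1) (oneS - x 2 * x 2) (oneS - x 3 * x 3) (oneS - x 3) ⟩
  D 2 (poch (n ℕ.* 3)) * (oneS - x 1 * x 1) * (oneS - x 2 * x 2) * (oneS - x 3 * x 3) * (D 3 (poch n) * (oneS - x 3))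
    ≈⟨ *-cong D2 (D-poch-suc 3 n) ⟨
  D 2 (poch (3 ℕ.+ n ℕ.* 3)) * D 3 (poch (suc n)) ∎
  where
  open ≈-R
  f g : Series
  f = Λ.factors 1 n
  g = Λ.factors 2 n
  x : ℕ → Series
  x i = q^ (i ℕ.+ n ℕ.* 3)

  square : ∀ {k} i → k ≡ i ℕ.+ n ℕ.* 3 ℕ.+ (i ℕ.+ n ℕ.* 3) → q^ k ≈ x i * x i
  square i e = ≈-trans (q-cong e) (≈-sym (mono-+ _ _))

  D6 : D 6 (poch (suc n)) ≈ D 6 (poch n) * (oneS - x 3 * x 3)
  D6 = ≈-trans (D-poch-suc 6 n) (*-congˡ (+-congˡ (neg-cong (square 3 (alg n)))))
    where
    alg : ∀ n → suc n ℕ.* 6 ≡ 3 ℕ.+ n ℕ.* 3 ℕ.+ (3 ℕ.+ n ℕ.* 3)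
    alg = ℕ-Solver.solve-∀

  double : ∀ k → k ℕ.* 2 ≡ k ℕ.+ k
  double = ℕ-Solver.solve-∀

  peel : ∀ i → D 2 (poch (suc i ℕ.+ n ℕ.* 3)) ≈ D 2 (poch (i ℕ.+ n ℕ.* 3)) * (oneS - x (suc i) * x (suc i))
  peel i = ≈-trans (D-poch-suc 2 (i ℕ.+ n ℕ.* 3))
    (*-congˡ (+-congˡ (neg-cong (square (suc i) (double (suc i ℕ.+ n ℕ.* 3))))))

  D2 : D 2 (poch (3 ℕ.+ n ℕ.* 3)) ≈
    D 2 (poch (n ℕ.* 3)) * (oneS - x 1 * x 1) * (oneS - x 2 * x 2) * (oneS - x 3 * x 3)
  D2 = ≈-trans (peel 2) (*-congʳ (≈-trans (peel 1) (*-congʳ (peel 0))))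

  poch3 : poch (3 ℕ.+ n ℕ.* 3) ≈ poch (n ℕ.* 3) * (oneS - x 1) * (oneS - x 2) * (oneS - x 3)
  poch3 = ≈-trans (≡⇒≈ (poch-suc (2 ℕ.+ n ℕ.* 3))) (*-congʳ (≈-trans (≡⇒≈ (poch-suc (1 ℕ.+ n ℕ.* 3)))
    (*-congʳ (≡⇒≈ (poch-suc (n ℕ.* 3))))))

Λ-product : ∀ n → e 1 * e 6 * Λ.θ n ≈[ n ] e 2 * e 3 * e 3
Λ-product n = begin
  e 1 * e 6 * Λ.θ n
    ≈⟨ trunc-*ˡ (e 1 * e 6) (Λ.triple-product n) ⟨
  e 1 * e 6 * (e 3 * (f * g))
    ≈⟨ trunc (solve 5 (λ a b c f g → a :* b :* (c :* (f :* g)) := f :* g :* b :* a :* c) ≈-refl (e 1) (e 6) (e 3) f g) ⟩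
  f * g * e 6 * e 1 * e 3
    ≈⟨ trunc-*ʳ (e 3) (trunc-* (trunc-*ˡ (f * g) (e-trunc 6 n (ℕₚ.n≤1+n n))) (e1-trunc (n ℕ.* 3) (n≤sn*m n 3))) ⟩
  f * g * D 6 (poch n) * poch (n ℕ.* 3) * e 3
    ≈⟨ trunc (*-congʳ (Λ-factors n)) ⟩
  D 2 (poch (n ℕ.* 3)) * D 3 (poch n) * e 3
    ≈⟨ trunc-*ʳ (e 3) (trunc-* (e-trunc 2 (n ℕ.* 3) (n≤sn*m n 3)) (e-trunc 3 n (ℕₚ.n≤1+n n))) ⟨
  e 2 * e 3 * e 3 ∎
  where
  open ≈[]-R {n}
  f g : Series
  f = Λ.factors 1 n
  g = Λ.factors 2 n

-- Splitting the theta series by the residue of the summation index modulo 3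

tri : ℕ → ℕ
tri zero    = 0
tri (suc n) = n ℕ.+ tri n

expo-tri : ∀ c d n → expo c d n ≡ (c ℕ.+ d) ℕ.* tri n ℕ.+ c ℕ.* n
expo-tri c d zero    = alg c d
  where
  alg : ∀ c d → 0 ≡ (c ℕ.+ d) ℕ.* 0 ℕ.+ c ℕ.* 0
  alg = ℕ-Solver.solve-∀
expo-tri c d (suc n) rewrite expo-tri c d n = alg c d n (tri n)
  where
  alg : ∀ c d n t → c ℕ.+ n ℕ.* (c ℕ.+ d) ℕ.+ ((c ℕ.+ d) ℕ.* t ℕ.+ c ℕ.* n) ≡
    (c ℕ.+ d) ℕ.* (n ℕ.+ t) ℕ.+ c ℕ.* suc n
  alg = ℕ-Solver.solve-∀

tri-triple : ∀ n → tri (n ℕ.* 3) ≡ 9 ℕ.* tri n ℕ.+ 3 ℕ.* n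
tri-triple zero    = refl
tri-triple (suc n) rewrite tri-triple n = alg n (tri n)
  where
  alg : ∀ n t → 2 ℕ.+ n ℕ.* 3 ℕ.+ (1 ℕ.+ n ℕ.* 3 ℕ.+ (n ℕ.* 3 ℕ.+ (9 ℕ.* t ℕ.+ 3 ℕ.* n))) ≡
    9 ℕ.* (n ℕ.+ t) ℕ.+ 3 ℕ.* suc n
  alg = ℕ-Solver.solve-∀

-- For a numeral `i` this unrolls to an explicit sum that the ring solver can handle.
tri-above : ℕ → ℕ → ℕ → ℕ
tri-above zero    k t = t
tri-above (suc i) k t = i ℕ.+ k ℕ.+ tri-above i k t

tri-+ : ∀ i k → tri (i ℕ.+ k) ≡ tri-above i k (tri k)
tri-+ zero    k = refl
tri-+ (suc i) k = cong (i ℕ.+ k ℕ.+_) (tri-+ i k)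

-- The quadratic part n(n-1)/2 of the exponents is abstracted to a variable `t`, so that what
-- remains is a polynomial identity for the ring solver. The summation index is i + 3n, `m` is the
-- dilation of the component and `s` the power of q split off.
expo-triple : ∀ i s m c d c′ d′ n →
  (∀ t → (c ℕ.+ d) ℕ.* tri-above i (n ℕ.* 3) (9 ℕ.* t ℕ.+ 3 ℕ.* n) ℕ.+ c ℕ.* (i ℕ.+ n ℕ.* 3) ≡
    s ℕ.+ ((c′ ℕ.+ d′) ℕ.* (n ℕ.+ t) ℕ.+ c′ ℕ.* suc n) ℕ.* m) →
  expo c d (i ℕ.+ n ℕ.* 3) ≡ s ℕ.+ expo c′ d′ (suc n) ℕ.* m
expo-triple i s m c d c′ d′ n alg = begin
  expo c d (i ℕ.+ n ℕ.* 3)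
    ≡⟨ expo-tri c d (i ℕ.+ n ℕ.* 3) ⟩
  (c ℕ.+ d) ℕ.* tri (i ℕ.+ n ℕ.* 3) ℕ.+ c ℕ.* (i ℕ.+ n ℕ.* 3)
    ≡⟨ cong (λ t → (c ℕ.+ d) ℕ.* t ℕ.+ c ℕ.* (i ℕ.+ n ℕ.* 3))
         (trans (tri-+ i (n ℕ.* 3)) (cong (tri-above i (n ℕ.* 3)) (tri-triple n))) ⟩
  (c ℕ.+ d) ℕ.* tri-above i (n ℕ.* 3) (9 ℕ.* tri n ℕ.+ 3 ℕ.* n) ℕ.+ c ℕ.* (i ℕ.+ n ℕ.* 3)
    ≡⟨ alg (tri n) ⟩
  s ℕ.+ ((c′ ℕ.+ d′) ℕ.* (n ℕ.+ tri n) ℕ.+ c′ ℕ.* suc n) ℕ.* m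
    ≡⟨ cong (λ x → s ℕ.+ x ℕ.* m) (expo-tri c′ d′ (suc n)) ⟨
  s ℕ.+ expo c′ d′ (suc n) ℕ.* m ∎
  where open ≡-Reasoning

^-pull : ∀ ε → ε * ε ≈ oneS → ∀ n → ε ^ (n ℕ.* 3) ≈ ε ^ n
^-pull ε ε² zero    = ≈-refl
^-pull ε ε² (suc n) = begin
  ε * (ε * (ε * ε ^ (n ℕ.* 3)))   ≈⟨ solve 2 (λ e p → e :* (e :* (e :* p)) := e :* e :* (e :* p)) ≈-refl ε (ε ^ (n ℕ.* 3)) ⟩
  ε * ε * (ε * ε ^ (n ℕ.* 3))     ≈⟨ *-cong ε² (*-congˡ (^-pull ε ε² n)) ⟩
  oneS * (ε * ε ^ n)              ≈⟨ *-identityˡ _ ⟩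
  ε * ε ^ n                       ∎
  where open ≈-R

one-^ : ∀ n → oneS ^ n ≈ oneS
one-^ zero    = ≈-refl
one-^ (suc n) = ≈-trans (*-identityˡ _) (one-^ n)

D-term : ∀ m .{{_ : NonZero m}} f p x y → D m p ≈ p →
  D m (f + p * (q^ x + q^ y)) ≈ D m f + p * (q^ (x ℕ.* m) + q^ (y ℕ.* m))
D-term m f p x y Dp = ≈-trans (D-+ m f _) (+-congˡ (≈-trans (D-* m p _)
  (*-cong Dp (≈-trans (D-+ m _ _) (+-cong (D-mono m x) (D-mono m y))))))

D-sign : ∀ m .{{_ : NonZero m}} n → D m (-1S ^ n) ≈ -1S ^ n
D-sign m n = ≈-trans (D-^ m -1S n) (^-congˡ n (≈-trans (D-neg m oneS) (neg-cong (D-one m))))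

D-one-^ : ∀ m .{{_ : NonZero m}} n → D m (oneS ^ n) ≈ oneS ^ n
D-one-^ m n = ≈-trans (D-^ m oneS n) (^-congˡ n (D-one m))

-- Indices k = 3j give k² = 9j². The classes k = 3j + 1 and k = 3j - 1 are exchanged by k ↦ -k and
-- give 1 + 3(3j² ± 2j), whence the factor 2; the minus sign is that of (-1)^k. With |k| at most 3n
-- + 1 all classes are cut at |j| at most n.
φ-split : ∀ n → φ.θ (suc (n ℕ.* 3)) ≈ D 9 (φ.θ n) - ι (+ 2) * (q^ 1 * D 3 (Ω.θ n))
φ-split zero = begin
  oneS + -1S * oneS * (q^ 1 + q^ 1)
    ≈⟨ solve 1 (λ x → :1 :+ :- :1 :* :1 :* (x :+ x) := :1 :- con (+ 2) :* (x :* :1)) ≈-refl (q^ 1) ⟩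
  oneS - ι (+ 2) * (q^ 1 * oneS)
    ≈⟨ +-cong (D-one 9) (neg-cong (*-congˡ (*-congˡ (D-one 3)))) ⟨
  D 9 oneS - ι (+ 2) * (q^ 1 * D 3 oneS) ∎
  where open ≈-R
φ-split (suc n) = begin
  φ.θ (suc (n ℕ.* 3)) + -1S * (-1S * p₃) * (x 2 + x 2) + -1S * (-1S * (-1S * p₃)) * (x 3 + x 3)
    + -1S * (-1S * (-1S * (-1S * p₃))) * (x 4 + x 4)
    ≈⟨ solve 5 (λ t p x₂ x₃ x₄ → t :+ :- :1 :* (:- :1 :* p) :* (x₂ :+ x₂) :+ :- :1 :* (:- :1 :* (:- :1 :* p)) :* (x₃ :+ x₃)
         :+ :- :1 :* (:- :1 :* (:- :1 :* (:- :1 :* p))) :* (x₄ :+ x₄) :=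
         t :+ p :* (con (+ 2) :* (x₂ :+ x₄ :- x₃))) ≈-refl
         (φ.θ (suc (n ℕ.* 3))) p₃ (x 2) (x 3) (x 4) ⟩
  φ.θ (suc (n ℕ.* 3)) + p₃ * (ι (+ 2) * (x 2 + x 4 - x 3))
    ≈⟨ +-cong (φ-split n) (*-cong (^-pull -1S -1S² n) (*-congˡ (+-cong (+-cong x₂ x₄) (neg-cong x₃)))) ⟩
  D 9 (φ.θ n) - ι (+ 2) * (q^ 1 * D 3 (Ω.θ n)) + p * (ι (+ 2) * (q^ 1 * y₁ + q^ 1 * y₂ - z))
    ≈⟨ solve 7 (λ a b q p y₁ y₂ z →
         a :- con (+ 2) :* (q :* b) :+ p :* (con (+ 2) :* (q :* y₁ :+ q :* y₂ :- z)) :=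
         a :+ :- :1 :* p :* (z :+ z) :- con (+ 2) :* (q :* (b :+ :- :1 :* p :* (y₁ :+ y₂)))) ≈-refl
         (D 9 (φ.θ n)) (D 3 (Ω.θ n)) (q^ 1) p y₁ y₂ z ⟩
  D 9 (φ.θ n) + -1S * p * (z + z) - ι (+ 2) * (q^ 1 * (D 3 (Ω.θ n) + -1S * p * (y₁ + y₂)))
    ≈⟨ +-cong (D-term 9 (φ.θ n) (-1S ^ suc n) _ _ (D-sign 9 (suc n)))
         (neg-cong (*-congˡ (*-congˡ (D-term 3 (Ω.θ n) (-1S ^ suc n) _ _ (D-sign 3 (suc n)))))) ⟨
  D 9 (φ.θ (suc n)) - ι (+ 2) * (q^ 1 * D 3 (Ω.θ (suc n))) ∎
  where
  open ≈-R
  p p₃ y₁ y₂ z : Series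
  p  = -1S ^ n
  p₃ = -1S ^ (n ℕ.* 3)
  y₁ = q^ (expo 1 5 (suc n) ℕ.* 3)
  y₂ = q^ (expo 5 1 (suc n) ℕ.* 3)
  z  = q^ (expo 1 1 (suc n) ℕ.* 9)
  x : ℕ → Series
  x i = q^ (expo 1 1 (i ℕ.+ n ℕ.* 3))

  x₃ : x 3 ≈ z
  x₃ = q-cong (expo-triple 3 0 9 1 1 1 1 n (alg n))
    where
    alg : ∀ n t → 2 ℕ.* (2 ℕ.+ n ℕ.* 3 ℕ.+ (1 ℕ.+ n ℕ.* 3 ℕ.+ (n ℕ.* 3 ℕ.+ (9 ℕ.* t ℕ.+ 3 ℕ.* n)))) ℕ.+ 1 ℕ.* (3 ℕ.+ n ℕ.* 3) ≡
      (2 ℕ.* (n ℕ.+ t) ℕ.+ 1 ℕ.* suc n) ℕ.* 9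
    alg = ℕ-Solver.solve-∀

  x₂ : x 2 ≈ q^ 1 * y₁
  x₂ = ≈-trans (q-cong (expo-triple 2 1 3 1 1 1 5 n (alg n))) (≈-sym (mono-+ 1 _))
    where
    alg : ∀ n t → 2 ℕ.* (1 ℕ.+ n ℕ.* 3 ℕ.+ (n ℕ.* 3 ℕ.+ (9 ℕ.* t ℕ.+ 3 ℕ.* n))) ℕ.+ 1 ℕ.* (2 ℕ.+ n ℕ.* 3) ≡
      1 ℕ.+ (6 ℕ.* (n ℕ.+ t) ℕ.+ 1 ℕ.* suc n) ℕ.* 3
    alg = ℕ-Solver.solve-∀

  x₄ : x 4 ≈ q^ 1 * y₂
  x₄ = ≈-trans (q-cong (expo-triple 4 1 3 1 1 5 1 n (alg n))) (≈-sym (mono-+ 1 _))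
    where
    alg : ∀ n t → 2 ℕ.* (3 ℕ.+ n ℕ.* 3 ℕ.+ (2 ℕ.+ n ℕ.* 3 ℕ.+ (1 ℕ.+ n ℕ.* 3 ℕ.+ (n ℕ.* 3 ℕ.+ (9 ℕ.* t ℕ.+ 3 ℕ.* n))))) ℕ.+ 1 ℕ.* (4 ℕ.+ n ℕ.* 3) ≡
      1 ℕ.+ (6 ℕ.* (n ℕ.+ t) ℕ.+ 5 ℕ.* suc n) ℕ.* 3
    alg = ℕ-Solver.solve-∀

-- For j = 3i + 1 the exponent j(j+1)/2 is 1 + 9 i(i+1)/2. The other two classes have exponents
-- divisible by 3 and are exchanged by j ↦ -1 - j, whence the factor 2.
ψ-split : ∀ n → ψ.θ (suc (n ℕ.* 3)) ≈ ι (+ 2) * D 3 (Λ.θ n) + q^ 1 * D 9 (ψ.θ n)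
ψ-split zero = begin
  oneS + oneS * oneS * (q^ 1 + q^ 0)
    ≈⟨ +-congˡ (*-congˡ (+-congˡ mono-0)) ⟩
  oneS + oneS * oneS * (q^ 1 + oneS)
    ≈⟨ solve 1 (λ x → :1 :+ :1 :* :1 :* (x :+ :1) := con (+ 2) :* :1 :+ x :* :1) ≈-refl (q^ 1) ⟩
  ι (+ 2) * oneS + q^ 1 * oneS
    ≈⟨ +-cong (*-congˡ (D-one 3)) (*-congˡ (D-one 9)) ⟨
  ι (+ 2) * D 3 oneS + q^ 1 * D 9 oneS ∎
  where open ≈-R
ψ-split (suc n) = begin
  ψ.θ (suc (n ℕ.* 3)) + oneS ^ (2 ℕ.+ n ℕ.* 3) * (x 2 + y 2) + oneS ^ (3 ℕ.+ n ℕ.* 3) * (x 3 + y 3)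
    + oneS ^ (4 ℕ.+ n ℕ.* 3) * (x 4 + y 4)
    ≈⟨ +-cong (+-cong (+-cong (ψ-split n) (*-cong (one-^ (2 ℕ.+ n ℕ.* 3)) (+-cong x₂ y₂))) (*-cong (one-^ (3 ℕ.+ n ℕ.* 3)) (+-cong x₃ y₃)))
         (*-cong (one-^ (4 ℕ.+ n ℕ.* 3)) (+-cong x₄ y₄)) ⟩
  ι (+ 2) * D 3 (Λ.θ n) + q^ 1 * D 9 (ψ.θ n) + oneS * (u + q^ 1 * w₂) + oneS * (v + u) + oneS * (q^ 1 * w₁ + v)
    ≈⟨ solve 7 (λ a b q u v w₁ w₂ →
         con (+ 2) :* a :+ q :* b :+ :1 :* (u :+ q :* w₂) :+ :1 :* (v :+ u) :+ :1 :* (q :* w₁ :+ v) :=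
         con (+ 2) :* (a :+ :1 :* (u :+ v)) :+ q :* (b :+ :1 :* (w₁ :+ w₂))) ≈-refl
         (D 3 (Λ.θ n)) (D 9 (ψ.θ n)) (q^ 1) u v w₁ w₂ ⟩
  ι (+ 2) * (D 3 (Λ.θ n) + oneS * (u + v)) + q^ 1 * (D 9 (ψ.θ n) + oneS * (w₁ + w₂))
    ≈⟨ +-cong (*-congˡ (+-congˡ (*-congʳ (one-^ (suc n))))) (*-congˡ (+-congˡ (*-congʳ (one-^ (suc n))))) ⟨
  ι (+ 2) * (D 3 (Λ.θ n) + oneS ^ suc n * (u + v)) + q^ 1 * (D 9 (ψ.θ n) + oneS ^ suc n * (w₁ + w₂))
    ≈⟨ +-cong (*-congˡ (D-term 3 (Λ.θ n) (oneS ^ suc n) _ _ (D-one-^ 3 (suc n))))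
         (*-congˡ (D-term 9 (ψ.θ n) (oneS ^ suc n) _ _ (D-one-^ 9 (suc n)))) ⟨
  ι (+ 2) * D 3 (Λ.θ (suc n)) + q^ 1 * D 9 (ψ.θ (suc n)) ∎
  where
  open ≈-R
  u v w₁ w₂ : Series
  u  = q^ (expo 1 2 (suc n) ℕ.* 3)
  v  = q^ (expo 2 1 (suc n) ℕ.* 3)
  w₁ = q^ (expo 1 0 (suc n) ℕ.* 9)
  w₂ = q^ (expo 0 1 (suc n) ℕ.* 9)
  x y : ℕ → Series
  x i = q^ (expo 1 0 (i ℕ.+ n ℕ.* 3))
  y i = q^ (expo 0 1 (i ℕ.+ n ℕ.* 3))

  x₂ : x 2 ≈ u
  x₂ = (q-cong (expo-triple 2 0 3 1 0 1 2 n (alg n)))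
    where
    alg : ∀ n t → 1 ℕ.* (1 ℕ.+ n ℕ.* 3 ℕ.+ (n ℕ.* 3 ℕ.+ (9 ℕ.* t ℕ.+ 3 ℕ.* n))) ℕ.+ 1 ℕ.* (2 ℕ.+ n ℕ.* 3) ≡
      (3 ℕ.* (n ℕ.+ t) ℕ.+ 1 ℕ.* suc n) ℕ.* 3
    alg = ℕ-Solver.solve-∀

  y₂ : y 2 ≈ q^ 1 * w₂
  y₂ = ≈-trans (q-cong (expo-triple 2 1 9 0 1 0 1 n (alg n))) (≈-sym (mono-+ 1 _))
    where
    alg : ∀ n t → 1 ℕ.* (1 ℕ.+ n ℕ.* 3 ℕ.+ (n ℕ.* 3 ℕ.+ (9 ℕ.* t ℕ.+ 3 ℕ.* n))) ℕ.+ 0 ≡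
      1 ℕ.+ (1 ℕ.* (n ℕ.+ t) ℕ.+ 0) ℕ.* 9
    alg = ℕ-Solver.solve-∀

  x₃ : x 3 ≈ v
  x₃ = (q-cong (expo-triple 3 0 3 1 0 2 1 n (alg n)))
    where
    alg : ∀ n t → 1 ℕ.* (2 ℕ.+ n ℕ.* 3 ℕ.+ (1 ℕ.+ n ℕ.* 3 ℕ.+ (n ℕ.* 3 ℕ.+ (9 ℕ.* t ℕ.+ 3 ℕ.* n)))) ℕ.+ 1 ℕ.* (3 ℕ.+ n ℕ.* 3) ≡
      (3 ℕ.* (n ℕ.+ t) ℕ.+ 2 ℕ.* suc n) ℕ.* 3
    alg = ℕ-Solver.solve-∀

  y₃ : y 3 ≈ u
  y₃ = (q-cong (expo-triple 3 0 3 0 1 1 2 n (alg n)))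
    where
    alg : ∀ n t → 1 ℕ.* (2 ℕ.+ n ℕ.* 3 ℕ.+ (1 ℕ.+ n ℕ.* 3 ℕ.+ (n ℕ.* 3 ℕ.+ (9 ℕ.* t ℕ.+ 3 ℕ.* n)))) ℕ.+ 0 ≡
      (3 ℕ.* (n ℕ.+ t) ℕ.+ 1 ℕ.* suc n) ℕ.* 3
    alg = ℕ-Solver.solve-∀

  x₄ : x 4 ≈ q^ 1 * w₁
  x₄ = ≈-trans (q-cong (expo-triple 4 1 9 1 0 1 0 n (alg n))) (≈-sym (mono-+ 1 _))
    where
    alg : ∀ n t → 1 ℕ.* (3 ℕ.+ n ℕ.* 3 ℕ.+ (2 ℕ.+ n ℕ.* 3 ℕ.+ (1 ℕ.+ n ℕ.* 3 ℕ.+ (n ℕ.* 3 ℕ.+ (9 ℕ.* t ℕ.+ 3 ℕ.* n))))) ℕ.+ 1 ℕ.* (4 ℕ.+ n ℕ.* 3) ≡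
      1 ℕ.+ (1 ℕ.* (n ℕ.+ t) ℕ.+ 1 ℕ.* suc n) ℕ.* 9
    alg = ℕ-Solver.solve-∀

  y₄ : y 4 ≈ v
  y₄ = (q-cong (expo-triple 4 0 3 0 1 2 1 n (alg n)))
    where
    alg : ∀ n t → 1 ℕ.* (3 ℕ.+ n ℕ.* 3 ℕ.+ (2 ℕ.+ n ℕ.* 3 ℕ.+ (1 ℕ.+ n ℕ.* 3 ℕ.+ (n ℕ.* 3 ℕ.+ (9 ℕ.* t ℕ.+ 3 ℕ.* n))))) ℕ.+ 0 ≡
      (3 ℕ.* (n ℕ.+ t) ℕ.+ 2 ℕ.* suc n) ℕ.* 3
    alg = ℕ-Solver.solve-∀

-- The 3-dissections of φ(-q) and ψ(q)

e⁻¹ : (m : ℕ) → .{{NonZero m}} → Series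
e⁻¹ m = invS (e m)

e-inverse : ∀ m .{{_ : NonZero m}} → e m * e⁻¹ m ≈ oneS
e-inverse m = *-invS (e m) (D-zero m E)

unit-solve : ∀ {N u v f g} → u * v ≈ oneS → u * f ≈[ N ] g → f ≈[ N ] v * g
unit-solve {N} {u} {v} {f} {g} uv p = begin
  f             ≈⟨ trunc (≈-trans (*-congʳ uv) (*-identityˡ f)) ⟨
  u * v * f     ≈⟨ trunc (solve 3 (λ u v f → u :* v :* f := v :* (u :* f)) ≈-refl u v f) ⟩
  v * (u * f)   ≈⟨ trunc-*ˡ v p ⟩
  v * g         ∎
  where open ≈[]-R {N}

unit-solve-≈ : ∀ {u v f g} → u * v ≈ oneS → u * f ≈ g → f ≈ v * g
unit-solve-≈ uv p = untrunc λ N → unit-solve uv (trunc p)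

D-e : ∀ m n k .{{_ : NonZero m}} .{{_ : NonZero n}} .{{_ : NonZero k}} → k ≡ n ℕ.* m → D m (e n) ≈ e k
D-e m n k k≡ = D-∘ m n k k≡ E

D-e⁻¹ : ∀ m n k .{{_ : NonZero m}} .{{_ : NonZero n}} .{{_ : NonZero k}} → k ≡ n ℕ.* m → D m (e⁻¹ n) ≈ e⁻¹ k
D-e⁻¹ m n k k≡ = ≈-trans (unit-solve-≈ (e-inverse k) (begin
  e k * D m (e⁻¹ n)           ≈⟨ *-congʳ (D-e m n k k≡) ⟨
  D m (e n) * D m (e⁻¹ n)     ≈⟨ D-* m (e n) (e⁻¹ n) ⟨
  D m (e n * e⁻¹ n)           ≈⟨ D-cong m (e-inverse n) ⟩
  D m oneS                    ≈⟨ D-one m ⟩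
  oneS                        ∎)) (*-identityʳ (e⁻¹ k))
  where open ≈-R

-- The components of φ(-q) = φ₃(q³) - 2q Ω₁(q³).
φ₃ Ω₁ : Series
φ₃ = e⁻¹ 6 * (e 3 * e 3)
Ω₁ = e⁻¹ 2 * (e⁻¹ 3 * (e 1 * e 6 * e 6))

D-3-φ₃ : D 3 φ₃ ≈ e⁻¹ 18 * (e 9 * e 9)
D-3-φ₃ = ≈-trans (D-* 3 (e⁻¹ 6) (e 3 * e 3)) (*-cong (D-e⁻¹ 3 6 18 refl)
  (≈-trans (D-* 3 (e 3) (e 3)) (*-cong (D-e 3 3 9 refl) (D-e 3 3 9 refl))))

D-3-Ω₁ : D 3 Ω₁ ≈ e⁻¹ 6 * (e⁻¹ 9 * (e 3 * e 18 * e 18))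
D-3-Ω₁ = ≈-trans (D-* 3 (e⁻¹ 2) _) (*-cong (D-e⁻¹ 3 2 6 refl)
  (≈-trans (D-* 3 (e⁻¹ 3) _) (*-cong (D-e⁻¹ 3 3 9 refl)
    (≈-trans (D-* 3 (e 1 * e 6) (e 6)) (*-cong (≈-trans (D-* 3 (e 1) (e 6))
      (*-cong (D-e 3 1 3 refl) (D-e 3 6 18 refl))) (D-e 3 6 18 refl))))))

φ-dissection : e 1 * e 1 ≈ e 2 * (D 3 φ₃ - ι (+ 2) * (q^ 1 * D 3 Ω₁))
φ-dissection = untrunc λ n → go n
  where
  go : ∀ n → e 1 * e 1 ≈[ n ] e 2 * (D 3 φ₃ - ι (+ 2) * (q^ 1 * D 3 Ω₁))
  go n = begin
    e 1 * e 1
      ≈⟨ weaken (ℕₚ.m≤n⇒m≤1+n (ℕₚ.m≤m*n n 3)) (φ-product (suc (n ℕ.* 3))) ⟨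
    e 2 * φ.θ (suc (n ℕ.* 3))
      ≈⟨ trunc (*-congˡ (φ-split n)) ⟩
    e 2 * (D 9 (φ.θ n) - ι (+ 2) * (q^ 1 * D 3 (Ω.θ n)))
      ≈⟨ trunc-*ˡ (e 2) (trunc-- D9 (trunc-*ˡ (ι (+ 2)) (trunc-*ˡ (q^ 1) D3))) ⟩
    e 2 * (D 3 φ₃ - ι (+ 2) * (q^ 1 * D 3 Ω₁)) ∎
    where
    open ≈[]-R {n}
    D9 : D 9 (φ.θ n) ≈[ n ] D 3 φ₃
    D9 = trunc-trans (unit-solve (e-inverse 18) (begin
      e 18 * D 9 (φ.θ n)       ≈⟨ trunc (*-congʳ (D-e 9 2 18 refl)) ⟨
      D 9 (e 2) * D 9 (φ.θ n)  ≈⟨ trunc (D-* 9 (e 2) (φ.θ n)) ⟨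
      D 9 (e 2 * φ.θ n)        ≈⟨ D-trunc 9 (φ-product n) ⟩
      D 9 (e 1 * e 1)          ≈⟨ trunc (≈-trans (D-* 9 (e 1) (e 1)) (*-cong (D-e 9 1 9 refl) (D-e 9 1 9 refl))) ⟩
      e 9 * e 9                ∎)) (trunc (≈-sym D-3-φ₃))
    D3 : D 3 (Ω.θ n) ≈[ n ] D 3 Ω₁
    D3 = D-trunc 3 (unit-solve (e-inverse 2) (unit-solve (e-inverse 3) (begin
      e 3 * (e 2 * Ω.θ n)      ≈⟨ trunc (solve 3 (λ a b t → a :* (b :* t) := b :* a :* t) ≈-refl (e 3) (e 2) (Ω.θ n)) ⟩
      e 2 * e 3 * Ω.θ n        ≈⟨ Ω-product n ⟩
      e 1 * e 6 * e 6          ∎)))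

ι2-cancel : ∀ {N f g} → ι (+ 2) * f ≈[ N ] ι (+ 2) * g → f ≈[ N ] g
ι2-cancel {f = f} {g} p = below λ n n<N → ℤₚ.*-cancelˡ-≡ (+ 2) (f n) (g n)
  (trans (sym (at (ι-* (+ 2) f) n)) (trans (at< p n n<N) (at (ι-* (+ 2) g) n)))

-- Twice this identity is what the triple product gives, since `ψ.θ` tends to 2ψ(q); the 2 is then
-- cancelled coefficientwise.
ψ-dissection : e 2 * e 2 ≈
  e 1 * (e⁻¹ 18 * (e⁻¹ 3 * (e 6 * e 9 * e 9)) + q^ 1 * (e⁻¹ 9 * (e 18 * e 18)))
ψ-dissection = untrunc λ n → ι2-cancel (go n)
  where
  b : Series
  b = e⁻¹ 18 * (e⁻¹ 3 * (e 6 * e 9 * e 9))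
  go : ∀ n → ι (+ 2) * (e 2 * e 2) ≈[ n ] ι (+ 2) * (e 1 * (b + q^ 1 * (e⁻¹ 9 * (e 18 * e 18))))
  go n = begin
    ι (+ 2) * (e 2 * e 2)
      ≈⟨ weaken (ℕₚ.m≤n⇒m≤1+n (ℕₚ.m≤m*n n 3)) (ψ-product (suc (n ℕ.* 3))) ⟨
    e 1 * ψ.θ (suc (n ℕ.* 3))
      ≈⟨ trunc (*-congˡ (ψ-split n)) ⟩
    e 1 * (ι (+ 2) * D 3 (Λ.θ n) + q^ 1 * D 9 (ψ.θ n))
      ≈⟨ trunc-*ˡ (e 1) (trunc-+ (trunc-*ˡ (ι (+ 2)) D3) (trunc-*ˡ (q^ 1) D9)) ⟩
    e 1 * (ι (+ 2) * b + q^ 1 * (e⁻¹ 9 * (ι (+ 2) * (e 18 * e 18))))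
      ≈⟨ trunc (solve 5 (λ e b q i f → e :* (con (+ 2) :* b :+ q :* (i :* (con (+ 2) :* f))) :=
           con (+ 2) :* (e :* (b :+ q :* (i :* f)))) ≈-refl (e 1) b (q^ 1) (e⁻¹ 9) (e 18 * e 18)) ⟩
    ι (+ 2) * (e 1 * (b + q^ 1 * (e⁻¹ 9 * (e 18 * e 18)))) ∎
    where
    open ≈[]-R {n}
    D9 : D 9 (ψ.θ n) ≈[ n ] e⁻¹ 9 * (ι (+ 2) * (e 18 * e 18))
    D9 = unit-solve (e-inverse 9) (begin
      e 9 * D 9 (ψ.θ n)            ≈⟨ trunc (*-congʳ (D-e 9 1 9 refl)) ⟨
      D 9 (e 1) * D 9 (ψ.θ n)      ≈⟨ trunc (D-* 9 (e 1) (ψ.θ n)) ⟨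
      D 9 (e 1 * ψ.θ n)            ≈⟨ D-trunc 9 (ψ-product n) ⟩
      D 9 (ι (+ 2) * (e 2 * e 2))  ≈⟨ trunc (≈-trans (D-scale 9 (+ 2) (e 2 * e 2)) (*-congˡ (≈-trans (D-* 9 (e 2) (e 2))
                                        (*-cong (D-e 9 2 18 refl) (D-e 9 2 18 refl))))) ⟩
      ι (+ 2) * (e 18 * e 18)      ∎)
    D3 : D 3 (Λ.θ n) ≈[ n ] b
    D3 = unit-solve (e-inverse 18) (unit-solve (e-inverse 3) (begin
      e 3 * (e 18 * D 3 (Λ.θ n))
        ≈⟨ trunc (solve 3 (λ a b t → a :* (b :* t) := a :* b :* t) ≈-refl (e 3) (e 18) (D 3 (Λ.θ n))) ⟩
      e 3 * e 18 * D 3 (Λ.θ n)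
        ≈⟨ trunc (≈-trans (D-* 3 (e 1 * e 6) (Λ.θ n)) (*-congʳ (≈-trans (D-* 3 (e 1) (e 6)) (*-cong (D-e 3 1 3 refl) (D-e 3 6 18 refl))))) ⟨
      D 3 (e 1 * e 6 * Λ.θ n)
        ≈⟨ D-trunc 3 (Λ-product n) ⟩
      D 3 (e 2 * e 3 * e 3)
        ≈⟨ trunc (≈-trans (D-* 3 (e 2 * e 3) (e 3)) (*-cong (≈-trans (D-* 3 (e 2) (e 3)) (*-cong (D-e 3 2 6 refl) (D-e 3 3 9 refl))) (D-e 3 3 9 refl))) ⟩
      e 6 * e 9 * e 9 ∎))

-- Trisection of a series by the residue of the exponent modulo 3

opaque
  third : ℕ → Series → Series
  third r f n = f (r ℕ.+ n ℕ.* 3)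

  third-at : ∀ r f n → third r f n ≡ f (r ℕ.+ n ℕ.* 3)
  third-at r f n = refl

weave : Series → Series → Series → Series
weave a b c = D 3 a + q^ 1 * (D 3 b + q^ 1 * D 3 c)

module _ (a b c : Series) where
  private
    unroll-suc : ∀ n → weave a b c (suc n) ≡ D 3 a (suc n) ℤ.+ (D 3 b n ℤ.+ (q^ 1 * D 3 c) n)
    unroll-suc n = trans (+-at (D 3 a) _ (suc n)) (cong (ℤ._+_ (D 3 a (suc n)))
      (trans (mono-*-shift 1 _ n) (+-at (D 3 b) _ n)))

  weave-0 : weave a b c 0 ≡ a 0
  weave-0 = trans (+-at (D 3 a) _ 0) (trans (cong₂ ℤ._+_ (D-zero 3 a) (mono-suc-*-zero 0 _)) (ℤₚ.+-identityʳ _))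

  weave-1 : weave a b c 1 ≡ b 0
  weave-1 = trans (unroll-suc 0) (trans (cong₂ ℤ._+_ (D-small 3 a 1 (s≤s (s≤s z≤n)) λ ())
    (cong₂ ℤ._+_ (D-zero 3 b) (mono-suc-*-zero 0 _))) (alg (b 0)))
    where
    alg : ∀ x → + 0 ℤ.+ (x ℤ.+ + 0) ≡ x
    alg = ℤ-Solver.solve-∀

  weave-2 : weave a b c 2 ≡ c 0
  weave-2 = trans (unroll-suc 1) (trans (cong₂ ℤ._+_ (D-small 3 a 2 (s≤s (s≤s (s≤s z≤n))) λ ())
    (cong₂ ℤ._+_ (D-small 3 b 1 (s≤s (s≤s z≤n)) λ ()) (trans (mono-*-shift 1 (D 3 c) 0) (D-zero 3 c)))) (alg (c 0)))
    where
    alg : ∀ x → + 0 ℤ.+ (+ 0 ℤ.+ x) ≡ x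
    alg = ℤ-Solver.solve-∀

shift-tail : ∀ b n → D 3 b (2 ℕ.+ n) ≡ (q^ 1 * D 3 (tail b)) n
shift-tail b zero    = trans (D-small 3 b 2 (s≤s (s≤s (s≤s z≤n))) λ ()) (sym (mono-suc-*-zero 0 _))
shift-tail b (suc n) = trans (D-shift 3 b n) (sym (mono-*-shift 1 _ n))

shift-tail₂ : ∀ c n → (q^ 1 * D 3 c) (2 ℕ.+ n) ≡ (q^ 1 * (q^ 1 * D 3 (tail c))) n
shift-tail₂ c zero    = trans (mono-*-shift 1 (D 3 c) 1)
  (trans (D-small 3 c 1 (s≤s (s≤s z≤n)) λ ()) (sym (mono-suc-*-zero 0 _)))
shift-tail₂ c (suc n) = trans (mono-*-shift 1 (D 3 c) (2 ℕ.+ n)) (trans (shift-tail c n) (sym (mono-*-shift 1 _ n)))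

weave-3+ : ∀ a b c n → weave a b c (3 ℕ.+ n) ≡ weave (tail a) (tail b) (tail c) n
weave-3+ a b c n = begin
  weave a b c (3 ℕ.+ n)
    ≡⟨ trans (+-at (D 3 a) _ (3 ℕ.+ n)) (cong (ℤ._+_ (D 3 a (3 ℕ.+ n)))
         (trans (mono-*-shift 1 _ (2 ℕ.+ n)) (+-at (D 3 b) _ (2 ℕ.+ n)))) ⟩
  D 3 a (3 ℕ.+ n) ℤ.+ (D 3 b (2 ℕ.+ n) ℤ.+ (q^ 1 * D 3 c) (2 ℕ.+ n))
    ≡⟨ cong₂ ℤ._+_ (D-shift 3 a n) (cong₂ ℤ._+_ (shift-tail b n) (shift-tail₂ c n)) ⟩
  D 3 (tail a) n ℤ.+ ((q^ 1 * D 3 (tail b)) n ℤ.+ (q^ 1 * (q^ 1 * D 3 (tail c))) n)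
    ≡⟨ trans (+-at (D 3 (tail a)) _ n) (cong (ℤ._+_ (D 3 (tail a) n)) (trans (at (distrib _ _ _) n) (+-at _ _ n))) ⟨
  weave (tail a) (tail b) (tail c) n ∎
  where
  open ≡-Reasoning
  distrib : ∀ x y z → x * (y + z) ≈ x * y + x * z
  distrib = solve 3 (λ x y z → x :* (y :+ z) := x :* y :+ x :* z) ≈-refl

weave-at-0 : ∀ a b c n → weave a b c (n ℕ.* 3) ≡ a n
weave-at-0 a b c zero    = weave-0 a b c
weave-at-0 a b c (suc n) = trans (weave-3+ a b c (n ℕ.* 3)) (weave-at-0 (tail a) (tail b) (tail c) n)

weave-at-1 : ∀ a b c n → weave a b c (1 ℕ.+ n ℕ.* 3) ≡ b n
weave-at-1 a b c zero    = weave-1 a b c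
weave-at-1 a b c (suc n) = trans (weave-3+ a b c (1 ℕ.+ n ℕ.* 3)) (weave-at-1 (tail a) (tail b) (tail c) n)

weave-at-2 : ∀ a b c n → weave a b c (2 ℕ.+ n ℕ.* 3) ≡ c n
weave-at-2 a b c zero    = weave-2 a b c
weave-at-2 a b c (suc n) = trans (weave-3+ a b c (2 ℕ.+ n ℕ.* 3)) (weave-at-2 (tail a) (tail b) (tail c) n)

opaque
  unfolding third

  weave-third : ∀ f → f ≈ weave (third 0 f) (third 1 f) (third 2 f)
  weave-third f = pointwise (go f)
    where
    go : ∀ f n → f n ≡ weave (third 0 f) (third 1 f) (third 2 f) n
    go f 0 = sym (weave-0 (third 0 f) (third 1 f) (third 2 f))
    go f 1 = sym (weave-1 (third 0 f) (third 1 f) (third 2 f))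
    go f 2 = sym (weave-2 (third 0 f) (third 1 f) (third 2 f))
    go f (suc (suc (suc n))) = trans (go (tail (tail (tail f))) n)
      (sym (weave-3+ (third 0 f) (third 1 f) (third 2 f) n))

-- The norm of a series over the cube roots of unity

norm₃ : Series → Series → Series → Series
norm₃ a b c = a * a * a + q^ 1 * (b * b * b) + q^ 1 * q^ 1 * (c * c * c) - ι (+ 3) * (q^ 1 * (a * b * c))

-- norm f is the product of f(ζ q^{1/3}) over the cube roots of unity ζ.
norm : Series → Series
norm f = norm₃ (third 0 f) (third 1 f) (third 2 f)

norm₃-trunc : ∀ {N a a′ b b′ c c′} → a ≈[ N ] a′ → b ≈[ N ] b′ → c ≈[ N ] c′ →
  norm₃ a b c ≈[ N ] norm₃ a′ b′ c′
norm₃-trunc p r s = trunc-- (trunc-+ (trunc-+ (trunc-* (trunc-* p p) p) (trunc-*ˡ _ (trunc-* (trunc-* r r) r)))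
  (trunc-*ˡ _ (trunc-* (trunc-* s s) s))) (trunc-*ˡ _ (trunc-*ˡ _ (trunc-* (trunc-* p r) s)))

norm₃-cong : ∀ {a a′ b b′ c c′} → a ≈ a′ → b ≈ b′ → c ≈ c′ → norm₃ a b c ≈ norm₃ a′ b′ c′
norm₃-cong p r s = untrunc λ N → norm₃-trunc (trunc p) (trunc r) (trunc s)

-- The components of a trisection are unique, so the norm may be computed from any expression of `f`
-- as a `weave`.
norm-weave : ∀ {f} a b c → f ≈ weave a b c → norm f ≈ norm₃ a b c
norm-weave {f} a b c p = norm₃-cong
  (pointwise λ n → trans (third-at 0 f n) (trans (at p (n ℕ.* 3)) (weave-at-0 a b c n)))
  (pointwise λ n → trans (third-at 1 f n) (trans (at p (1 ℕ.+ n ℕ.* 3)) (weave-at-1 a b c n)))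
  (pointwise λ n → trans (third-at 2 f n) (trans (at p (2 ℕ.+ n ℕ.* 3)) (weave-at-2 a b c n)))

norm-cong : ∀ {f g} → f ≈ g → norm f ≈ norm g
norm-cong {f} {g} p = norm-weave _ _ _ (≈-trans p (weave-third g))

norm-trunc : ∀ {N f g} → f ≈[ N ℕ.* 3 ] g → norm f ≈[ N ] norm g
norm-trunc {N} {f} {g} p = norm₃-trunc (part 0 (s≤s z≤n)) (part 1 (s≤s (s≤s z≤n))) (part 2 (s≤s (s≤s (s≤s z≤n))))
  where
  part : ∀ r → r < 3 → third r f ≈[ N ] third r g
  part r r<3 = below λ n n<N → trans (third-at r f n)
    (trans (at< p (r ℕ.+ n ℕ.* 3) (ℕₚ.<-≤-trans (ℕₚ.+-monoˡ-< (n ℕ.* 3) r<3) (ℕₚ.*-monoˡ-≤ 3 n<N)))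
      (sym (third-at r g n)))

weave-* : ∀ a b c a′ b′ c′ → weave a b c * weave a′ b′ c′ ≈
  weave (a * a′ + q^ 1 * (b * c′ + c * b′)) (a * b′ + b * a′ + q^ 1 * (c * c′)) (a * c′ + b * b′ + c * a′)
weave-* a b c a′ b′ c′ = begin
  weave a b c * weave a′ b′ c′
    ≈⟨ solve 7 (λ q a b c a′ b′ c′ → (a :+ q :* (b :+ q :* c)) :* (a′ :+ q :* (b′ :+ q :* c′)) :=
         (a :* a′ :+ q :* q :* q :* (b :* c′ :+ c :* b′)) :+ q :* ((a :* b′ :+ b :* a′ :+ q :* q :* q :* (c :* c′))
           :+ q :* (a :* c′ :+ b :* b′ :+ c :* a′))) ≈-refl
         (q^ 1) (D 3 a) (D 3 b) (D 3 c) (D 3 a′) (D 3 b′) (D 3 c′) ⟩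
  (D 3 a * D 3 a′ + q^ 1 * q^ 1 * q^ 1 * (D 3 b * D 3 c′ + D 3 c * D 3 b′))
    + q^ 1 * ((D 3 a * D 3 b′ + D 3 b * D 3 a′ + q^ 1 * q^ 1 * q^ 1 * (D 3 c * D 3 c′))
    + q^ 1 * (D 3 a * D 3 c′ + D 3 b * D 3 b′ + D 3 c * D 3 a′))
    ≈⟨ +-cong (⊕ (⊗ a a′) (⊛ (⊕ (⊗ b c′) (⊗ c b′))))
         (*-congˡ (+-cong (⊕ (⊕ (⊗ a b′) (⊗ b a′)) (⊛ (⊗ c c′)))
           (*-congˡ (⊕ (⊕ (⊗ a c′) (⊗ b b′)) (⊗ c a′))))) ⟨
  weave (a * a′ + q^ 1 * (b * c′ + c * b′)) (a * b′ + b * a′ + q^ 1 * (c * c′)) (a * c′ + b * b′ + c * a′) ∎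
  where
  open ≈-R
  ⊗ : ∀ f g → D 3 (f * g) ≈ D 3 f * D 3 g
  ⊗ = D-* 3
  ⊕ : ∀ {f g f′ g′} → D 3 f ≈ f′ → D 3 g ≈ g′ → D 3 (f + g) ≈ f′ + g′
  ⊕ {f} {g} p r = ≈-trans (D-+ 3 f g) (+-cong p r)
  ⊛ : ∀ {f f′} → D 3 f ≈ f′ → D 3 (q^ 1 * f) ≈ q^ 1 * q^ 1 * q^ 1 * f′
  ⊛ {f} p = ≈-trans (D-mono1-* 3 f)
    (*-cong (≈-sym (≈-trans (*-congʳ (mono-+ 1 1)) (mono-+ 2 1))) p)

-- The form `norm₃ a b c` is the determinant of multiplication by a + q^(1/3) b + q^(2/3) c. Its
-- multiplicativity is a polynomial identity in the six components and `q^ 1`, so no roots of unity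
-- have to be adjoined.
norm-* : ∀ f g → norm (f * g) ≈ norm f * norm g
norm-* f g = ≈-trans
  (norm-weave _ _ _ (≈-trans (*-cong (weave-third f) (weave-third g))
    (weave-* (third 0 f) (third 1 f) (third 2 f) (third 0 g) (third 1 g) (third 2 g))))
  (solve 7 (λ q a b c a′ b′ c′ →
    let n : S.Polynomial 7 → S.Polynomial 7 → S.Polynomial 7 → S.Polynomial 7
        n a b c = a :* a :* a :+ q :* (b :* b :* b) :+ q :* q :* (c :* c :* c) :- con (+ 3) :* (q :* (a :* b :* c))
    in n (a :* a′ :+ q :* (b :* c′ :+ c :* b′)) (a :* b′ :+ b :* a′ :+ q :* (c :* c′)) (a :* c′ :+ b :* b′ :+ c :* a′)
         := n a b c :* n a′ b′ c′) ≈-refl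
    (q^ 1) (third 0 f) (third 1 f) (third 2 f) (third 0 g) (third 1 g) (third 2 g))

-- Doubling exponents exchanges the residues 1 and 2 modulo 3, with a carry: 2 · 2 = 1 + 3. Hence
-- the components become `D 2 a`, `q^ 1 * D 2 c` and `D 2 b`.
norm-D2 : ∀ f → norm (D 2 f) ≈ D 2 (norm f)
norm-D2 f = begin
  norm (D 2 f)
    ≈⟨ norm-weave (D 2 a) (q^ 1 * D 2 c) (D 2 b) (≈-trans (D-cong 2 (weave-third f)) D2-weave) ⟩
  norm₃ (D 2 a) (q^ 1 * D 2 c) (D 2 b)
    ≈⟨ solve 4 (λ q a b c → a :* a :* a :+ q :* (q :* c :* (q :* c) :* (q :* c)) :+ q :* q :* (b :* b :* b)
           :- con (+ 3) :* (q :* (a :* (q :* c) :* b)) :=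
         a :* a :* a :+ q :* q :* (b :* b :* b) :+ q :* q :* (q :* q) :* (c :* c :* c)
           :- con (+ 3) :* (q :* q :* (a :* b :* c))) ≈-refl (q^ 1) (D 2 a) (D 2 b) (D 2 c) ⟩
  D 2 a * D 2 a * D 2 a + q^ 1 * q^ 1 * (D 2 b * D 2 b * D 2 b)
    + q^ 1 * q^ 1 * (q^ 1 * q^ 1) * (D 2 c * D 2 c * D 2 c)
    - ι (+ 3) * (q^ 1 * q^ 1 * (D 2 a * D 2 b * D 2 c))
    ≈⟨ ≈-trans (D-- 2 _ _) (+-cong
         (≈-trans (D-+ 2 _ _) (+-cong (≈-trans (D-+ 2 _ _) (+-cong (triple a a a) (times Q (triple b b b))))
           (times (≈-trans (D-* 2 _ _) (*-cong Q Q)) (triple c c c))))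
         (neg-cong (≈-trans (D-scale 2 (+ 3) _) (*-congˡ (times Q (triple a b c)))))) ⟨
  D 2 (norm f) ∎
  where
  open ≈-R
  a b c : Series
  a = third 0 f
  b = third 1 f
  c = third 2 f
  Q : D 2 (q^ 1) ≈ q^ 1 * q^ 1
  Q = ≈-trans (D-mono 2 1) (≈-sym (mono-+ 1 1))
  triple : ∀ x y z → D 2 (x * y * z) ≈ D 2 x * D 2 y * D 2 z
  triple x y z = ≈-trans (D-* 2 (x * y) z) (*-congʳ (D-* 2 x y))
  times : ∀ {x x′ y y′} → D 2 x ≈ x′ → D 2 y ≈ y′ → D 2 (x * y) ≈ x′ * y′
  times {x} {y = y} p r = ≈-trans (D-* 2 x y) (*-cong p r)
  swap : ∀ g → D 2 (D 3 g) ≈ D 3 (D 2 g)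
  swap g = ≈-trans (D-∘ 2 3 6 refl g) (≈-sym (D-∘ 3 2 6 refl g))
  D2-weave : D 2 (weave a b c) ≈ weave (D 2 a) (q^ 1 * D 2 c) (D 2 b)
  D2-weave = begin
    D 2 (weave a b c)
      ≈⟨ ≈-trans (D-+ 2 _ _) (+-cong (swap a) (times Q (≈-trans (D-+ 2 _ _) (+-cong (swap b) (times Q (swap c)))))) ⟩
    D 3 (D 2 a) + q^ 1 * q^ 1 * (D 3 (D 2 b) + q^ 1 * q^ 1 * D 3 (D 2 c))
      ≈⟨ solve 4 (λ q a b c → a :+ q :* q :* (b :+ q :* q :* c) := a :+ q :* (q :* q :* q :* c :+ q :* b)) ≈-refl
           (q^ 1) (D 3 (D 2 a)) (D 3 (D 2 b)) (D 3 (D 2 c)) ⟩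
    D 3 (D 2 a) + q^ 1 * (q^ 1 * q^ 1 * q^ 1 * D 3 (D 2 c) + q^ 1 * D 3 (D 2 b))
      ≈⟨ +-congˡ (*-congˡ (+-congʳ (*-congʳ (≈-trans (*-congʳ (mono-+ 1 1)) (mono-+ 2 1))))) ⟩
    D 3 (D 2 a) + q^ 1 * (q^ 3 * D 3 (D 2 c) + q^ 1 * D 3 (D 2 b))
      ≈⟨ +-congˡ (*-congˡ (+-congʳ (D-mono1-* 3 (D 2 c)))) ⟨
    weave (D 2 a) (q^ 1 * D 2 c) (D 2 b) ∎

private
  cube-q : ∀ n → q^ n * q^ n * q^ n ≈ q^ (n ℕ.* 3)
  cube-q n = ≈-trans (*-congʳ (mono-+ n n)) (≈-trans (mono-+ (n ℕ.+ n) n) (q-cong (alg n)))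
    where
    alg : ∀ n → n ℕ.+ n ℕ.+ n ≡ n ℕ.* 3
    alg = ℕ-Solver.solve-∀

-- The product of 1 - ζ^k q^(k/3) over the three ζ is a cube when 3 divides k, since all factors
-- coincide, and 1 - q^k otherwise.
norm-3k : ∀ n → norm (oneS - q^ (n ℕ.* 3)) ≈ (oneS - q^ n) * (oneS - q^ n) * (oneS - q^ n)
norm-3k n = ≈-trans (norm-weave (oneS - q^ n) (ι (+ 0)) (ι (+ 0)) (begin
  oneS - q^ (n ℕ.* 3)
    ≈⟨ +-cong (D-one 3) (neg-cong (D-mono 3 n)) ⟨
  D 3 oneS - D 3 (q^ n)
    ≈⟨ D-- 3 oneS (q^ n) ⟨
  D 3 (oneS - q^ n)
    ≈⟨ solve 2 (λ d q → d := d :+ q :* (con (+ 0) :+ q :* con (+ 0))) ≈-refl (D 3 (oneS - q^ n)) (q^ 1) ⟩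
  D 3 (oneS - q^ n) + q^ 1 * (ι (+ 0) + q^ 1 * ι (+ 0))
    ≈⟨ +-congˡ (*-congˡ (+-cong (D-ι 3 (+ 0)) (*-congˡ (D-ι 3 (+ 0))))) ⟨
  weave (oneS - q^ n) (ι (+ 0)) (ι (+ 0)) ∎))
  (solve 2 (λ x q → x :* x :* x :+ q :* (con (+ 0) :* con (+ 0) :* con (+ 0)) :+ q :* q :* (con (+ 0) :* con (+ 0) :* con (+ 0))
    :- con (+ 3) :* (q :* (x :* con (+ 0) :* con (+ 0))) := x :* x :* x) ≈-refl (oneS - q^ n) (q^ 1))
  where open ≈-R

norm-3k+1 : ∀ n → norm (oneS - q^ (1 ℕ.+ n ℕ.* 3)) ≈ oneS - q^ (1 ℕ.+ n ℕ.* 3)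
norm-3k+1 n = begin
  norm (oneS - q^ (1 ℕ.+ n ℕ.* 3))
    ≈⟨ norm-weave oneS (neg (q^ n)) (ι (+ 0)) (begin
      oneS - q^ (1 ℕ.+ n ℕ.* 3)
        ≈⟨ +-congˡ (neg-cong (mono-+ 1 (n ℕ.* 3))) ⟨
      oneS - q^ 1 * q^ (n ℕ.* 3)
        ≈⟨ solve 2 (λ q x → :1 :- q :* x := :1 :+ q :* (:- x :+ q :* con (+ 0))) ≈-refl (q^ 1) (q^ (n ℕ.* 3)) ⟩
      oneS + q^ 1 * (neg (q^ (n ℕ.* 3)) + q^ 1 * ι (+ 0))
        ≈⟨ +-cong (D-one 3) (*-congˡ (+-cong (≈-trans (D-neg 3 (q^ n)) (neg-cong (D-mono 3 n))) (*-congˡ (D-ι 3 (+ 0))))) ⟨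
      weave oneS (neg (q^ n)) (ι (+ 0)) ∎) ⟩
  norm₃ oneS (neg (q^ n)) (ι (+ 0))
    ≈⟨ solve 2 (λ x q → :1 :* :1 :* :1 :+ q :* (:- x :* :- x :* :- x) :+ q :* q :* (con (+ 0) :* con (+ 0) :* con (+ 0))
         :- con (+ 3) :* (q :* (:1 :* :- x :* con (+ 0))) := :1 :- q :* (x :* x :* x)) ≈-refl (q^ n) (q^ 1) ⟩
  oneS - q^ 1 * (q^ n * q^ n * q^ n)
    ≈⟨ +-congˡ (neg-cong (≈-trans (*-congˡ (cube-q n)) (mono-+ 1 (n ℕ.* 3)))) ⟩
  oneS - q^ (1 ℕ.+ n ℕ.* 3) ∎
  where open ≈-R

norm-3k+2 : ∀ n → norm (oneS - q^ (2 ℕ.+ n ℕ.* 3)) ≈ oneS - q^ (2 ℕ.+ n ℕ.* 3)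
norm-3k+2 n = begin
  norm (oneS - q^ (2 ℕ.+ n ℕ.* 3))
    ≈⟨ norm-weave oneS (ι (+ 0)) (neg (q^ n)) (begin
      oneS - q^ (2 ℕ.+ n ℕ.* 3)
        ≈⟨ +-congˡ (neg-cong (≈-trans (*-congʳ (mono-+ 1 1)) (mono-+ 2 (n ℕ.* 3)))) ⟨
      oneS - q^ 1 * q^ 1 * q^ (n ℕ.* 3)
        ≈⟨ solve 2 (λ q x → :1 :- q :* q :* x := :1 :+ q :* (con (+ 0) :+ q :* :- x)) ≈-refl (q^ 1) (q^ (n ℕ.* 3)) ⟩
      oneS + q^ 1 * (ι (+ 0) + q^ 1 * neg (q^ (n ℕ.* 3)))
        ≈⟨ +-cong (D-one 3) (*-congˡ (+-cong (D-ι 3 (+ 0)) (*-congˡ (≈-trans (D-neg 3 (q^ n)) (neg-cong (D-mono 3 n)))))) ⟨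
      weave oneS (ι (+ 0)) (neg (q^ n)) ∎) ⟩
  norm₃ oneS (ι (+ 0)) (neg (q^ n))
    ≈⟨ solve 2 (λ x q → :1 :* :1 :* :1 :+ q :* (con (+ 0) :* con (+ 0) :* con (+ 0)) :+ q :* q :* (:- x :* :- x :* :- x)
         :- con (+ 3) :* (q :* (:1 :* con (+ 0) :* :- x)) := :1 :- q :* q :* (x :* x :* x)) ≈-refl (q^ n) (q^ 1) ⟩
  oneS - q^ 1 * q^ 1 * (q^ n * q^ n * q^ n)
    ≈⟨ +-congˡ (neg-cong (≈-trans (*-cong (mono-+ 1 1) (cube-q n)) (mono-+ 2 (n ℕ.* 3)))) ⟩
  oneS - q^ (2 ℕ.+ n ℕ.* 3) ∎
  where open ≈-R

-- Factors with exponent prime to 3 survive in the norm, and `D 3 (poch n)` supplies the missing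
-- multiples of 3. The multiples themselves contribute the cube of `poch n`. In the limit the norm
-- of E(q) is E(q)⁴/E(q³).
norm-poch : ∀ n → norm (poch (n ℕ.* 3)) * D 3 (poch n) ≈ poch (n ℕ.* 3) * (poch n * poch n * poch n)
norm-poch zero = begin
  norm (poch 0) * D 3 (poch 0)
    ≈⟨ *-cong (≈-trans (norm-cong (≡⇒≈ poch-zero)) norm-one) (D-poch-zero 3) ⟩
  oneS * oneS
    ≈⟨ solve 0 (:1 :* :1 := :1 :* (:1 :* :1 :* :1)) ≈-refl ⟩
  oneS * (oneS * oneS * oneS)
    ≡⟨ cong (λ p → p * (p * p * p)) poch-zero ⟨
  poch 0 * (poch 0 * poch 0 * poch 0) ∎
  where
  open ≈-R
  norm-one : norm oneS ≈ oneS
  norm-one = ≈-trans (norm-weave oneS (ι (+ 0)) (ι (+ 0)) (≈-sym (≈-trans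
      (+-cong (D-one 3) (*-congˡ (+-cong (D-ι 3 (+ 0)) (*-congˡ (D-ι 3 (+ 0))))))
      (solve 1 (λ q → :1 :+ q :* (con (+ 0) :+ q :* con (+ 0)) := :1) ≈-refl (q^ 1)))))
    (solve 1 (λ q → :1 :* :1 :* :1 :+ q :* (con (+ 0) :* con (+ 0) :* con (+ 0)) :+ q :* q :* (con (+ 0) :* con (+ 0) :* con (+ 0))
      :- con (+ 3) :* (q :* (:1 :* con (+ 0) :* con (+ 0))) := :1) ≈-refl (q^ 1))
norm-poch (suc n) = begin
  norm (poch (3 ℕ.+ n ℕ.* 3)) * D 3 (poch (suc n))
    ≈⟨ *-cong (≈-trans (norm-cong poch3) (≈-trans (norm-* _ _) (*-cong (≈-trans (norm-* _ _) (*-cong (≈-trans (norm-* _ _)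
         (*-congˡ (norm-3k+1 n))) (norm-3k+2 n))) (norm-3k (suc n))))) (D-poch-suc 3 n) ⟩
  norm (poch (n ℕ.* 3)) * x 1 * x 2 * (y * y * y) * (D 3 (poch n) * x 3)
    ≈⟨ solve 6 (λ a b x₁ x₂ x₃ y → a :* x₁ :* x₂ :* (y :* y :* y) :* (b :* x₃) := a :* b :* (x₁ :* x₂ :* x₃ :* (y :* y :* y))) ≈-refl
         (norm (poch (n ℕ.* 3))) (D 3 (poch n)) (x 1) (x 2) (x 3) y ⟩
  norm (poch (n ℕ.* 3)) * D 3 (poch n) * (x 1 * x 2 * x 3 * (y * y * y))
    ≈⟨ *-congʳ (norm-poch n) ⟩
  poch (n ℕ.* 3) * (poch n * poch n * poch n) * (x 1 * x 2 * x 3 * (y * y * y))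
    ≈⟨ solve 6 (λ a b x₁ x₂ x₃ y → a :* (b :* b :* b) :* (x₁ :* x₂ :* x₃ :* (y :* y :* y)) :=
         a :* x₁ :* x₂ :* x₃ :* (b :* y :* (b :* y) :* (b :* y))) ≈-refl
         (poch (n ℕ.* 3)) (poch n) (x 1) (x 2) (x 3) y ⟩
  poch (n ℕ.* 3) * x 1 * x 2 * x 3 * (poch n * y * (poch n * y) * (poch n * y))
    ≈⟨ *-cong poch3 (≡⇒≈ (cong (λ p → p * p * p) (poch-suc n))) ⟨
  poch (3 ℕ.+ n ℕ.* 3) * (poch (suc n) * poch (suc n) * poch (suc n)) ∎
  where
  open ≈-R
  x : ℕ → Series
  x i = oneS - q^ (i ℕ.+ n ℕ.* 3)
  y : Series
  y = oneS - q^ suc n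
  poch3 : poch (3 ℕ.+ n ℕ.* 3) ≈ poch (n ℕ.* 3) * x 1 * x 2 * x 3
  poch3 = ≈-trans (≡⇒≈ (poch-suc (2 ℕ.+ n ℕ.* 3))) (*-congʳ (≈-trans (≡⇒≈ (poch-suc (1 ℕ.+ n ℕ.* 3)))
    (*-congʳ (≡⇒≈ (poch-suc (n ℕ.* 3))))))

norm-E : norm E * e 3 ≈ E * (E * E * E)
norm-E = untrunc go
  where
  go : ∀ n → norm E * e 3 ≈[ n ] E * (E * E * E)
  go n = begin
    norm E * e 3
      ≈⟨ trunc-* (norm-trunc (E-trunc (n ℕ.* 3) (ℕₚ.n≤1+n _))) (e-trunc 3 n (ℕₚ.n≤1+n n)) ⟩
    norm (poch (n ℕ.* 3)) * D 3 (poch n)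
      ≈⟨ trunc (norm-poch n) ⟩
    poch (n ℕ.* 3) * (poch n * poch n * poch n)
      ≈⟨ trunc-* (E-trunc (n ℕ.* 3) (ℕₚ.m≤n⇒m≤1+n (ℕₚ.m≤m*n n 3))) (trunc-* (trunc-* E≈ E≈) E≈) ⟨
    E * (E * E * E) ∎
    where
    open ≈[]-R {n}
    E≈ : E ≈[ n ] poch n
    E≈ = E-trunc n (ℕₚ.n≤1+n n)

-- Eta quotients

-- The ring solver treats `e m` and `e⁻¹ m` as unrelated variables. Identities of eta quotients are
-- therefore solved with explicit powers of the products `e m * e⁻¹ m`, which are removed
-- afterwards.
cancel-e : ∀ m .{{_ : NonZero m}} k f → f * (e m * e⁻¹ m) ^ k ≈ f
cancel-e m k f = ≈-trans (*-congˡ (≈-trans (^-congˡ k (e-inverse m)) (one-^ k))) (*-identityʳ f)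

-- Here `x` is the eta quotient X, and `w` is the ratio Ω₁/φ₃ of the components of φ(-q), so that
-- `W` below is q w(q³).
x w w⁻¹ v : Series
x   = e 2 ^ 4 * e 3 ^ 8 * (e⁻¹ 1 ^ 8 * e⁻¹ 6 ^ 4)
w   = e 1 * e 6 ^ 3 * (e⁻¹ 2 * e⁻¹ 3 ^ 3)
w⁻¹ = e 2 * e 3 ^ 3 * (e⁻¹ 1 * e⁻¹ 6 ^ 3)
v   = q^ 1 * w ^ 3

norm-e1 : norm (e 1) * e 3 ≈ e 1 ^ 4
norm-e1 = begin
  norm (e 1) * e 3     ≈⟨ *-congʳ (norm-cong (D-1 E)) ⟩
  norm E * e 3         ≈⟨ norm-E ⟩
  E * (E * E * E)      ≈⟨ solve 1 (λ e → e :* (e :* e :* e) := e :^ 4) ≈-refl E ⟩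
  E ^ 4                ≈⟨ ^-congˡ 4 (D-1 E) ⟨
  e 1 ^ 4              ∎
  where open ≈-R

norm-e2 : norm (e 2) * e 6 ≈ e 2 ^ 4
norm-e2 = begin
  norm (D 2 E) * e 6         ≈⟨ *-cong (norm-D2 E) (≈-sym (D-e 2 3 6 refl)) ⟩
  D 2 (norm E) * D 2 (e 3)   ≈⟨ D-* 2 (norm E) (e 3) ⟨
  D 2 (norm E * e 3)         ≈⟨ D-cong 2 (≈-trans norm-E (solve 1 (λ e → e :* (e :* e :* e) := e :^ 4) ≈-refl E)) ⟩
  D 2 (E ^ 4)                ≈⟨ D-^ 2 E 4 ⟩
  e 2 ^ 4                    ∎
  where open ≈-R

φ₃*w : φ₃ * w ≈ Ω₁
φ₃*w = begin
  φ₃ * w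
    ≈⟨ solve 6 (λ e₁ e₃ e₆ i₂ i₃ i₆ → i₆ :* (e₃ :* e₃) :* (e₁ :* e₆ :^ 3 :* (i₂ :* i₃ :^ 3)) :=
         i₂ :* (i₃ :* (e₁ :* e₆ :* e₆)) :* (e₃ :* i₃) :^ 2 :* (e₆ :* i₆) :^ 1) ≈-refl
         (e 1) (e 3) (e 6) (e⁻¹ 2) (e⁻¹ 3) (e⁻¹ 6) ⟩
  Ω₁ * (e 3 * e⁻¹ 3) ^ 2 * (e 6 * e⁻¹ 6) ^ 1
    ≈⟨ ≈-trans (cancel-e 6 1 _) (cancel-e 3 2 Ω₁) ⟩
  Ω₁ ∎
  where open ≈-R

-- The dissection of φ(-q) has no component of residue 2, so its norm is just a³ + q b³ with a = φ₃
-- and b = -2 φ₃ w; the cube of -2 is the origin of the 8.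
norm-φ : norm (e 1) * norm (e 1) ≈ norm (e 2) * (φ₃ ^ 3 * (oneS - ι (+ 8) * v))
norm-φ = begin
  norm (e 1) * norm (e 1)
    ≈⟨ norm-* (e 1) (e 1) ⟨
  norm (e 1 * e 1)
    ≈⟨ ≈-trans (norm-cong φ-dissection) (norm-* (e 2) _) ⟩
  norm (e 2) * norm (D 3 φ₃ - ι (+ 2) * (q^ 1 * D 3 Ω₁))
    ≈⟨ *-congˡ (norm-weave φ₃ (ι (- + 2) * Ω₁) (ι (+ 0)) (≈-trans
         (solve 3 (λ a q b → a :- con (+ 2) :* (q :* b) := a :+ q :* (con (- + 2) :* b :+ q :* con (+ 0))) ≈-refl
           (D 3 φ₃) (q^ 1) (D 3 Ω₁))
         (+-congˡ (*-congˡ (+-cong (≈-sym (D-scale 3 (- + 2) Ω₁)) (*-congˡ (≈-sym (D-ι 3 (+ 0))))))))) ⟩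
  norm (e 2) * norm₃ φ₃ (ι (- + 2) * Ω₁) (ι (+ 0))
    ≈⟨ *-congˡ (norm₃-cong ≈-refl (*-congˡ φ₃*w) ≈-refl) ⟨
  norm (e 2) * norm₃ φ₃ (ι (- + 2) * (φ₃ * w)) (ι (+ 0))
    ≈⟨ *-congˡ (solve 3 (λ a w q → let b = con (- + 2) :* (a :* w); c = con (+ 0) in
         a :* a :* a :+ q :* (b :* b :* b) :+ q :* q :* (c :* c :* c) :- con (+ 3) :* (q :* (a :* b :* c)) :=
         a :^ 3 :* (:1 :- con (+ 8) :* (q :* w :^ 3))) ≈-refl φ₃ w (q^ 1)) ⟩
  norm (e 2) * (φ₃ ^ 3 * (oneS - ι (+ 8) * v)) ∎
  where open ≈-R

-- The norms of E(q) and E(q²) are eta quotients, so `norm-φ` makes 1 - 8v an eta quotient too, and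
-- this one is 1/X. The factor `i` collects what remains once both norms have been substituted.
x-v : x * (oneS - ι (+ 8) * v) ≈ oneS
x-v = begin
  x * u
    ≈⟨ ≈-trans (cancel-e 6 1 _) (cancel-e 3 2 (x * u)) ⟨
  x * u * (e 3 * e⁻¹ 3) ^ 2 * (e 6 * e⁻¹ 6) ^ 1
    ≈⟨ solve 7 (λ i₁ i₆ e₂ e₃ e₆ u i₃ →
         e₂ :^ 4 :* e₃ :^ 8 :* (i₁ :^ 8 :* i₆ :^ 4) :* u :* (e₃ :* i₃) :^ 2 :* (e₆ :* i₆) :^ 1 :=
         i₁ :^ 8 :* i₆ :^ 2 :* e₃ :^ 2 :* (i₃ :^ 2 :* e₆) :* (e₂ :^ 4 :* ((i₆ :* (e₃ :* e₃)) :^ 3 :* u) :* e₃ :^ 2)) ≈-refl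
         (e⁻¹ 1) (e⁻¹ 6) (e 2) (e 3) (e 6) u (e⁻¹ 3) ⟩
  i * (e 2 ^ 4 * (φ₃ ^ 3 * u) * e 3 ^ 2)
    ≈⟨ *-congˡ (*-congʳ (*-congʳ norm-e2)) ⟨
  i * (norm (e 2) * e 6 * (φ₃ ^ 3 * u) * e 3 ^ 2)
    ≈⟨ solve 5 (λ i n e f g → i :* (n :* e :* f :* g :^ 2) := i :* (n :* f :* e :* g :^ 2)) ≈-refl
         i (norm (e 2)) (e 6) (φ₃ ^ 3 * u) (e 3) ⟩
  i * (norm (e 2) * (φ₃ ^ 3 * u) * e 6 * e 3 ^ 2)
    ≈⟨ *-congˡ (*-congʳ (*-congʳ norm-φ)) ⟨
  i * (norm (e 1) * norm (e 1) * e 6 * e 3 ^ 2)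
    ≈⟨ solve 4 (λ i n e g → i :* (n :* n :* e :* g :^ 2) := i :* ((n :* g) :* (n :* g) :* e)) ≈-refl
         i (norm (e 1)) (e 6) (e 3) ⟩
  i * ((norm (e 1) * e 3) * (norm (e 1) * e 3) * e 6)
    ≈⟨ *-congˡ (*-congʳ (*-cong norm-e1 norm-e1)) ⟩
  i * (e 1 ^ 4 * e 1 ^ 4 * e 6)
    ≈⟨ solve 6 (λ i₁ e₁ i₃ e₃ i₆ e₆ → i₁ :^ 8 :* i₆ :^ 2 :* e₃ :^ 2 :* (i₃ :^ 2 :* e₆) :* (e₁ :^ 4 :* e₁ :^ 4 :* e₆) :=
         :1 :* (e₁ :* i₁) :^ 8 :* (e₃ :* i₃) :^ 2 :* (e₆ :* i₆) :^ 2) ≈-refl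
         (e⁻¹ 1) (e 1) (e⁻¹ 3) (e 3) (e⁻¹ 6) (e 6) ⟩
  oneS * (e 1 * e⁻¹ 1) ^ 8 * (e 3 * e⁻¹ 3) ^ 2 * (e 6 * e⁻¹ 6) ^ 2
    ≈⟨ ≈-trans (cancel-e 6 2 _) (≈-trans (cancel-e 3 2 _) (cancel-e 1 8 oneS)) ⟩
  oneS ∎
  where
  open ≈-R
  u i : Series
  u = oneS - ι (+ 8) * v
  i = e⁻¹ 1 ^ 8 * e⁻¹ 6 ^ 2 * e 3 ^ 2 * (e⁻¹ 3 ^ 2 * e 6)

w⁻¹*w : w⁻¹ * w ≈ oneS
w⁻¹*w = ≈-trans
  (solve 8 (λ e₁ i₁ e₂ i₂ e₃ i₃ e₆ i₆ →
    e₂ :* e₃ :^ 3 :* (i₁ :* i₆ :^ 3) :* (e₁ :* e₆ :^ 3 :* (i₂ :* i₃ :^ 3)) :=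
    :1 :* (e₁ :* i₁) :^ 1 :* (e₂ :* i₂) :^ 1 :* (e₃ :* i₃) :^ 3 :* (e₆ :* i₆) :^ 3) ≈-refl
    (e 1) (e⁻¹ 1) (e 2) (e⁻¹ 2) (e 3) (e⁻¹ 3) (e 6) (e⁻¹ 6))
  (≈-trans (cancel-e 6 3 _) (≈-trans (cancel-e 3 3 _) (≈-trans (cancel-e 2 1 _) (cancel-e 1 1 oneS))))

-- Expressing X and ξ through W

Y s t W P : Series
Y = D 3 x
s = D 3 w⁻¹
t = D 3 w
W = q^ 1 * t
P = oneS + ι (+ 2) * W + ι (+ 4) * (W * W)

D3-quotient : ∀ m m′ n n′ k k′ l l′
  .{{_ : NonZero m}} .{{_ : NonZero m′}} .{{_ : NonZero n}} .{{_ : NonZero n′}}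
  .{{_ : NonZero k}} .{{_ : NonZero k′}} .{{_ : NonZero l}} .{{_ : NonZero l′}} →
  m′ ≡ m ℕ.* 3 → n′ ≡ n ℕ.* 3 → k′ ≡ k ℕ.* 3 → l′ ≡ l ℕ.* 3 → ∀ a b c d →
  D 3 (e m ^ a * e n ^ b * (e⁻¹ k ^ c * e⁻¹ l ^ d)) ≈ e m′ ^ a * e n′ ^ b * (e⁻¹ k′ ^ c * e⁻¹ l′ ^ d)
D3-quotient m m′ n n′ k k′ l l′ p r p′ r′ a b c d = ≈-trans (D-* 3 _ _)
  (*-cong (≈-trans (D-* 3 _ _) (*-cong (pow a (D-e 3 m m′ p)) (pow b (D-e 3 n n′ r))))
    (≈-trans (D-* 3 _ _) (*-cong (pow c (D-e⁻¹ 3 k k′ p′)) (pow d (D-e⁻¹ 3 l l′ r′)))))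
  where
  pow : ∀ j {f g} → D 3 f ≈ g → D 3 (f ^ j) ≈ g ^ j
  pow j {f} p = ≈-trans (D-^ 3 f j) (^-congˡ j p)

Y-quotient : Y ≈ e 6 ^ 4 * e 9 ^ 8 * (e⁻¹ 3 ^ 8 * e⁻¹ 18 ^ 4)
Y-quotient = D3-quotient 2 6 3 9 1 3 6 18 refl refl refl refl 4 8 8 4

s-quotient : s ≈ e 6 ^ 1 * e 9 ^ 3 * (e⁻¹ 3 ^ 1 * e⁻¹ 18 ^ 3)
s-quotient = ≈-trans
  (D-cong 3 (solve 4 (λ a b c d → a :* b :* (c :* d) := a :^ 1 :* b :* (c :^ 1 :* d)) ≈-refl (e 2) (e 3 ^ 3) (e⁻¹ 1) (e⁻¹ 6 ^ 3)))
  (D3-quotient 2 6 3 9 1 3 6 18 refl refl refl refl 1 3 1 3)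

t-quotient : t ≈ e 3 ^ 1 * e 18 ^ 3 * (e⁻¹ 6 ^ 1 * e⁻¹ 9 ^ 3)
t-quotient = ≈-trans
  (D-cong 3 (solve 4 (λ a b c d → a :* b :* (c :* d) := a :^ 1 :* b :* (c :^ 1 :* d)) ≈-refl (e 1) (e 6 ^ 3) (e⁻¹ 2) (e⁻¹ 3 ^ 3)))
  (D3-quotient 1 3 6 18 2 6 3 9 refl refl refl refl 1 3 1 3)

s*W : s * W ≈ q^ 1
s*W = begin
  s * (q^ 1 * t)      ≈⟨ solve 3 (λ s q t → s :* (q :* t) := q :* (s :* t)) ≈-refl s (q^ 1) t ⟩
  q^ 1 * (s * t)      ≈⟨ *-congˡ (≈-trans (≈-sym (D-* 3 w⁻¹ w)) (≈-trans (D-cong 3 w⁻¹*w) (D-one 3))) ⟩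
  q^ 1 * oneS         ≈⟨ *-identityʳ _ ⟩
  q^ 1                ∎
  where open ≈-R

D-3-v : D 3 v ≈ W ^ 3
D-3-v = begin
  D 3 (q^ 1 * w ^ 3)       ≈⟨ ≈-trans (D-* 3 (q^ 1) (w ^ 3)) (*-cong (D-mono 3 1) (D-^ 3 w 3)) ⟩
  q^ 3 * t ^ 3             ≈⟨ *-congʳ (≈-trans (*-congʳ (mono-+ 1 1)) (mono-+ 2 1)) ⟨
  q^ 1 * q^ 1 * q^ 1 * t ^ 3 ≈⟨ solve 2 (λ q t → q :* q :* q :* t :^ 3 := (q :* t) :^ 3) ≈-refl (q^ 1) t ⟩
  W ^ 3                    ∎
  where open ≈-R

Y-W : Y * (oneS - ι (+ 8) * W ^ 3) ≈ oneS
Y-W = begin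
  Y * (oneS - ι (+ 8) * W ^ 3)           ≈⟨ *-congˡ (+-cong (D-one 3) (neg-cong (≈-trans (D-scale 3 (+ 8) v) (*-congˡ D-3-v)))) ⟨
  Y * (D 3 oneS - D 3 (ι (+ 8) * v))     ≈⟨ *-congˡ (D-- 3 oneS _) ⟨
  Y * D 3 (oneS - ι (+ 8) * v)           ≈⟨ D-* 3 x _ ⟨
  D 3 (x * (oneS - ι (+ 8) * v))         ≈⟨ ≈-trans (D-cong 3 x-v) (D-one 3) ⟩
  oneS                                   ∎
  where open ≈-R

-- p = φ(-q)/φ(-q⁹) and y = ψ(q)/ψ(q⁹).
p y : Series
p = e 1 ^ 2 * (e 18 * (e⁻¹ 2 * e⁻¹ 9 ^ 2))
y = e 2 ^ 2 * (e 9 * (e⁻¹ 1 * e⁻¹ 18 ^ 2))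

p≈1-2W : p ≈ oneS - ι (+ 2) * W
p≈1-2W = begin
  e 1 ^ 2 * (e 18 * (e⁻¹ 2 * e⁻¹ 9 ^ 2))
    ≈⟨ *-congʳ (≈-trans (solve 1 (λ a → a :^ 2 := a :* a) ≈-refl (e 1)) (≈-trans φ-dissection
         (*-congˡ (+-cong D-3-φ₃ (neg-cong (*-congˡ (*-congˡ D-3-Ω₁))))))) ⟩
  e 2 * (e⁻¹ 18 * (e 9 * e 9) - ι (+ 2) * (q^ 1 * (e⁻¹ 6 * (e⁻¹ 9 * (e 3 * e 18 * e 18)))))
    * (e 18 * (e⁻¹ 2 * e⁻¹ 9 ^ 2))
    ≈⟨ solve 9 (λ e₂ i₂ e₃ i₆ e₉ i₉ e₁₈ i₁₈ q →
         e₂ :* (i₁₈ :* (e₉ :* e₉) :- con (+ 2) :* (q :* (i₆ :* (i₉ :* (e₃ :* e₁₈ :* e₁₈))))) :* (e₁₈ :* (i₂ :* i₉ :^ 2)) :=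
         (:1 :* (e₉ :* i₉) :^ 2 :* (e₁₈ :* i₁₈) :^ 1 :- con (+ 2) :* (q :* (e₃ :^ 1 :* e₁₈ :^ 3 :* (i₆ :^ 1 :* i₉ :^ 3)))) :* (e₂ :* i₂) :^ 1)
         ≈-refl (e 2) (e⁻¹ 2) (e 3) (e⁻¹ 6) (e 9) (e⁻¹ 9) (e 18) (e⁻¹ 18) (q^ 1) ⟩
  (oneS * (e 9 * e⁻¹ 9) ^ 2 * (e 18 * e⁻¹ 18) ^ 1 - ι (+ 2) * (q^ 1 * (e 3 ^ 1 * e 18 ^ 3 * (e⁻¹ 6 ^ 1 * e⁻¹ 9 ^ 3))))
    * (e 2 * e⁻¹ 2) ^ 1
    ≈⟨ cancel-e 2 1 _ ⟩
  oneS * (e 9 * e⁻¹ 9) ^ 2 * (e 18 * e⁻¹ 18) ^ 1 - ι (+ 2) * (q^ 1 * (e 3 ^ 1 * e 18 ^ 3 * (e⁻¹ 6 ^ 1 * e⁻¹ 9 ^ 3)))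
    ≈⟨ +-cong (≈-trans (cancel-e 18 1 _) (cancel-e 9 2 oneS)) (neg-cong (*-congˡ (*-congˡ (≈-sym t-quotient)))) ⟩
  oneS - ι (+ 2) * W ∎
  where open ≈-R

y≈s[1+W] : y ≈ s * (oneS + W)
y≈s[1+W] = begin
  e 2 ^ 2 * (e 9 * (e⁻¹ 1 * e⁻¹ 18 ^ 2))
    ≈⟨ *-congʳ (≈-trans (solve 1 (λ a → a :^ 2 := a :* a) ≈-refl (e 2)) ψ-dissection) ⟩
  e 1 * (e⁻¹ 18 * (e⁻¹ 3 * (e 6 * e 9 * e 9)) + q^ 1 * (e⁻¹ 9 * (e 18 * e 18))) * (e 9 * (e⁻¹ 1 * e⁻¹ 18 ^ 2))
    ≈⟨ solve 9 (λ e₁ i₁ i₃ e₆ e₉ i₉ e₁₈ i₁₈ q →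
         e₁ :* (i₁₈ :* (i₃ :* (e₆ :* e₉ :* e₉)) :+ q :* (i₉ :* (e₁₈ :* e₁₈))) :* (e₉ :* (i₁ :* i₁₈ :^ 2)) :=
         (e₆ :^ 1 :* e₉ :^ 3 :* (i₃ :^ 1 :* i₁₈ :^ 3) :+ q :* (e₉ :* i₉) :^ 1 :* (e₁₈ :* i₁₈) :^ 2) :* (e₁ :* i₁) :^ 1)
         ≈-refl (e 1) (e⁻¹ 1) (e⁻¹ 3) (e 6) (e 9) (e⁻¹ 9) (e 18) (e⁻¹ 18) (q^ 1) ⟩
  (e 6 ^ 1 * e 9 ^ 3 * (e⁻¹ 3 ^ 1 * e⁻¹ 18 ^ 3) + q^ 1 * (e 9 * e⁻¹ 9) ^ 1 * (e 18 * e⁻¹ 18) ^ 2) * (e 1 * e⁻¹ 1) ^ 1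
    ≈⟨ cancel-e 1 1 _ ⟩
  e 6 ^ 1 * e 9 ^ 3 * (e⁻¹ 3 ^ 1 * e⁻¹ 18 ^ 3) + q^ 1 * (e 9 * e⁻¹ 9) ^ 1 * (e 18 * e⁻¹ 18) ^ 2
    ≈⟨ +-cong (≈-sym s-quotient) (≈-trans (cancel-e 18 2 _) (≈-trans (cancel-e 9 1 (q^ 1)) (≈-sym s*W))) ⟩
  s + s * W
    ≈⟨ solve 2 (λ s w → s :+ s :* w := s :* (:1 :+ w)) ≈-refl s W ⟩
  s * (oneS + W) ∎
  where open ≈-R

-- By (1 - 2W)(1 + 2W + 4W²) = 1 - 8W³, which is 1/X at q³. So 1/p is P Y, and this rewrites the
-- powers of p in the denominators of X and ξ.
p*P*Y : p * P * Y ≈ oneS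
p*P*Y = begin
  p * P * Y
    ≈⟨ *-congʳ (*-congʳ p≈1-2W) ⟩
  (oneS - ι (+ 2) * W) * P * Y
    ≈⟨ solve 2 (λ w y → (:1 :- con (+ 2) :* w) :* (:1 :+ con (+ 2) :* w :+ con (+ 4) :* (w :* w)) :* y :=
         y :* (:1 :- con (+ 8) :* w :^ 3)) ≈-refl W Y ⟩
  Y * (oneS - ι (+ 8) * W ^ 3)
    ≈⟨ Y-W ⟩
  oneS ∎
  where open ≈-R

x*p⁴*Y : x * p ^ 4 * Y ≈ oneS
x*p⁴*Y = begin
  x * p ^ 4 * Y
    ≈⟨ *-congˡ Y-quotient ⟩
  x * p ^ 4 * (e 6 ^ 4 * e 9 ^ 8 * (e⁻¹ 3 ^ 8 * e⁻¹ 18 ^ 4))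
    ≈⟨ solve 12 (λ e₁ i₁ e₂ i₂ e₃ i₃ e₆ i₆ e₉ i₉ e₁₈ i₁₈ →
         e₂ :^ 4 :* e₃ :^ 8 :* (i₁ :^ 8 :* i₆ :^ 4) :* (e₁ :^ 2 :* (e₁₈ :* (i₂ :* i₉ :^ 2))) :^ 4
           :* (e₆ :^ 4 :* e₉ :^ 8 :* (i₃ :^ 8 :* i₁₈ :^ 4)) :=
         :1 :* (e₁ :* i₁) :^ 8 :* (e₂ :* i₂) :^ 4 :* (e₃ :* i₃) :^ 8 :* (e₆ :* i₆) :^ 4 :* (e₉ :* i₉) :^ 8 :* (e₁₈ :* i₁₈) :^ 4)
         ≈-refl (e 1) (e⁻¹ 1) (e 2) (e⁻¹ 2) (e 3) (e⁻¹ 3) (e 6) (e⁻¹ 6) (e 9) (e⁻¹ 9) (e 18) (e⁻¹ 18) ⟩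
  oneS * (e 1 * e⁻¹ 1) ^ 8 * (e 2 * e⁻¹ 2) ^ 4 * (e 3 * e⁻¹ 3) ^ 8 * (e 6 * e⁻¹ 6) ^ 4 * (e 9 * e⁻¹ 9) ^ 8 * (e 18 * e⁻¹ 18) ^ 4
    ≈⟨ ≈-trans (cancel-e 18 4 _) (≈-trans (cancel-e 9 8 _) (≈-trans (cancel-e 6 4 _) (≈-trans (cancel-e 3 8 _)
         (≈-trans (cancel-e 2 4 _) (cancel-e 1 8 oneS))))) ⟩
  oneS ∎
  where open ≈-R

x≈P⁴Y³ : x ≈ P ^ 4 * Y ^ 3
x≈P⁴Y³ = begin
  x                                   ≈⟨ ≈-trans (*-congˡ (≈-trans (^-congˡ 4 p*P*Y) (one-^ 4))) (*-identityʳ x) ⟨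
  x * (p * P * Y) ^ 4                 ≈⟨ solve 4 (λ x p P y → x :* (p :* P :* y) :^ 4 := x :* p :^ 4 :* y :* (P :^ 4 :* y :^ 3)) ≈-refl x p P Y ⟩
  x * p ^ 4 * Y * (P ^ 4 * Y ^ 3)     ≈⟨ *-congʳ x*p⁴*Y ⟩
  oneS * (P ^ 4 * Y ^ 3)              ≈⟨ *-identityˡ _ ⟩
  P ^ 4 * Y ^ 3                       ∎
  where open ≈-R

z : Series
z = e 2 ^ 5 * e 9 ^ 4 * (e⁻¹ 1 ^ 4 * e⁻¹ 18 ^ 5)

-- This ties ξ to the two theta relations: q²ξ is y²/p by cancellation of eta factors alone.
z*p : z * p ≈ y ^ 2
z*p = ≈-trans
  (solve 8 (λ e₁ i₁ e₂ i₂ e₉ i₉ e₁₈ i₁₈ →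
    e₂ :^ 5 :* e₉ :^ 4 :* (i₁ :^ 4 :* i₁₈ :^ 5) :* (e₁ :^ 2 :* (e₁₈ :* (i₂ :* i₉ :^ 2))) :=
    (e₂ :^ 2 :* (e₉ :* (i₁ :* i₁₈ :^ 2))) :^ 2 :* (e₁ :* i₁) :^ 2 :* (e₂ :* i₂) :^ 1 :* (e₉ :* i₉) :^ 2 :* (e₁₈ :* i₁₈) :^ 1)
    ≈-refl (e 1) (e⁻¹ 1) (e 2) (e⁻¹ 2) (e 9) (e⁻¹ 9) (e 18) (e⁻¹ 18))
  (≈-trans (cancel-e 18 1 _) (≈-trans (cancel-e 9 2 _) (≈-trans (cancel-e 2 1 _) (cancel-e 1 2 (y ^ 2)))))

z-product : z ≈ (s * (oneS + W)) ^ 2 * P * Y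
z-product = begin
  z                                 ≈⟨ ≈-trans (*-congˡ p*P*Y) (*-identityʳ z) ⟨
  z * (p * P * Y)                   ≈⟨ solve 4 (λ z p P y → z :* (p :* P :* y) := z :* p :* P :* y) ≈-refl z p P Y ⟩
  z * p * P * Y                     ≈⟨ *-congʳ (*-congʳ (≈-trans z*p (^-congˡ 2 y≈s[1+W]))) ⟩
  (s * (oneS + W)) ^ 2 * P * Y      ∎
  where open ≈-R

-- Polynomials as coefficient lists, constant term first

Poly : Set
Poly = List ℤ

eval : Poly → Series → Series
eval []       f = zeroS
eval (c ∷ cs) f = ι c + f * eval cs f

_⊕_ : Poly → Poly → Poly
[]       ⊕ ds       = ds
(c ∷ cs) ⊕ []       = c ∷ cs
(c ∷ cs) ⊕ (d ∷ ds) = (c ℤ.+ d) ∷ (cs ⊕ ds)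

scale : ℤ → Poly → Poly
scale c = map (ℤ._* c)

_⊗_ : Poly → Poly → Poly
[]       ⊗ ds = []
(c ∷ cs) ⊗ ds = scale c ds ⊕ (+ 0 ∷ (cs ⊗ ds))

power : Poly → ℕ → Poly
power cs zero    = + 1 ∷ []
power cs (suc k) = cs ⊗ power cs k

compose : Poly → Poly → Poly
compose []       ds = []
compose (c ∷ cs) ds = (c ∷ []) ⊕ (ds ⊗ compose cs ds)

-- Prepending a coefficient multiplies the rest by the variable and so rotates the residue classes;
-- only the class of exponent 2 gains a power of the cube.
split₃ : Poly → Poly × Poly × Poly
split₃ []       = [] , [] , []
split₃ (c ∷ cs) = let a , b , d = split₃ cs in c ∷ d , a , b

eval-cong : ∀ cs {f g} → f ≈ g → eval cs f ≈ eval cs g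
eval-cong []       p = ≈-refl
eval-cong (c ∷ cs) p = +-congˡ (*-cong p (eval-cong cs p))

eval-⊕ : ∀ cs ds f → eval (cs ⊕ ds) f ≈ eval cs f + eval ds f
eval-⊕ []       ds       f = ≈-sym (+-identityˡ _)
eval-⊕ (c ∷ cs) []       f = ≈-sym (+-identityʳ _)
eval-⊕ (c ∷ cs) (d ∷ ds) f = ≈-trans (+-cong (ι-homo-+ c d) (*-congˡ (eval-⊕ cs ds f)))
  (solve 5 (λ c d f x y → c :+ d :+ f :* (x :+ y) := c :+ f :* x :+ (d :+ f :* y)) ≈-refl
    (ι c) (ι d) f (eval cs f) (eval ds f))

eval-scale : ∀ c ds f → eval (scale c ds) f ≈ ι c * eval ds f
eval-scale c []       f = ≈-sym (zeroʳ (ι c))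
eval-scale c (d ∷ ds) f = ≈-trans (+-cong (ι-homo-* d c) (*-congˡ (eval-scale c ds f)))
  (solve 4 (λ c d f y → d :* c :+ f :* (c :* y) := c :* (d :+ f :* y)) ≈-refl (ι c) (ι d) f (eval ds f))

eval-⊗ : ∀ cs ds f → eval (cs ⊗ ds) f ≈ eval cs f * eval ds f
eval-⊗ []       ds f = ≈-sym (zeroˡ _)
eval-⊗ (c ∷ cs) ds f = begin
  eval (scale c ds ⊕ (+ 0 ∷ (cs ⊗ ds))) f
    ≈⟨ ≈-trans (eval-⊕ (scale c ds) _ f) (+-cong (eval-scale c ds f) (+-congˡ (*-congˡ (eval-⊗ cs ds f)))) ⟩
  ι c * eval ds f + (ι (+ 0) + f * (eval cs f * eval ds f))
    ≈⟨ solve 4 (λ c d f y → c :* d :+ (con (+ 0) :+ f :* (y :* d)) := (c :+ f :* y) :* d) ≈-refl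
         (ι c) (eval ds f) f (eval cs f) ⟩
  (ι c + f * eval cs f) * eval ds f ∎
  where open ≈-R

eval-const : ∀ c f → eval (c ∷ []) f ≈ ι c
eval-const c f = ≈-trans (+-congˡ (zeroʳ f)) (+-identityʳ (ι c))

eval-power : ∀ cs k f → eval (power cs k) f ≈ eval cs f ^ k
eval-power cs zero    f = ≈-trans (eval-const (+ 1) f) ι-one
eval-power cs (suc k) f = ≈-trans (eval-⊗ cs (power cs k) f) (*-congˡ (eval-power cs k f))

eval-compose : ∀ cs ds f → eval (compose cs ds) f ≈ eval cs (eval ds f)
eval-compose []       ds f = ≈-refl
eval-compose (c ∷ cs) ds f = ≈-trans (eval-⊕ (c ∷ []) (ds ⊗ compose cs ds) f)
  (+-cong (eval-const c f) (≈-trans (eval-⊗ ds (compose cs ds) f) (*-congˡ (eval-compose cs ds f))))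

eval-split₃ : ∀ cs f → let a , b , c = split₃ cs in
  eval cs f ≈ eval a (f ^ 3) + f * (eval b (f ^ 3) + f * eval c (f ^ 3))
eval-split₃ []       f = ≈-sym (≈-trans (+-identityˡ _) (≈-trans (*-congˡ (≈-trans (+-identityˡ _) (zeroʳ f))) (zeroʳ f)))
eval-split₃ (c ∷ cs) f = ≈-trans (+-congˡ (*-congˡ (eval-split₃ cs f)))
  (solve 5 (λ c f x y z → c :+ f :* (x :+ f :* (y :+ f :* z)) := c :+ f :^ 3 :* z :+ f :* (x :+ f :* y)) ≈-refl
    (ι c) f (eval (proj₁ (split₃ cs)) (f ^ 3)) (eval (proj₁ (proj₂ (split₃ cs))) (f ^ 3))
    (eval (proj₂ (proj₂ (split₃ cs))) (f ^ 3)))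

D-eval : ∀ m .{{_ : NonZero m}} cs f → D m (eval cs f) ≈ eval cs (D m f)
D-eval m []       f = D-zeroS m
D-eval m (c ∷ cs) f = ≈-trans (D-+ m (ι c) _)
  (+-cong (D-ι m c) (≈-trans (D-* m f _) (*-congˡ (D-eval m cs f))))

eval-zero : ∀ {cs} → All (_≡ + 0) cs → ∀ f → eval cs f ≈ zeroS
eval-zero []        f = ≈-refl
eval-zero (refl ∷ p) f = ≈-trans (+-cong ι-zero (≈-trans (*-congˡ (eval-zero p f)) (zeroʳ f))) (+-identityˡ zeroS)

-- Equality of polynomials up to trailing zeros.
Agree : Poly → Poly → Set
Agree cs ds = True (all? (ℤ._≟ + 0) (cs ⊕ scale (- + 1) ds))

eval-agree : ∀ cs ds → Agree cs ds → ∀ f → eval cs f ≈ eval ds f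
eval-agree cs ds agree f = begin
  eval cs f
    ≈⟨ solve 2 (λ a b → a := a :+ con (- + 1) :* b :+ b) ≈-refl (eval cs f) (eval ds f) ⟩
  eval cs f + ι (- + 1) * eval ds f + eval ds f
    ≈⟨ +-congʳ (≈-trans (eval-⊕ cs _ f) (+-congˡ (eval-scale (- + 1) ds f))) ⟨
  eval (cs ⊕ scale (- + 1) ds) f + eval ds f
    ≈⟨ +-congʳ (eval-zero (toWitness agree) f) ⟩
  zeroS + eval ds f
    ≈⟨ +-identityˡ _ ⟩
  eval ds f ∎
  where open ≈-R

-- Reversing the coefficients turns a polynomial in g = 1/f, multiplied by a power of f, into a
-- polynomial in f. The factor `f` on the left avoids the exponent `length cs` - 1, and the
-- accumulator `ds` follows the recursion of `_ʳ++_`.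
eval-ʳ++ : ∀ {f g} → f * g ≈ oneS → ∀ cs ds →
  f * eval (cs ʳ++ ds) f ≈ f ^ length cs * (f * eval ds f + eval cs g)
eval-ʳ++ {f} {g} fg []       ds = ≈-sym (≈-trans (*-identityˡ _) (+-identityʳ _))
eval-ʳ++ {f} {g} fg (c ∷ cs) ds = begin
  f * eval (cs ʳ++ (c ∷ ds)) f
    ≈⟨ eval-ʳ++ fg cs (c ∷ ds) ⟩
  f ^ length cs * (f * (ι c + f * eval ds f) + eval cs g)
    ≈⟨ *-congˡ (+-congˡ (≈-trans (*-congʳ fg) (*-identityˡ _))) ⟨
  f ^ length cs * (f * (ι c + f * eval ds f) + f * g * eval cs g)
    ≈⟨ solve 6 (λ p f g c d e → p :* (f :* (c :+ f :* d) :+ f :* g :* e) := f :* p :* (f :* d :+ (c :+ g :* e))) ≈-refl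
         (f ^ length cs) f g (ι c) (eval ds f) (eval cs g) ⟩
  f * f ^ length cs * (f * eval ds f + (ι c + g * eval cs g)) ∎
  where open ≈-R

-- The polynomial c with W² c(W³) the part of (1 + W)² P^m of exponents 2 mod 3.
extract : ℕ → Poly
extract m = proj₂ (proj₂ (split₃ (power (+ 1 ∷ + 1 ∷ []) 2 ⊗ power (+ 1 ∷ + 2 ∷ + 4 ∷ []) m)))

-- Since s W = q, the factor s² turns the parts A, W B, W² C of the polynomial into s² A, q s B, q²
-- C, where s, Y and the values A, B, C are series in q³. So residues of W-exponents are residues of
-- q-exponents, and the coefficients at 3k + 2 see C alone, without any s.
U-series : ∀ {f} m n → f ≈ s ^ 2 * ((oneS + W) ^ 2 * P ^ m) * Y ^ n →
  ∀ k → f (2 ℕ.+ k ℕ.* 3) ≡ (x ^ n * eval (extract m) v) k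
U-series {f} m n f≈ k = trans (at f≈weave (2 ℕ.+ k ℕ.* 3)) (weave-at-2 _ _ _ k)
  where
  open ≈-R
  cs a b c : Poly
  cs = power (+ 1 ∷ + 1 ∷ []) 2 ⊗ power (+ 1 ∷ + 2 ∷ + 4 ∷ []) m
  a = proj₁ (split₃ cs)
  b = proj₁ (proj₂ (split₃ cs))
  c = proj₂ (proj₂ (split₃ cs))

  eval-cs : (oneS + W) ^ 2 * P ^ m ≈ eval cs W
  eval-cs = ≈-sym (≈-trans (eval-⊗ (power (+ 1 ∷ + 1 ∷ []) 2) (power (+ 1 ∷ + 2 ∷ + 4 ∷ []) m) W) (*-cong
    (≈-trans (eval-power (+ 1 ∷ + 1 ∷ []) 2 W) (^-congˡ 2 (+-cong ι-one (≈-trans (*-congˡ (≈-trans (eval-const (+ 1) W) ι-one)) (*-identityʳ W)))))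
    (≈-trans (eval-power (+ 1 ∷ + 2 ∷ + 4 ∷ []) m W) (^-congˡ m (≈-trans
      (+-cong ι-one (*-congˡ (+-congˡ (*-congˡ (eval-const (+ 4) W)))))
      (solve 1 (λ w → :1 :+ w :* (con (+ 2) :+ w :* con (+ 4)) := :1 :+ con (+ 2) :* w :+ con (+ 4) :* (w :* w)) ≈-refl W))))))

  D3-part : ∀ {g h} ds → D 3 g ≈ h → D 3 (x ^ n * (g * eval ds v)) ≈ Y ^ n * (h * eval ds (W ^ 3))
  D3-part ds p = ≈-trans (D-* 3 _ _) (*-cong (D-^ 3 x n) (≈-trans (D-* 3 _ _)
    (*-cong p (≈-trans (D-eval 3 ds v) (eval-cong ds D-3-v)))))

  f≈weave : f ≈ weave (x ^ n * (w⁻¹ ^ 2 * eval a v)) (x ^ n * (w⁻¹ * eval b v)) (x ^ n * eval c v)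
  f≈weave = begin
    f
      ≈⟨ ≈-trans f≈ (*-congʳ (*-congˡ (≈-trans eval-cs (eval-split₃ cs W)))) ⟩
    s ^ 2 * (A + W * (B + W * C)) * Y ^ n
      ≈⟨ solve 6 (λ s w a b c y → s :^ 2 :* (a :+ w :* (b :+ w :* c)) :* y :=
           y :* (s :^ 2 :* a) :+ s :* w :* (y :* (s :* b) :+ s :* w :* (y :* c))) ≈-refl s W A B C (Y ^ n) ⟩
    Y ^ n * (s ^ 2 * A) + s * W * (Y ^ n * (s * B) + s * W * (Y ^ n * C))
      ≈⟨ +-congˡ (*-cong s*W (+-congˡ (*-congʳ s*W))) ⟩
    Y ^ n * (s ^ 2 * A) + q^ 1 * (Y ^ n * (s * B) + q^ 1 * (Y ^ n * C))
      ≈⟨ +-cong (D3-part a (D-^ 3 w⁻¹ 2)) (*-congˡ (+-cong (D3-part b ≈-refl) (*-congˡ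
           (≈-trans (D-* 3 _ _) (*-cong (D-^ 3 x n) (≈-trans (D-eval 3 c v) (eval-cong c D-3-v))))))) ⟨
    weave (x ^ n * (w⁻¹ ^ 2 * eval a v)) (x ^ n * (w⁻¹ * eval b v)) (x ^ n * eval c v) ∎
    where
    A B C : Series
    A = eval a (W ^ 3)
    B = eval b (W ^ 3)
    C = eval c (W ^ 3)

-- With u = 1 - 8v = 1/x the claim is that the extracted polynomial equals the one with coefficients
-- `reverse cs` in u. As polynomials in v the two are compared by computation, and the power of x
-- then reverses the list.
extract-eval : ∀ m cs → Agree (extract m) (compose (reverse cs) (+ 1 ∷ - + 8 ∷ [])) → reverse (reverse cs) ≡ cs →
  x ^ length (reverse cs) * eval (extract m) v ≈ eval (+ 0 ∷ cs) x
extract-eval m cs agree rev = begin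
  x ^ length rs * eval (extract m) v
    ≈⟨ *-congˡ (≈-trans (eval-agree (extract m) _ agree v) (≈-trans (eval-compose rs _ v) (eval-cong rs u))) ⟩
  x ^ length rs * eval rs (oneS - ι (+ 8) * v)
    ≈⟨ *-congˡ (≈-trans (+-congʳ (zeroʳ x)) (+-identityˡ _)) ⟨
  x ^ length rs * (x * zeroS + eval rs (oneS - ι (+ 8) * v))
    ≈⟨ eval-ʳ++ x-v rs [] ⟨
  x * eval (reverse rs) x
    ≈⟨ ≈-trans (+-congʳ ι-zero) (+-identityˡ _) ⟨
  eval (+ 0 ∷ reverse rs) x
    ≡⟨ cong (λ ds → eval (+ 0 ∷ ds) x) rev ⟩
  eval (+ 0 ∷ cs) x ∎
  where
  open ≈-R
  rs : Poly
  rs = reverse cs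
  u : eval (+ 1 ∷ - + 8 ∷ []) v ≈ oneS - ι (+ 8) * v
  u = ≈-trans (+-cong ι-one (*-congˡ (eval-const (- + 8) v)))
    (solve 1 (λ v → :1 :+ v :* con (- + 8) := :1 :- con (+ 8) :* v) ≈-refl v)

zx^k : ∀ k → z * x ^ k ≈ s ^ 2 * ((oneS + W) ^ 2 * P ^ suc (k ℕ.* 4)) * Y ^ suc (k ℕ.* 3)
zx^k zero = ≈-trans (*-identityʳ z) (≈-trans z-product
  (solve 4 (λ s w p y → (s :* (:1 :+ w)) :^ 2 :* p :* y := s :^ 2 :* ((:1 :+ w) :^ 2 :* p :^ 1) :* y :^ 1) ≈-refl s W P Y))
zx^k (suc k) = begin
  z * (x * x ^ k)
    ≈⟨ solve 3 (λ z x p → z :* (x :* p) := z :* p :* x) ≈-refl z x (x ^ k) ⟩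
  z * x ^ k * x
    ≈⟨ *-cong (zx^k k) x≈P⁴Y³ ⟩
  s ^ 2 * ((oneS + W) ^ 2 * P ^ suc (k ℕ.* 4)) * Y ^ suc (k ℕ.* 3) * (P ^ 4 * Y ^ 3)
    -- The powers are written out factor by factor because this is how the exponents
    -- `suc (suc k * 4)` and `suc (suc k * 3)` unfold for a variable k.
    ≈⟨ solve 5 (λ a p pk y yk → a :* pk :* yk :* (p :^ 4 :* y :^ 3) := a :* (p :* (p :* (p :* (p :* pk)))) :* (y :* (y :* (y :* yk)))) ≈-refl
         (s ^ 2) P ((oneS + W) ^ 2 * P ^ suc (k ℕ.* 4)) Y (Y ^ suc (k ℕ.* 3)) ⟩
  s ^ 2 * (P * (P * (P * (P * ((oneS + W) ^ 2 * P ^ suc (k ℕ.* 4)))))) * Y ^ suc (suc k ℕ.* 3)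
    ≈⟨ *-congʳ (*-congˡ (solve 3 (λ w p pk → p :* (p :* (p :* (p :* (w :* pk)))) := w :* (p :* (p :* (p :* (p :* pk))))) ≈-refl
         ((oneS + W) ^ 2) P (P ^ suc (k ℕ.* 4)))) ⟩
  s ^ 2 * ((oneS + W) ^ 2 * P ^ suc (suc k ℕ.* 4)) * Y ^ suc (suc k ℕ.* 3) ∎
  where open ≈-R

-- The Laurent series X and ξ

opaque
  unfolding _+_

  ^S≡^ : ∀ f k → f ^S k ≡ f ^ k
  ^S≡^ f zero    = refl
  ^S≡^ f (suc k) = cong (f *S_) (^S≡^ f k)

  *S-quotient : ∀ f g h k → (f *S g) *S invS (h *S k) ≡ f * g * invS (h * k)
  *S-quotient f g h k = refl

  Eq≡e : ∀ m .{{_ : NonZero m}} → Eq m ≡ e m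
  Eq≡e m = refl

  *S≡* : ∀ f g → f *S g ≡ f * g
  *S≡* f g = refl

  ·S-oneS≡ι : ∀ c → c ·S oneS ≡ ι c
  ·S-oneS≡ι c = refl

^-head : ∀ {f} → f 0 ≡ + 1 → ∀ k → (f ^ k) 0 ≡ + 1
^-head     p zero    = refl
^-head {f} p (suc k) = *-head {f} p (^-head {f} p k)

-- Inverses are unique, so the single `invS` of the denominator splits into powers of the `e⁻¹`.
eta-quotient : ∀ m n k l .{{_ : NonZero m}} .{{_ : NonZero n}} .{{_ : NonZero k}} .{{_ : NonZero l}} a b c d →
  ((Eq m ^S a) *S (Eq n ^S b)) *S invS ((Eq k ^S c) *S (Eq l ^S d)) ≈ e m ^ a * e n ^ b * (e⁻¹ k ^ c * e⁻¹ l ^ d)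
eta-quotient m n k l a b c d = begin
  ((Eq m ^S a) *S (Eq n ^S b)) *S invS ((Eq k ^S c) *S (Eq l ^S d))
    ≡⟨ *S-quotient (Eq m ^S a) (Eq n ^S b) (Eq k ^S c) (Eq l ^S d) ⟩
  (Eq m ^S a) * (Eq n ^S b) * invS ((Eq k ^S c) * (Eq l ^S d))
    ≡⟨ cong₂ (λ f g → f * invS g) (cong₂ _*_ (pow m a) (pow n b)) (cong₂ _*_ (pow k c) (pow l d)) ⟩
  e m ^ a * e n ^ b * invS g
    ≈⟨ *-congˡ (≈-trans (unit-solve-≈ (*-invS g g-head) inverse) (*-identityʳ (invS g))) ⟨
  e m ^ a * e n ^ b * (e⁻¹ k ^ c * e⁻¹ l ^ d) ∎
  where
  open ≈-R
  g : Series
  g = e k ^ c * e l ^ d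
  pow : ∀ m .{{_ : NonZero m}} a → Eq m ^S a ≡ e m ^ a
  pow m a = trans (cong (_^S a) (Eq≡e m)) (^S≡^ (e m) a)
  g-head : g 0 ≡ + 1
  g-head = *-head {e k ^ c} (^-head {e k} (D-zero k E) c) (^-head {e l} (D-zero l E) d)
  power-inverse : ∀ m .{{_ : NonZero m}} j → e m ^ j * e⁻¹ m ^ j ≈ oneS
  power-inverse m j = ≈-trans (≈-sym (^-distrib-* (e m) (e⁻¹ m) j))
    (≈-trans (^-congˡ j (e-inverse m)) (one-^ j))
  inverse : g * (e⁻¹ k ^ c * e⁻¹ l ^ d) ≈ oneS
  inverse = ≈-trans
    (solve 4 (λ a b c d → a :* b :* (c :* d) := a :* c :* (b :* d)) ≈-refl (e k ^ c) (e l ^ d) (e⁻¹ k ^ c) (e⁻¹ l ^ d))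
    (≈-trans (*-cong (power-inverse k c) (power-inverse l d)) (*-identityˡ oneS))

X≈x : ser X ≈ x
X≈x = eta-quotient 2 3 1 6 4 8 8 4

ξ≈z : ser ξ ≈ z
ξ≈z = eta-quotient 2 9 1 18 5 4 4 5

-- The argument X is generalised to a variable, since Agda would otherwise
-- try to evaluate its coefficients.
module _ {a : Series} (a≈x : a ≈ x) where

  -- All shifts are 0, so `_+L_` only introduces an argument + n - + 0 that reduces to n. The series
  -- `f` stays existential to keep its unfolded form out of later goals.
  polyL-eval : ∀ cs → ∃ λ f → polyL cs (fromSeries a) ≡ laurent 0 f × f ≈ eval cs x
  polyL-eval []       = zeroS , refl , ≈-refl
  polyL-eval (c ∷ cs) with polyL-eval cs
  ... | f , polyL≡ , f≈ rewrite polyL≡ = _ , refl , pointwise λ n → begin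
    coeffL (laurent 0 (c ·S oneS)) (+ n ℤ.- + 0) ℤ.+ coeffL (laurent 0 (a *S f)) (+ n ℤ.- + 0)
      ≡⟨ cong₂ ℤ._+_ (coeffL-0 (c ·S oneS) n) (coeffL-0 (a *S f) n) ⟩
    (c ·S oneS) n ℤ.+ (a *S f) n
      ≡⟨ cong₂ (λ g h → g n ℤ.+ h n) (·S-oneS≡ι c) (*S≡* a f) ⟩
    ι c n ℤ.+ (a * f) n
      ≡⟨ cong (ℤ._+_ (ι c n)) (at (*-cong a≈x f≈) n) ⟩
    ι c n ℤ.+ (x * eval cs x) n
      ≡⟨ +-at (ι c) (x * eval cs x) n ⟨
    eval (c ∷ cs) x n ∎
    where
    open ≡-Reasoning
    coeffL-0 : ∀ g n → coeffL (laurent 0 g) (+ n ℤ.- + 0) ≡ g n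
    coeffL-0 g n = cong g (trans (ℕₚ.+-identityʳ _) (ℕₚ.+-identityʳ n))

  U-coeffL : ∀ g cs → (∀ k → g (2 ℕ.+ k ℕ.* 3) ≡ eval cs x k) →
    ∀ n → U (coeffL (laurent 2 g)) n ≡ coeffL (polyL cs (fromSeries a)) n
  U-coeffL g cs g≡ n with polyL-eval cs
  ... | f , polyL≡ , f≈ rewrite polyL≡ = go n
    where
    open ≡-Reasoning
    go : ∀ n → U (coeffL (laurent 2 g)) n ≡ coeffL (laurent 0 f) n
    go (+ k) = begin
      coeffL (laurent 2 g) (+ 3 ℤ.* + k)        ≡⟨ cong (coeffL (laurent 2 g)) (ℤₚ.pos-* 3 k) ⟨
      g (3 ℕ.* k ℕ.+ 2)                         ≡⟨ cong g (alg k) ⟩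
      g (2 ℕ.+ k ℕ.* 3)                         ≡⟨ g≡ k ⟩
      eval cs x k                               ≡⟨ at f≈ k ⟨
      f k                                       ≡⟨ cong f (ℕₚ.+-identityʳ k) ⟨
      f (k ℕ.+ 0)                               ∎
      where
      alg : ∀ k → 3 ℕ.* k ℕ.+ 2 ≡ 2 ℕ.+ k ℕ.* 3
      alg = ℕ-Solver.solve-∀
    -- For n = -(1 + k) the shifted exponent 3n + 2 = -(3k + 1) is still negative, so both sides are
    -- the default 0. Exhibiting the 2 in the exponent lets the addition of the shift compute.
    go -[1+ k ] = cong (λ j → coeffL (laurent 2 g) -[1+ j ]) (alg k)
      where
      alg : ∀ k → k ℕ.+ (suc k ℕ.+ (suc k ℕ.+ 0)) ≡ 2 ℕ.+ (k ℕ.+ k ℕ.+ k)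
      alg = ℕ-Solver.solve-∀

-- `L` and `M` are variables tied to the actual series by equations, so the argument runs on
-- abstract series. The required length 3k + 1 of the list is the exponent of X in front of the
-- polynomial in v.
U-times-power : ∀ k L M {a g} → M ≡ fromSeries a → a ≈ x → L ≡ laurent 2 g → g ≈ z * x ^ k →
  ∀ cs → length (reverse cs) ≡ suc (k ℕ.* 3) →
  Agree (extract (suc (k ℕ.* 4))) (compose (reverse cs) (+ 1 ∷ - + 8 ∷ [])) → reverse (reverse cs) ≡ cs →
  ∀ n → U (coeffL L) n ≡ coeffL (polyL (+ 0 ∷ cs) M) n
U-times-power k _ _ {g = g} refl a≈x refl g≈ cs len agree rev = U-coeffL a≈x g (+ 0 ∷ cs) λ j → trans
  (U-series (suc (k ℕ.* 4)) (suc (k ℕ.* 3)) (≈-trans g≈ (zx^k k)) j)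
  (at (≈-trans (*-congʳ (≡⇒≈ (cong (x ^_) (sym len)))) (extract-eval (suc (k ℕ.* 4)) cs agree rev)) j)

ξX^ : ∀ {f} k → f ≈ x ^ k → ser ξ *S f ≈ z * x ^ k
ξX^ {f} k p = ≈-trans (≡⇒≈ (*S≡* (ser ξ) f)) (*-cong ξ≈z p)

X^≈x^ : ∀ {f} k → f ≈ x ^ k → ser X *S f ≈ x ^ suc k
X^≈x^ {f} k p = ≈-trans (≡⇒≈ (*S≡* (ser X) f)) (*-cong X≈x p)

theorem2p4 : ((n : ℤ) → U (coeffL ξ) n ≡ coeffL (polyL (+ 0 ∷ + 9 ∷ []) X) n)
    × ((n : ℤ) → U (coeffL (ξ *L X)) n
    ≡ coeffL (polyL (+ 0 ∷ - + 9 ∷ + 252 ∷ - + 891 ∷ + 729 ∷ []) X) n)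
    × ((n : ℤ) → U (coeffL (ξ *L (X ^L 2))) n
    ≡ coeffL (polyL (+ 0 ∷ + 1 ∷ - + 378 ∷ + 8613 ∷ - + 54675 ∷ + 138510 ∷ - + 150903 ∷ + 59049 ∷ []) X) n)
    × ((n : ℤ) → U (coeffL (ξ *L (X ^L 3))) n
    ≡ coeffL (polyL (+ 0 ∷ + 0 ∷ + 147 ∷ - + 14553 ∷ + 312255 ∷ - + 2617839 ∷ + 10764414 ∷ - + 23914845 ∷ + 29288304 ∷ - + 18600435 ∷ + 4782969 ∷ []) X) n)
theorem2p4 =
    U-times-power 0 ξ X refl X≈x refl (≈-trans ξ≈z (≈-sym (*-identityʳ z)))
      (+ 9 ∷ []) refl _ refl
  , U-times-power 1 (ξ *L X) X refl X≈x refl (ξX^ 1 (≈-trans X≈x (≈-sym (*-identityʳ x))))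
      (- + 9 ∷ + 252 ∷ - + 891 ∷ + 729 ∷ []) refl _ refl
  , U-times-power 2 (ξ *L (X ^L 2)) X refl X≈x refl (ξX^ 2 (X^≈x^ 1 (X^≈x^ 0 ≈-refl)))
      (+ 1 ∷ - + 378 ∷ + 8613 ∷ - + 54675 ∷ + 138510 ∷ - + 150903 ∷ + 59049 ∷ []) refl _ refl
  , U-times-power 3 (ξ *L (X ^L 3)) X refl X≈x refl (ξX^ 3 (X^≈x^ 2 (X^≈x^ 1 (X^≈x^ 0 ≈-refl))))
      -- The list needs ten entries, but (1 + W)² P^13 has degree 28, so its part of exponents 3j +
      -- 2 stops at j = 8; hence the coefficient of X vanishes.
      (+ 0 ∷ + 147 ∷ - + 14553 ∷ + 312255 ∷ - + 2617839 ∷ + 10764414 ∷ - + 23914845 ∷ + 29288304 ∷ - + 18600435 ∷ + 4782969 ∷ [])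
      refl _ refl
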